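{- For integers $n,k,r$, the number of contracted Grassmannian trees of type $(k,n)$ with momentum amplituhedron dimension $r$ equals $[x^ny^kq^r]\mathcal G_{\mathrm{tree}}(x,y,q)$, where $$\mathcal G_{\mathrm{tree}}(x,y,q)=x\left(1+y+yq\,C^{\langle-1\rangle}(x,y,q)\right),$$ $$C(x,y,q)=\frac{x\left(1-x(1+y)q^2-x^2yq^2(1+q-q^2)-x^4y^2q^5(1+q)\right)}{(1+xq)(1+xyq)(1-xq^2)(1-xyq^2)},$$ with compositional inverse taken with respect to $x$. The number of contracted Grassmannian forests of type $(k,n)$ with momentum amplituhedron dimension $r$ equals $[x^ny^kq^r]\mathcal G_{\mathrm{forest}}(x,y,q)$, where $$x\,\mathcal G_{\mathrm{forest}}(x,y,q)=\left(\frac{x}{1+\mathcal G_{\mathrm{tree}}(x,y,q)}\right)^{\langle-1\rangle}$$ (compositional inverse in $x$); equivalently, $[x^n]\mathcal G_{\mathrm{forest}}(x,y,q)=\frac1{n+1}[x^n]\left(1+\mathcal G_{\mathrm{tree}}(x,y,q)\right)^{n+1}$.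
   Context: A Grassmannian graph is a finite planar graph embedded in a closed disk with $n$ boundary vertices $b_1,\dots,b_n$ of degree $1$ on the boundary circle, labelled clockwise; all other vertices (internal vertices) lie in the interior, each is connected by a path to the boundary, and no vertex has degree $2$. Each internal vertex $v$ carries an integer helicity $h(v)$: if $v$ is a boundary leaf (an internal vertex of degree $1$ adjacent to a boundary vertex) then $h(v)\in\{0,1\}$; otherwise $1\le h(v)\le\deg(v)-1$. An internal vertex is white if $h(v)=1$, black if $h(v)=\deg(v)-1$, generic otherwise. The helicity of the graph $G$ is $h(G)=\sum_{v\text{ internal}}\left(h(v)-\frac{\deg v}{2}\right)+\frac n2$, and $G$ has type $(k,n)$ if $h(G)=k$. A Grassmannian forest (tree) is an acyclic (connected acyclic) Grassmannian graph; it is contracted if no two adjacent internal vertices are both white and no two adjacent internal vertices are both black. Graphs are counted up to isotopy of the disk fixing the labelled boundary vertices (the empty forest with $n=0$ is allowed). Momentum amplituhedron dimension: for an internal vertex $v$ let $m(v)=2\deg(v)-4$ if $v$ is generic and $m(v)=\deg(v)-1$ otherwise; for a tree $T$ with $n$ boundary vertices, $\dim_{\mathcal M}(T)=n-1$ if $n\le2$ and $1+\sum_{v\text{ internal}}(m(v)-1)$ otherwise; for a forest, $\dim_{\mathcal M}$ is the sum over its connected components (each a tree on its own boundary vertices). Compositional inverse $f^{\langle -1\rangle}$ of a series $f\in x\,\mathbb Q(y,q)[[x]]$ with nonzero coefficient of $x$ is the series with $f(f^{\langle-1\rangle}(x))=f^{\langle-1\rangle}(f(x))=x$; $[x^ny^kq^r]$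 denotes coefficient extraction. -}

module Defs where

open import Data.Bool using (Bool; true; false; _∧_; _∨_; not; if_then_else_; T)
open import Data.Nat as ℕ using (ℕ; zero; suc; _≡ᵇ_; _≤ᵇ_; _<ᵇ_; _∸_)
open import Data.Integer as ℤ using (ℤ; +_; -[1+_])
open import Data.List using (List; []; _∷_; length; map; upTo)
open import Data.Bool.ListAction using (all; any)
open import Data.Product using (Σ; _×_; _,_; proj₁; proj₂)
open import Relation.Binary.PropositionalEquality using (_≡_)
open import Relation.Nullary.Decidable using (⌊_⌋)

-- Formal power series in x, y, q with integer coefficients
-- (a series s has coefficient  s a b c  at  x^a y^b q^c).

Ser : Set
Ser = ℕ → ℕ → ℕ → ℤ

Σ≤ : ℕ → (ℕ → ℤ) → ℤ
Σ≤ zero    f = f zero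
Σ≤ (suc n) f = Σ≤ n f ℤ.+ f (suc n)

𝟙 X Y Q : Ser
𝟙 zero zero zero = + 1
𝟙 _    _    _    = + 0
X (suc zero) zero zero = + 1
X _ _ _ = + 0
Y zero (suc zero) zero = + 1
Y _ _ _ = + 0
Q zero zero (suc zero) = + 1
Q _ _ _ = + 0

infixl 6 _⊕_ _⊖_
infixl 7 _⊗_

_⊕_ : Ser → Ser → Ser
(f ⊕ g) a b c = f a b c ℤ.+ g a b c

neg : Ser → Ser
neg f a b c = ℤ.- f a b c

_⊖_ : Ser → Ser → Ser
f ⊖ g = f ⊕ neg g

_⊗_ : Ser → Ser → Ser
(f ⊗ g) a b c =
  Σ≤ a λ i → Σ≤ b λ j → Σ≤ c λ l → f i j l ℤ.* g (a ∸ i) (b ∸ j) (c ∸ l)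

pow : Ser → ℕ → Ser
pow g zero    = 𝟙
pow g (suc m) = g ⊗ pow g m

infix 4 _≈_
_≈_ : Ser → Ser → Set
f ≈ g = ∀ a b c → f a b c ≡ g a b c

ZeroAtX0 : Ser → Set
ZeroAtX0 g = ∀ b c → g zero b c ≡ + 0

xcoef : Ser → ℕ → Ser
xcoef f m zero b c    = f m b c
xcoef f m (suc _) _ _ = + 0

-- composition in x:  (f ∘ g)(x) = Σ_m f_m(y,q) g(x)^m ; this is the
-- composition of formal power series when g has zero constant term in x
-- (then only m ≤ a contributes to the coefficient of x^a).
comp : Ser → Ser → Ser
comp f g a b c = Σ≤ a λ m → (xcoef f m ⊗ pow g m) a b c

coeff : Ser → ℕ → ℤ → ℤ → ℤ
coeff s n (+ k) (+ r) = s n k r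
coeff s n _     _     = + 0

Cnum : Ser
Cnum = X ⊗ (𝟙 ⊖ X ⊗ (𝟙 ⊕ Y) ⊗ pow Q 2
                ⊖ pow X 2 ⊗ Y ⊗ pow Q 2 ⊗ (𝟙 ⊕ Q ⊖ pow Q 2)
                ⊖ pow X 4 ⊗ pow Y 2 ⊗ pow Q 5 ⊗ (𝟙 ⊕ Q))

Cden : Ser
Cden = (𝟙 ⊕ X ⊗ Q) ⊗ (𝟙 ⊕ X ⊗ Y ⊗ Q) ⊗ (𝟙 ⊖ X ⊗ pow Q 2) ⊗ (𝟙 ⊖ X ⊗ Y ⊗ pow Q 2)

Gtree : Ser → Ser
Gtree Cinv = X ⊗ (𝟙 ⊕ Y ⊕ Y ⊗ Q ⊗ Cinv)

-- Grassmannian trees up to isotopy.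
--
-- A Grassmannian tree with n ≥ 2 boundary vertices, up to isotopy of the
-- disk fixing b_1..b_n, is encoded canonically as the plane tree rooted
-- at b_1: b_1 is joined to a vertex t (a 'Tr').  A 'Tr' is either a
-- boundary vertex 'bd', or an internal vertex 'nd h cs' of helicity h
-- whose children cs are listed in clockwise order starting after the
-- edge to its parent (so deg = length cs + 1).  The boundary vertices
-- met in this order are b_2, ..., b_n.
-- The case n = 1 is 'single h': b_1 joined to a boundary leaf of
-- helicity h.

data Tr : Set where
  bd : Tr
  nd : ℕ → List Tr → Tr

data GTree : Set where
  single : ℕ → GTree
  rooted : Tr → GTree

_==ℤ_ : ℤ → ℤ → Bool
a ==ℤ b = ⌊ a ℤ.≟ b ⌋

mutual
  leavesT : Tr → ℕ
  leavesT bd        = 1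
  leavesT (nd _ cs) = leavesL cs

  leavesL : List Tr → ℕ
  leavesL []       = 0
  leavesL (t ∷ ts) = leavesT t ℕ.+ leavesL ts

-- validity: internal (non-leaf) vertices have degree ≥ 3 (no degree 2,
-- and no internal degree-1 vertex other than a boundary leaf) and
-- 1 ≤ h ≤ deg - 1
mutual
  validT : Tr → Bool
  validT bd        = true
  validT (nd h cs) = (2 ≤ᵇ length cs) ∧ (1 ≤ᵇ h) ∧ (h ≤ᵇ length cs) ∧ validL cs

  validL : List Tr → Bool
  validL []       = true
  validL (t ∷ ts) = validT t ∧ validL ts

isWhite isBlack : Tr → Bool
isWhite bd        = false
isWhite (nd h cs) = h ≡ᵇ 1
isBlack bd        = false
isBlack (nd h cs) = h ≡ᵇ length cs        -- h = deg - 1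

mutual
  contrT : Tr → Bool
  contrT bd        = true
  contrT (nd h cs) = contrL (nd h cs) cs

  contrL : Tr → List Tr → Bool
  contrL p []       = true
  contrL p (c ∷ cs) =
    not (isWhite p ∧ isWhite c) ∧ not (isBlack p ∧ isBlack c) ∧ contrT c ∧ contrL p cs

mutual
  hsumT : Tr → ℤ
  hsumT bd        = + 0
  hsumT (nd h cs) = (+ (2 ℕ.* h) ℤ.- + suc (length cs)) ℤ.+ hsumL cs

  hsumL : List Tr → ℤ
  hsumL []       = + 0
  hsumL (t ∷ ts) = hsumT t ℤ.+ hsumL ts

mval : ℕ → ℕ → ℤ
mval h d = if (1 <ᵇ h) ∧ (h <ᵇ d ∸ 1)
           then + (2 ℕ.* d) ℤ.- + 4
           else + d ℤ.- + 1

mutual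
  dsumT : Tr → ℤ
  dsumT bd        = + 0
  dsumT (nd h cs) = (mval h (suc (length cs)) ℤ.- + 1) ℤ.+ dsumL cs

  dsumL : List Tr → ℤ
  dsumL []       = + 0
  dsumL (t ∷ ts) = dsumT t ℤ.+ dsumL ts

nbd : GTree → ℕ
nbd (single _) = 1
nbd (rooted t) = suc (leavesT t)

validG : GTree → Bool
validG (single h) = h ≤ᵇ 1
validG (rooted t) = validT t

contrG : GTree → Bool
contrG (single _) = true
contrG (rooted t) = contrT t

intHel : GTree → ℤ
intHel (single h) = + (2 ℕ.* h) ℤ.- + 1
intHel (rooted t) = hsumT t

twiceHelG : GTree → ℤ
twiceHelG g = intHel g ℤ.+ + nbd g

dimG : GTree → ℤ
dimG g with nbd g ≤ᵇ 2
dimG g | true  = + nbd g ℤ.- + 1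
dimG (single h) | false = + 1 ℤ.+ (mval h 1 ℤ.- + 1)
dimG (rooted t) | false = + 1 ℤ.+ dsumT t

isCTree : ℕ → ℤ → ℤ → GTree → Bool
isCTree n k r g =
  validG g ∧ contrG g ∧ (nbd g ≡ᵇ n) ∧ (twiceHelG g ==ℤ (+ 2 ℤ.* k)) ∧ (dimG g ==ℤ r)

CTree : ℕ → ℤ → ℤ → Set
CTree n k r = Σ GTree λ g → T (isCTree n k r g)

-- Grassmannian forests up to isotopy: a list of components
-- (B , g) where B is the strictly increasing list of labels i of the
-- boundary vertices b_i of the component and g its tree (boundary
-- vertices of g, in the clockwise order starting at its first one,
-- are the b_i, i ∈ B, in increasing order).  The blocks form a
-- noncrossing set partition of {1..n}, listed by increasing minimum.

Forest : Set
Forest = List (List ℕ × GTree)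

strictInc : List ℕ → Bool
strictInc []           = true
strictInc (a ∷ [])     = true
strictInc (a ∷ b ∷ bs) = (a <ᵇ b) ∧ strictInc (b ∷ bs)

inRange : ℕ → List ℕ → Bool
inRange n = all (λ i → (1 ≤ᵇ i) ∧ (i ≤ᵇ n))

member : ℕ → List ℕ → Bool
member i = any (λ j → i ≡ᵇ j)

countIn : ℕ → List (List ℕ) → ℕ
countIn i []       = 0
countIn i (B ∷ Bs) = (if member i B then 1 else 0) ℕ.+ countIn i Bs

covers : ℕ → List (List ℕ) → Bool
covers n Bs = all (λ i → countIn (suc i) Bs ≡ᵇ 1) (upTo n)

noCross : List ℕ → List ℕ → Bool
noCross P Q = not (any (λ a → any (λ b → any (λ c → any (λ d →
  (a <ᵇ b) ∧ (b <ᵇ c) ∧ (c <ᵇ d)) Q) P) Q) P)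

noncrossingAll : List (List ℕ) → Bool
noncrossingAll []       = true
noncrossingAll (B ∷ Bs) = all (λ C → noCross B C ∧ noCross C B) Bs ∧ noncrossingAll Bs

headOr0 : List ℕ → ℕ
headOr0 []      = 0
headOr0 (a ∷ _) = a

minsInc : List (List ℕ) → Bool
minsInc Bs = strictInc (map headOr0 Bs)

componentOK : ℕ → List ℕ × GTree → Bool
componentOK n (B , g) =
  strictInc B ∧ inRange n B ∧ (length B ≡ᵇ nbd g) ∧ validG g ∧ contrG g

sumℤ : List ℤ → ℤ
sumℤ []       = + 0
sumℤ (a ∷ as) = a ℤ.+ sumℤ as

twiceHelF : ℕ → Forest → ℤ
twiceHelF n F = sumℤ (map (λ p → intHel (proj₂ p)) F) ℤ.+ + n

dimF : Forest → ℤ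
dimF F = sumℤ (map (λ p → dimG (proj₂ p)) F)

isCForest : ℕ → ℤ → ℤ → Forest → Bool
isCForest n k r F =
  all (componentOK n) F ∧ covers n (map proj₁ F) ∧ minsInc (map proj₁ F)
  ∧ noncrossingAll (map proj₁ F)
  ∧ (twiceHelF n F ==ℤ (+ 2 ℤ.* k)) ∧ (dimF F ==ℤ r)

CForest : ℕ → ℤ → ℤ → Set
CForest n k r = Σ Forest λ F → T (isCForest n k r F)

{-# OPTIONS --safe #-}

-- Let T, W and B count the trees hanging from b₁, those with a white top vertex, and those with a black one.
-- A white top vertex with first child u comes from u and one further tree t, whose top vertex is merged into it
-- when t is white; as u is not white, W = q (T - W) T, and likewise B = y q (T - B) T. Generic vertices grow out of
-- those with three children by inserting first children. Solving these equations shows that C(T) = x.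
--
-- In a forest, the component of the first label with m boundary vertices leaves m gaps, filled by arbitrary forests.
-- More generally, forests inside a block with r labels still to come are counted by G (x G)ʳ, so that
-- G = Σ tₘ (x G)ᵐ, where tₘ are the coefficients of 1 + G_tree. This is the equation that defines G_forest.
--
-- The explicit coefficients are Lagrange inversion: with φ H = x and θ = x d/dx, the coefficient of xᴺ in φᴺ θ(Hᵏ)
-- is N if k = N and vanishes for k < N, and one applies φᴺ θ to Σ Fₖ Hᵏ = x.
module Submission where

open import Level using (0ℓ)
open import Algebra using (CommutativeRing)
import Algebra.Solver.Ring
open import Algebra.Solver.Ring.AlmostCommutativeRing using (fromCommutativeRing; _-Raw-AlmostCommutative⟶_)
open import Data.Integer as ℤ using (ℤ; +_)
import Data.Integer.Properties as ℤₚ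
open import Data.Maybe using (Maybe; just; nothing)
open import Data.Nat as ℕ using (ℕ; zero; suc; _∸_; _≤_; _<_; z≤n; s≤s; _≡ᵇ_; _<ᵇ_)
import Data.Nat.Properties as ℕₚ
open import Data.Product using (_,_)
open import Data.Sum using (_⊎_; inj₁; inj₂)
open import Relation.Nullary using (¬_; yes; no)
open import Relation.Binary.PropositionalEquality as ≡ using (_≡_; _≢_)

-- Formal power series over a commutative ring

-- The equations for trees and forests are used against the direction of their discovery. No
-- generating function is formed from counts: the given inverse of `C` is shown to satisfy the
-- equations for T, W, B and the generic trees, and strong induction on the number of leaves then
-- shows that its coefficients count. Forests are treated in the same way. Hence counting is stated
-- for one power of x at a time, and every product has to be seen to involve smaller sizes only.
--
-- A tree with at least two boundary vertices has helicity 1 + Σ (h - 1) and dimension 1 + Σ (m -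
-- 1), so both exponents are additive over vertices. A further child raises m by 1 at a white or
-- black vertex and by 2 at a generic one. Solving for W, B and the generic part G in terms of T
-- gives W = qT²/(1 + qT), B = yqT²/(1 + yqT) and G = yq³T³/((1 - q²T)(1 - yq²T)); `C` is T - W - B
-- - G over a common denominator, with x written for T.
--
-- The coefficients are integers, so Lagrange inversion keeps its factor n + 1 on the left instead
-- of dividing by it.

module Series (R : CommutativeRing 0ℓ 0ℓ) where
  open CommutativeRing R hiding (zero)
  open import Algebra.Properties.CommutativeSemigroup +-commutativeSemigroup
    using () renaming (interchange to +-interchange)
  open import Relation.Binary.Reasoning.Setoid setoid

  sum : ℕ → (ℕ → Carrier) → Carrier
  sum zero    f = f zero
  sum (suc n) f = sum n f + f (suc n)

  sum-cong : ∀ n {f g} → (∀ i → i ≤ n → f i ≈ g i) → sum n f ≈ sum n g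
  sum-cong zero    h = h zero z≤n
  sum-cong (suc n) h = +-cong (sum-cong n λ i p → h i (ℕₚ.m≤n⇒m≤1+n p)) (h (suc n) ℕₚ.≤-refl)

  sum-0 : ∀ n {f} → (∀ i → i ≤ n → f i ≈ 0#) → sum n f ≈ 0#
  sum-0 zero    h = h zero z≤n
  sum-0 (suc n) h = trans (+-cong (sum-0 n λ i p → h i (ℕₚ.m≤n⇒m≤1+n p)) (h (suc n) ℕₚ.≤-refl)) (+-identityˡ 0#)

  sum-+ : ∀ n f g → sum n (λ i → f i + g i) ≈ sum n f + sum n g
  sum-+ zero    f g = refl
  sum-+ (suc n) f g = trans (+-congʳ (sum-+ n f g)) (+-interchange _ _ _ _)

  sum-*ˡ : ∀ n r f → sum n (λ i → r * f i) ≈ r * sum n f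
  sum-*ˡ zero    r f = refl
  sum-*ˡ (suc n) r f = trans (+-congʳ (sum-*ˡ n r f)) (sym (distribˡ _ _ _))

  sum-suc : ∀ n f → sum (suc n) f ≈ f 0 + sum n (λ i → f (suc i))
  sum-suc zero    f = refl
  sum-suc (suc n) f = trans (+-congʳ (sum-suc n f)) (+-assoc _ _ _)

  -- a record, so that unification does not unfold the two series
  infix 4 _≋_
  record _≋_ (f g : ℕ → Carrier) : Set where
    constructor mk
    field at : ∀ n → f n ≈ g n
  open _≋_ public

  infixl 6 _+ˢ_
  infixl 7 _*ˢ_ _·_
  infix 8 -ˢ_

  _+ˢ_ _*ˢ_ : (ℕ → Carrier) → (ℕ → Carrier) → ℕ → Carrier
  (f +ˢ g) n = f n + g n
  (f *ˢ g) n = sum n (λ i → f i * g (n ∸ i))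

  -ˢ_ : (ℕ → Carrier) → ℕ → Carrier
  (-ˢ f) n = - f n

  const : Carrier → ℕ → Carrier
  const r zero    = r
  const r (suc _) = 0#

  0ˢ 1ˢ x : ℕ → Carrier
  0ˢ _ = 0#
  1ˢ = const 1#
  x zero          = 0#
  x (suc zero)    = 1#
  x (suc (suc _)) = 0#

  _·_ : Carrier → (ℕ → Carrier) → ℕ → Carrier
  (r · f) n = r * f n

  tail : (ℕ → Carrier) → ℕ → Carrier
  tail f n = f (suc n)

  *-cong≤ : ∀ n {f f′ g g′} → (∀ i → i ≤ n → f i ≈ f′ i) → (∀ i → i ≤ n → g i ≈ g′ i) →
            (f *ˢ g) n ≈ (f′ *ˢ g′) n
  *-cong≤ n p q = sum-cong n λ i i≤n → *-cong (p i i≤n) (q (n ∸ i) (ℕₚ.m∸n≤m n i))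

  *-sucˡ : ∀ f g n → (f *ˢ g) (suc n) ≈ f 0 * g (suc n) + (tail f *ˢ g) n
  *-sucˡ f g n = sum-suc n _

  *-sucʳ : ∀ f g n → (f *ˢ g) (suc n) ≈ (f *ˢ tail g) n + f (suc n) * g 0
  *-sucʳ f g n = +-cong
    (sum-cong n λ i i≤n → *-congˡ (reflexive (≡.cong g (ℕₚ.+-∸-assoc 1 i≤n))))
    (*-congˡ (reflexive (≡.cong g (ℕₚ.n∸n≡0 n))))

  -- Removing the constant term of `f` from the left of one product matches removing it from the
  -- right of the other, so induction on the degree replaces a reversal of the sum.
  *ˢ-comm′ : ∀ n f g → (f *ˢ g) n ≈ (g *ˢ f) n
  *ˢ-comm′ zero    f g = *-comm _ _
  *ˢ-comm′ (suc n) f g = begin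
    (f *ˢ g) (suc n)                    ≈⟨ *-sucˡ f g n ⟩
    f 0 * g (suc n) + (tail f *ˢ g) n   ≈⟨ +-cong (*-comm _ _) (*ˢ-comm′ n (tail f) g) ⟩
    g (suc n) * f 0 + (g *ˢ tail f) n   ≈⟨ +-comm _ _ ⟩
    (g *ˢ tail f) n + g (suc n) * f 0   ≈⟨ *-sucʳ g f n ⟨
    (g *ˢ f) (suc n)                    ∎

  *ˢ-distribʳ′ : ∀ n h f g → ((f +ˢ g) *ˢ h) n ≈ (f *ˢ h) n + (g *ˢ h) n
  *ˢ-distribʳ′ n h f g = trans (sum-cong n λ i _ → distribʳ _ _ _) (sum-+ n _ _)

  ·-*ˢ : ∀ n r f g → ((r · f) *ˢ g) n ≈ r * (f *ˢ g) n
  ·-*ˢ n r f g = trans (sum-cong n λ i _ → *-assoc _ _ _) (sum-*ˡ n r _)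

  -- The tail obeys tail (f g) = f₀ tail g + (tail f) g, which reduces degree n + 1 to degree n.
  *ˢ-assoc′ : ∀ n f g h → ((f *ˢ g) *ˢ h) n ≈ (f *ˢ (g *ˢ h)) n
  *ˢ-assoc′ zero    f g h = *-assoc _ _ _
  *ˢ-assoc′ (suc n) f g h = begin
    ((f *ˢ g) *ˢ h) (suc n)
      ≈⟨ *-sucˡ (f *ˢ g) h n ⟩
    f 0 * g 0 * h (suc n) + (tail (f *ˢ g) *ˢ h) n
      ≈⟨ +-cong (*-assoc _ _ _) (*-cong≤ n {g = h} (λ i _ → *-sucˡ f g i) (λ _ _ → refl)) ⟩
    f 0 * (g 0 * h (suc n)) + ((f 0 · tail g +ˢ tail f *ˢ g) *ˢ h) n
      ≈⟨ +-congˡ (*ˢ-distribʳ′ n h _ _) ⟩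
    f 0 * (g 0 * h (suc n)) + (((f 0 · tail g) *ˢ h) n + ((tail f *ˢ g) *ˢ h) n)
      ≈⟨ +-congˡ (+-cong (·-*ˢ n (f 0) (tail g) h) (*ˢ-assoc′ n (tail f) g h)) ⟩
    f 0 * (g 0 * h (suc n)) + (f 0 * (tail g *ˢ h) n + (tail f *ˢ (g *ˢ h)) n)
      ≈⟨ +-assoc _ _ _ ⟨
    f 0 * (g 0 * h (suc n)) + f 0 * (tail g *ˢ h) n + (tail f *ˢ (g *ˢ h)) n
      ≈⟨ +-congʳ (distribˡ _ _ _) ⟨
    f 0 * (g 0 * h (suc n) + (tail g *ˢ h) n) + (tail f *ˢ (g *ˢ h)) n
      ≈⟨ +-congʳ (*-congˡ (*-sucˡ g h n)) ⟨
    f 0 * (g *ˢ h) (suc n) + (tail f *ˢ (g *ˢ h)) n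
      ≈⟨ *-sucˡ f (g *ˢ h) n ⟨
    (f *ˢ (g *ˢ h)) (suc n) ∎

  const-*ˢ : ∀ r f n → (const r *ˢ f) n ≈ r * f n
  const-*ˢ r f zero    = refl
  const-*ˢ r f (suc n) = begin
    (const r *ˢ f) (suc n)             ≈⟨ *-sucˡ (const r) f n ⟩
    r * f (suc n) + (0ˢ *ˢ f) n        ≈⟨ +-congˡ (sum-0 n λ i _ → zeroˡ _) ⟩
    r * f (suc n) + 0#                 ≈⟨ +-identityʳ _ ⟩
    r * f (suc n)                      ∎

  x-*ˢ-suc : ∀ f n → (x *ˢ f) (suc n) ≈ f n
  x-*ˢ-suc f n = begin
    (x *ˢ f) (suc n)                   ≈⟨ *-sucˡ x f n ⟩
    0# * f (suc n) + (tail x *ˢ f) n   ≈⟨ +-cong (zeroˡ _) (*-cong≤ n {g = f} (λ { zero _ → refl ; (suc _) _ → refl }) (λ _ _ → refl)) ⟩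
    0# + (1ˢ *ˢ f) n                   ≈⟨ +-identityˡ _ ⟩
    (1ˢ *ˢ f) n                        ≈⟨ const-*ˢ 1# f n ⟩
    1# * f n                           ≈⟨ *-identityˡ _ ⟩
    f n                                ∎

  x-*ˢ-zero : ∀ f → (x *ˢ f) 0 ≈ 0#
  x-*ˢ-zero f = zeroˡ _

  -- Being a ring again, it can serve as coefficient ring: the construction is applied for q, then
  -- y, then x.
  seriesRing : CommutativeRing 0ℓ 0ℓ
  seriesRing = record
    { Carrier = ℕ → Carrier
    ; _≈_ = _≋_
    ; _+_ = _+ˢ_
    ; _*_ = _*ˢ_
    ; -_  = -ˢ_
    ; 0#  = 0ˢ
    ; 1#  = 1ˢ
    ; isCommutativeRing = record
      { isRing = record
        { +-isAbelianGroup = record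
          { isGroup = record
            { isMonoid = record
              { isSemigroup = record
                { isMagma = record
                  { isEquivalence = record
                    { refl  = mk λ _ → refl
                    ; sym   = λ p → mk λ n → sym (at p n)
                    ; trans = λ p q → mk λ n → trans (at p n) (at q n)
                    }
                  ; ∙-cong = λ p q → mk λ n → +-cong (at p n) (at q n)
                  }
                ; assoc = λ f g h → mk λ n → +-assoc _ _ _
                }
              ; identity = (λ f → mk λ n → +-identityˡ _) , (λ f → mk λ n → +-identityʳ _)
              }
            ; inverse = (λ f → mk λ n → -‿inverseˡ _) , (λ f → mk λ n → -‿inverseʳ _)
            ; ⁻¹-cong = λ p → mk λ n → -‿cong (at p n)
            }
          ; comm = λ f g → mk λ n → +-comm _ _
          }
        ; *-cong = λ p q → mk λ n → *-cong≤ n (λ i _ → at p i) (λ i _ → at q i)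
        ; *-assoc = λ f g h → mk λ n → *ˢ-assoc′ n f g h
        ; *-identity = (λ f → mk λ n → 1ˢ-*ˢ f n) , (λ f → mk λ n → trans (*ˢ-comm′ n f 1ˢ) (1ˢ-*ˢ f n))
        ; distrib = (λ h f g → mk λ n → trans (*ˢ-comm′ n h (f +ˢ g)) (trans (*ˢ-distribʳ′ n h f g) (+-cong (*ˢ-comm′ n f h) (*ˢ-comm′ n g h))))
                  , (λ h f g → mk λ n → *ˢ-distribʳ′ n h f g)
        }
      ; *-comm = λ f g → mk λ n → *ˢ-comm′ n f g
      }
    }
    where
    1ˢ-*ˢ : ∀ f n → (1ˢ *ˢ f) n ≈ f n
    1ˢ-*ˢ f n = trans (const-*ˢ 1# f n) (*-identityˡ _)

  module S = CommutativeRing seriesRing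
  open import Algebra.Properties.Semiring.Exp S.semiring public using (_^_; ^-homo-*; ^-congˡ)
  open import Algebra.Properties.CommutativeSemiring.Exp S.commutativeSemiring using (^-distrib-*)
  open import Algebra.Properties.Semiring.Mult semiring using (_×_; ×-homo-+)
  open import Algebra.Properties.Group +-group using () renaming (∙-cancelˡ to +-cancelˡ; ∙-cancelʳ to +-cancelʳ)
  import Algebra.Solver.Ring.NaturalCoefficients.Default S.commutativeSemiring as Solver

  -- In degree k + 1 the product is g (k + 1) plus terms in lower coefficients of `g`, which agree
  -- with those of `h` by induction; no inverse of `f` is constructed.
  *-cancelˡ-unit : ∀ {f g h} → f 0 ≈ 1# → f *ˢ g ≋ f *ˢ h → g ≋ h
  *-cancelˡ-unit {f} {g} {h} f₀ e = mk λ n → below (suc n) n ℕₚ.≤-refl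
    where
    head : ∀ a → f 0 * a ≈ a
    head a = trans (*-congʳ f₀) (*-identityˡ a)
    below : ∀ n k → k < n → g k ≈ h k
    below (suc n) zero    _       = trans (sym (head _)) (trans (at e 0) (head _))
    below (suc n) (suc k) (s≤s p) = trans (sym (head _)) (trans (+-cancelʳ _ _ _ eq) (head _))
      where
      eq : f 0 * g (suc k) + (tail f *ˢ g) k ≈ f 0 * h (suc k) + (tail f *ˢ g) k
      eq = begin
        f 0 * g (suc k) + (tail f *ˢ g) k  ≈⟨ *-sucˡ f g k ⟨
        (f *ˢ g) (suc k)                   ≈⟨ at e (suc k) ⟩
        (f *ˢ h) (suc k)                   ≈⟨ *-sucˡ f h k ⟩
        f 0 * h (suc k) + (tail f *ˢ h) k
          ≈⟨ +-congˡ (*-cong≤ k {f = tail f} (λ _ _ → refl) λ i i≤k → below n i (ℕₚ.≤-trans (s≤s i≤k) p)) ⟨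
        f 0 * h (suc k) + (tail f *ˢ g) k  ∎

  x-cancelˡ : ∀ {f g} → x *ˢ f ≋ x *ˢ g → f ≋ g
  x-cancelˡ {f} {g} e = mk λ n → trans (sym (x-*ˢ-suc f n)) (trans (at e (suc n)) (x-*ˢ-suc g n))

  *-sumʳ : ∀ N n g (s : ℕ → ℕ → Carrier) →
           (g *ˢ λ k → sum N (λ m → s m k)) n ≈ sum N (λ m → (g *ˢ s m) n)
  *-sumʳ zero    n g s = refl
  *-sumʳ (suc N) n g s = begin
    (g *ˢ ((λ k → sum N (λ m → s m k)) +ˢ s (suc N))) n
      ≈⟨ at (S.distribˡ g (λ k → sum N (λ m → s m k)) (s (suc N))) n ⟩
    (g *ˢ λ k → sum N (λ m → s m k)) n + (g *ˢ s (suc N)) n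
      ≈⟨ +-congʳ (*-sumʳ N n g s) ⟩
    sum N (λ m → (g *ˢ s m) n) + (g *ˢ s (suc N)) n ∎

  *-scalarʳ : ∀ r f g n → (f *ˢ (r · g)) n ≈ r * (f *ˢ g) n
  *-scalarʳ r f g n = begin
    (f *ˢ (r · g)) n  ≈⟨ *ˢ-comm′ n f _ ⟩
    ((r · g) *ˢ f) n  ≈⟨ ·-*ˢ n r g f ⟩
    r * (g *ˢ f) n    ≈⟨ *-congˡ (*ˢ-comm′ n g f) ⟩
    r * (f *ˢ g) n    ∎

  *ˢ-order : ∀ n {f g} → f 0 ≈ 0# → (∀ k → k < n → g k ≈ 0#) → (f *ˢ g) n ≈ 0#
  *ˢ-order n {f} {g} f₀ g< = sum-0 n λ where
    zero    _   → trans (*-congʳ f₀) (zeroˡ _)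
    (suc i) i<n → trans (*-congˡ (g< (n ∸ suc i) (ℕₚ.∸-monoʳ-< {n} {suc i} {0} (s≤s z≤n) i<n))) (zeroʳ _)

  -- A factor without constant term delays the other one by a degree; inductions on the degree rest
  -- on this.
  *ˢ-below : ∀ n {f g h} → f 0 ≈ 0# → (∀ k → k < n → g k ≈ h k) → (f *ˢ g) n ≈ (f *ˢ h) n
  *ˢ-below n {f} {g} {h} f₀ e = sum-cong n λ where
    zero    _   → trans (trans (*-congʳ f₀) (zeroˡ _)) (sym (trans (*-congʳ f₀) (zeroˡ _)))
    (suc i) i<n → *-congˡ (e (n ∸ suc i) (ℕₚ.∸-monoʳ-< {n} {suc i} {0} (s≤s z≤n) i<n))

  ^-order : ∀ {g} → g 0 ≈ 0# → ∀ m n → n < m → (g ^ m) n ≈ 0#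
  ^-order {g} g₀ (suc m) n (s≤s n≤m) = *ˢ-order n {g} {g ^ m} g₀ λ k k<n → ^-order {g} g₀ m k (ℕₚ.≤-trans k<n n≤m)

  -- Composition of series

  psum : ℕ → (ℕ → Carrier) → (ℕ → Carrier) → ℕ → Carrier
  psum N f g n = sum N (λ m → f m * (g ^ m) n)

  compose : (ℕ → Carrier) → (ℕ → Carrier) → ℕ → Carrier
  compose f g n = psum n f g n

  -- In `compose` the truncation moves with the degree, which obstructs multiplication by another
  -- series. As g^m starts in degree m, a bound common to all degrees involved may be used instead.
  psum-stable : ∀ {g} → g 0 ≈ 0# → ∀ N n f → n ≤ N → psum N f g n ≈ compose f g n
  psum-stable g₀ zero    zero    f z≤n = refl
  psum-stable g₀ (suc N) n f n≤ with ℕₚ.m≤n⇒m<n∨m≡n n≤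
  ... | inj₂ ≡.refl = refl
  ... | inj₁ (s≤s n≤N) = begin
    psum N f _ n + f (suc N) * (_ ^ suc N) n  ≈⟨ +-congˡ (trans (*-congˡ (^-order g₀ (suc N) n (s≤s n≤N))) (zeroʳ _)) ⟩
    psum N f _ n + 0#                         ≈⟨ +-identityʳ _ ⟩
    psum N f _ n                              ≈⟨ psum-stable g₀ N n f n≤N ⟩
    compose f _ n                             ∎

  compose-congˡ : ∀ {f f′} g n → (∀ i → i ≤ n → f i ≈ f′ i) → compose f g n ≈ compose f′ g n
  compose-congˡ g n e = sum-cong n λ i i≤n → *-congʳ (e i i≤n)

  compose-+ : ∀ f h g n → compose (f +ˢ h) g n ≈ compose f g n + compose h g n
  compose-+ f h g n = trans (sum-cong n λ i _ → distribʳ _ _ _) (sum-+ n _ _)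

  compose-· : ∀ r f g n → compose (r · f) g n ≈ r * compose f g n
  compose-· r f g n = trans (sum-cong n λ i _ → *-assoc _ _ _) (sum-*ˡ n r _)

  compose-const : ∀ r g → compose (const r) g ≋ const r
  compose-const r g = mk λ where
    zero    → *-identityʳ r
    (suc n) → trans (sum-suc n _) (trans (+-cong (zeroʳ r) (sum-0 n λ _ _ → zeroˡ _)) (+-identityˡ 0#))

  module _ {g : ℕ → Carrier} (g₀ : g 0 ≈ 0#) where

    -- Horner's rule f(g) = f₀ + g (tail f)(g), from which the other laws of composition follow
    -- without expanding powers.
    compose-step : ∀ f → compose f g ≋ const (f 0) +ˢ g *ˢ compose (tail f) g
    compose-step f = mk λ n → begin
      compose f g n
        ≈⟨ psum-stable g₀ (suc n) n f (ℕₚ.n≤1+n n) ⟨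
      sum (suc n) (λ m → f m * (g ^ m) n)
        ≈⟨ sum-suc n _ ⟩
      f 0 * 1ˢ n + sum n (λ m → f (suc m) * (g *ˢ g ^ m) n)
        ≈⟨ +-cong (head n) (sum-cong n λ m _ → sym (*-scalarʳ (f (suc m)) g (g ^ m) n)) ⟩
      const (f 0) n + sum n (λ m → (g *ˢ (f (suc m) · (g ^ m))) n)
        ≈⟨ +-congˡ (sym (*-sumʳ n n g (λ m → f (suc m) · (g ^ m)))) ⟩
      const (f 0) n + (g *ˢ psum n (tail f) g) n
        ≈⟨ +-congˡ (*-cong≤ n {f = g} (λ _ _ → refl) λ k k≤n → psum-stable {g} g₀ n k (tail f) k≤n) ⟩
      const (f 0) n + (g *ˢ compose (tail f) g) n ∎
      where
      head : ∀ n → f 0 * 1ˢ n ≈ const (f 0) n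
      head zero    = *-identityʳ _
      head (suc n) = zeroʳ _

    compose-x : compose x g ≋ g
    compose-x = S.trans (compose-step x) (S.trans (S.+-cong zero-const (S.*-congˡ tail-x)) (S.trans (S.+-identityˡ _) (S.*-identityʳ g)))
      where
      zero-const : const 0# ≋ 0ˢ
      zero-const = mk λ { zero → refl ; (suc _) → refl }
      tail-x : compose (tail x) g ≋ 1ˢ
      tail-x = S.trans (mk λ n → compose-congˡ g n λ { zero _ → refl ; (suc _) _ → refl }) (compose-const 1# g)

    -- Horner's rule for f h and the product rule for tails lead back to the claim for `tail f` and
    -- `h`, multiplied by `g`. As `g` has no constant term, the claim is needed only in lower
    -- degrees.
    compose-* : ∀ f h → compose (f *ˢ h) g ≋ compose f g *ˢ compose h g
    compose-* f₀ h₀ = mk λ n → below (suc n) n f₀ h₀ ℕₚ.≤-refl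
      where
      below : ∀ n k f h → k < n → compose (f *ˢ h) g k ≈ (compose f g *ˢ compose h g) k
      below (suc n) k f h (s≤s k≤n) = begin
        compose (f *ˢ h) g k
          ≈⟨ at (compose-step (f *ˢ h)) k ⟩
        const (f 0 * h 0) k + (g *ˢ compose (tail (f *ˢ h)) g) k
          ≈⟨ +-congˡ (*ˢ-below k g₀ λ j j<k → tails j (ℕₚ.≤-trans j<k k≤n)) ⟩
        const (f 0 * h 0) k + (g *ˢ (const (f 0) *ˢ compose (tail h) g +ˢ compose (tail f) g *ˢ compose h g)) k
          ≈⟨ +-congʳ (const-* k) ⟩
        (const (f 0) *ˢ const (h 0) +ˢ g *ˢ (const (f 0) *ˢ compose (tail h) g +ˢ compose (tail f) g *ˢ compose h g)) k
          ≈⟨ at (Solver.solve 6 (λ a b g th tf ch → a :* b :+ g :* (a :* th :+ tf :* ch) := a :* (b :+ g :* th) :+ (g :* tf) :* ch)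
                 S.refl (const (f 0)) (const (h 0)) g (compose (tail h) g) (compose (tail f) g) (compose h g)) k ⟩
        (const (f 0) *ˢ (const (h 0) +ˢ g *ˢ compose (tail h) g) +ˢ (g *ˢ compose (tail f) g) *ˢ compose h g) k
          ≈⟨ at (S.+-congʳ {x = (g *ˢ compose (tail f) g) *ˢ compose h g} (S.*-congˡ {x = const (f 0)} (S.sym (compose-step h)))) k ⟩
        (const (f 0) *ˢ compose h g +ˢ (g *ˢ compose (tail f) g) *ˢ compose h g) k
          ≈⟨ at (S.sym (S.distribʳ (compose h g) (const (f 0)) (g *ˢ compose (tail f) g))) k ⟩
        ((const (f 0) +ˢ g *ˢ compose (tail f) g) *ˢ compose h g) k
          ≈⟨ at (S.*-congʳ {x = compose h g} (S.sym (compose-step f))) k ⟩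
        (compose f g *ˢ compose h g) k ∎
        where
        open Solver using (_:*_; _:+_; _:=_)
        const-* : ∀ k → const (f 0 * h 0) k ≈ (const (f 0) *ˢ const (h 0)) k
        const-* zero    = refl
        const-* (suc k) = sym (trans (const-*ˢ (f 0) (const (h 0)) (suc k)) (zeroʳ _))
        tails : ∀ j → j < n → compose (tail (f *ˢ h)) g j ≈ (const (f 0) *ˢ compose (tail h) g +ˢ compose (tail f) g *ˢ compose h g) j
        tails j j<n = begin
          compose (tail (f *ˢ h)) g j
            ≈⟨ compose-congˡ g j (λ i _ → *-sucˡ f h i) ⟩
          compose (f 0 · tail h +ˢ tail f *ˢ h) g j
            ≈⟨ compose-+ (f 0 · tail h) (tail f *ˢ h) g j ⟩
          compose (f 0 · tail h) g j + compose (tail f *ˢ h) g j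
            ≈⟨ +-cong (trans (compose-· (f 0) (tail h) g j) (sym (const-*ˢ (f 0) (compose (tail h) g) j))) (below n j (tail f) h j<n) ⟩
          (const (f 0) *ˢ compose (tail h) g +ˢ compose (tail f) g *ˢ compose h g) j ∎

  *-x^ : ∀ f k n → (f *ˢ x ^ k) (k ℕ.+ n) ≈ f n
  *-x^ f zero    n = at (S.*-identityʳ f) n
  *-x^ f (suc k) n = begin
    (f *ˢ (x *ˢ x ^ k)) (suc (k ℕ.+ n))  ≈⟨ at (Solver.solve 3 (λ f x y → f :* (x :* y) := x :* (f :* y)) S.refl f x (x ^ k)) (suc (k ℕ.+ n)) ⟩
    (x *ˢ (f *ˢ x ^ k)) (suc (k ℕ.+ n))  ≈⟨ x-*ˢ-suc (f *ˢ x ^ k) (k ℕ.+ n) ⟩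
    (f *ˢ x ^ k) (k ℕ.+ n)               ≈⟨ *-x^ f k n ⟩
    f n                                  ∎
    where open Solver using (_:*_; _:=_)

  -- Lagrange inversion

  ν : ℕ → Carrier
  ν n = n × 1#

  -- the Euler operator x d/dx
  θ : (ℕ → Carrier) → ℕ → Carrier
  θ f n = ν n * f n

  θ-cong : ∀ {f g} → f ≋ g → θ f ≋ θ g
  θ-cong e = mk λ n → *-congˡ (at e n)

  θ-* : ∀ f g → θ (f *ˢ g) ≋ θ f *ˢ g +ˢ f *ˢ θ g
  θ-* f g = mk λ n → begin
    ν n * sum n (λ i → f i * g (n ∸ i))
      ≈⟨ sum-*ˡ n (ν n) _ ⟨
    sum n (λ i → ν n * (f i * g (n ∸ i)))
      ≈⟨ sum-cong n (λ i i≤n → leibniz i (n ∸ i) (ℕₚ.m+[n∸m]≡n i≤n)) ⟩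
    sum n (λ i → θ f i * g (n ∸ i) + f i * θ g (n ∸ i))
      ≈⟨ sum-+ n _ _ ⟩
    (θ f *ˢ g +ˢ f *ˢ θ g) n ∎
    where
    import Algebra.Solver.Ring.NaturalCoefficients.Default commutativeSemiring as SolverR
    open SolverR using (_:*_; _:+_; _:=_)
    leibniz : ∀ i j {n} → i ℕ.+ j ≡ n → ν n * (f i * g j) ≈ ν i * f i * g j + f i * (ν j * g j)
    leibniz i j ≡.refl = trans (*-congʳ (×-homo-+ 1# i j))
      (SolverR.solve 4 (λ a b f g → (a :+ b) :* (f :* g) := a :* f :* g :+ f :* (b :* g)) refl (ν i) (ν j) (f i) (g j))

  θ-1 : θ 1ˢ ≋ 0ˢ
  θ-1 = mk λ { zero → zeroˡ _ ; (suc n) → zeroʳ _ }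

  -- The power rule multiplied by `f`, which avoids the exponent k - 1.
  θ-^ : ∀ f k → θ (f ^ k) *ˢ f ≋ const (ν k) *ˢ (f ^ k *ˢ θ f)
  θ-^ f zero    = S.trans (S.trans (S.*-congʳ {x = f} θ-1) (S.zeroˡ f))
                    (mk λ n → sym (trans (const-*ˢ 0# (1ˢ *ˢ θ f) n) (zeroˡ _)))
  θ-^ f (suc k) = S.trans (S.*-congʳ {x = f} (θ-* f (f ^ k)))
    (S.trans (Solver.solve 4 (λ a b c d → (a :* b :+ c :* d) :* c := b :* c :* a :+ c :* (d :* c)) S.refl (θ f) (f ^ k) f (θ (f ^ k)))
    (S.trans (S.+-congˡ (S.*-congˡ (θ-^ f k)))
    (S.trans (Solver.solve 4 (λ a b c d → b :* c :* a :+ c :* (d :* (b :* a)) := (con 1 :+ d) :* ((c :* b) :* a)) S.refl (θ f) (f ^ k) f (const (ν k)))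
    (S.*-congʳ {x = (f *ˢ f ^ k) *ˢ θ f} (mk λ { zero → refl ; (suc _) → +-identityʳ _ })))))
    where open Solver using (_:*_; _:+_; _:=_; con)

  θ-x : θ x ≋ x
  θ-x = mk λ { zero → zeroʳ _ ; (suc zero) → trans (*-identityʳ _) (+-identityʳ 1#) ; (suc (suc _)) → zeroʳ _ }

  module Lagrange
    (torsion-free : ∀ n r → ν (suc n) * r ≈ 0# → r ≈ 0#)
    {φ H : ℕ → Carrier} (φ₀ : φ 0 ≈ 1#) (φH : φ *ˢ H ≋ x)
    where

    open Solver using (_:*_; _:+_; _:=_)

    H₀ : H 0 ≈ 0#
    H₀ = trans (sym (*-identityˡ _)) (trans (*-congʳ (sym φ₀)) (at φH 0))

    -- Both sides are p k φ^(p+k-1) θφ; multiplying by `φ` makes the power rule applicable, and `φ`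
    -- cancels because its constant term is 1.
    θ-^-swap : ∀ p k → const (ν p) *ˢ (φ ^ p *ˢ θ (φ ^ k)) ≋ const (ν k) *ˢ (θ (φ ^ p) *ˢ φ ^ k)
    θ-^-swap p k = *-cancelˡ-unit φ₀
      (S.trans (Solver.solve 4 (λ f a b c → f :* (a :* (b :* c)) := a :* (b :* (c :* f))) S.refl φ (const (ν p)) (φ ^ p) (θ (φ ^ k)))
      (S.trans (S.*-congˡ (S.*-congˡ (θ-^ φ k)))
      (S.trans (Solver.solve 5 (λ a b c d e → a :* (b :* (c :* (d :* e))) := c :* ((a :* (b :* e)) :* d)) S.refl (const (ν p)) (φ ^ p) (const (ν k)) (φ ^ k) (θ φ))
      (S.trans (S.*-congˡ (S.*-congʳ {x = φ ^ k} (S.sym (θ-^ φ p))))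
      (Solver.solve 4 (λ f a b c → a :* ((b :* f) :* c) := f :* (a :* (b :* c))) S.refl φ (const (ν k)) (θ (φ ^ p)) (φ ^ k))))))

    φ^*H^ : ∀ k → φ ^ k *ˢ H ^ k ≋ x ^ k
    φ^*H^ k = S.trans (S.sym (^-distrib-* φ H k)) (^-congˡ k φH)

    θ-x^ : ∀ k → θ (x ^ k) ≋ const (ν k) *ˢ x ^ k
    θ-x^ k = x-cancelˡ (S.trans (S.*-comm _ _) (S.trans (θ-^ x k) (S.trans (S.*-congˡ (S.*-congˡ θ-x))
      (Solver.solve 3 (λ a b c → a :* (b :* c) := c :* (a :* b)) S.refl (const (ν k)) (x ^ k) x))))

    -- The Leibniz rule for φ^k H^k = x^k, multiplied by φ^p.
    φ^*θH^ : ∀ p k → φ ^ p *ˢ (φ ^ k *ˢ θ (H ^ k)) +ˢ φ ^ p *ˢ (θ (φ ^ k) *ˢ H ^ k) ≋ const (ν k) *ˢ (φ ^ p *ˢ x ^ k)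
    φ^*θH^ p k =
      S.trans (Solver.solve 3 (λ a b c → a :* b :+ a :* c := a :* (c :+ b)) S.refl (φ ^ p) (φ ^ k *ˢ θ (H ^ k)) (θ (φ ^ k) *ˢ H ^ k))
      (S.trans (S.*-congˡ (S.trans (S.sym (θ-* (φ ^ k) (H ^ k))) (S.trans (θ-cong (φ^*H^ k)) (θ-x^ k))))
      (Solver.solve 3 (λ a b c → a :* (b :* c) := b :* (a :* c)) S.refl (φ ^ p) (const (ν k)) (x ^ k)))

    -- The other Leibniz term θ(φ^k) H^k has no part in degree k: H^k starts there and θ kills
    -- constant terms.
    θH^-diagonal : ∀ k → (φ ^ k *ˢ θ (H ^ k)) k ≈ ν k
    θH^-diagonal k = begin
      (φ ^ k *ˢ θ (H ^ k)) k
        ≈⟨ +-identityʳ _ ⟨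
      (φ ^ k *ˢ θ (H ^ k)) k + 0#
        ≈⟨ +-congˡ (*ˢ-order k {θ (φ ^ k)} {H ^ k} (zeroˡ _) (^-order H₀ k)) ⟨
      (φ ^ k *ˢ θ (H ^ k)) k + (θ (φ ^ k) *ˢ H ^ k) k
        ≈⟨ +-cong (at (S.*-identityˡ (φ ^ k *ˢ θ (H ^ k))) k) (at (S.*-identityˡ (θ (φ ^ k) *ˢ H ^ k)) k) ⟨
      (φ ^ 0 *ˢ (φ ^ k *ˢ θ (H ^ k)) +ˢ φ ^ 0 *ˢ (θ (φ ^ k) *ˢ H ^ k)) k
        ≈⟨ at (φ^*θH^ 0 k) k ⟩
      (const (ν k) *ˢ (1ˢ *ˢ x ^ k)) k
        ≈⟨ const-*ˢ (ν k) (1ˢ *ˢ x ^ k) k ⟩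
      ν k * (1ˢ *ˢ x ^ k) k
        ≈⟨ *-congˡ (reflexive (≡.cong (1ˢ *ˢ x ^ k) (≡.sym (ℕₚ.+-identityʳ k)))) ⟩
      ν k * (1ˢ *ˢ x ^ k) (k ℕ.+ 0)
        ≈⟨ *-congˡ (*-x^ 1ˢ k 0) ⟩
      ν k * 1#
        ≈⟨ *-identityʳ _ ⟩
      ν k ∎

    -- Multiplying by p turns φᵖ θ(φᵏ) into k θ(φᵖ) φᵏ, whose product with Hᵏ is k θ(φᵖ) xᵏ;
    -- at degree k + p it cancels p k φᵖ xᵏ.
    θH^-off-diagonal : ∀ p k → (φ ^ (suc p ℕ.+ k) *ˢ θ (H ^ k)) (k ℕ.+ suc p) ≈ 0#
    θH^-off-diagonal p′ k = torsion-free p′ _ (+-cancelʳ z _ _ (trans total (sym (+-identityˡ z))))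
      where
      p = suc p′
      N = k ℕ.+ p
      A B : ℕ → Carrier
      A = φ ^ p *ˢ (φ ^ k *ˢ θ (H ^ k))
      B = φ ^ p *ˢ (θ (φ ^ k) *ˢ H ^ k)
      z = ν k * (ν p * (φ ^ p) p)
      swapped : const (ν p) *ˢ B ≋ const (ν k) *ˢ (θ (φ ^ p) *ˢ x ^ k)
      swapped =
        S.trans (Solver.solve 4 (λ a b c d → a :* (b :* (c :* d)) := (a :* (b :* c)) :* d) S.refl (const (ν p)) (φ ^ p) (θ (φ ^ k)) (H ^ k))
        (S.trans (S.*-congʳ {x = H ^ k} (θ-^-swap p k))
        (S.trans (Solver.solve 4 (λ a b c d → (a :* (b :* c)) :* d := a :* (b :* (c :* d))) S.refl (const (ν k)) (θ (φ ^ p)) (φ ^ k) (H ^ k))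
        (S.*-congˡ (S.*-congˡ (φ^*H^ k)))))
      pB : ν p * B N ≈ z
      pB = begin
        ν p * B N                                    ≈⟨ const-*ˢ (ν p) B N ⟨
        (const (ν p) *ˢ B) N                         ≈⟨ at swapped N ⟩
        (const (ν k) *ˢ (θ (φ ^ p) *ˢ x ^ k)) N      ≈⟨ const-*ˢ (ν k) (θ (φ ^ p) *ˢ x ^ k) N ⟩
        ν k * (θ (φ ^ p) *ˢ x ^ k) N                 ≈⟨ *-congˡ (*-x^ (θ (φ ^ p)) k p) ⟩
        z                                            ∎
      total : ν p * (φ ^ (p ℕ.+ k) *ˢ θ (H ^ k)) N + z ≈ z
      total = begin
        ν p * (φ ^ (p ℕ.+ k) *ˢ θ (H ^ k)) N + z
          ≈⟨ +-cong (*-congˡ (at (S.trans (S.*-congʳ {x = θ (H ^ k)} (^-homo-* φ p k)) (S.*-assoc (φ ^ p) (φ ^ k) (θ (H ^ k)))) N)) (sym pB) ⟩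
        ν p * A N + ν p * B N
          ≈⟨ distribˡ _ _ _ ⟨
        ν p * (A N + B N)
          ≈⟨ *-congˡ (at (φ^*θH^ p k) N) ⟩
        ν p * (const (ν k) *ˢ (φ ^ p *ˢ x ^ k)) N
          ≈⟨ *-congˡ (trans (const-*ˢ (ν k) (φ ^ p *ˢ x ^ k) N) (*-congˡ (*-x^ (φ ^ p) k p))) ⟩
        ν p * (ν k * (φ ^ p) p)
          ≈⟨ trans (sym (*-assoc _ _ _)) (trans (*-congʳ (*-comm _ _)) (*-assoc _ _ _)) ⟩
        z ∎

    lagrange-inversion : ∀ {F} → compose F H ≋ x → ∀ n → ν (suc n) * F (suc n) ≈ (φ ^ suc n) n
    lagrange-inversion {F} FH n = begin
      ν N * F N
        ≈⟨ *-comm _ _ ⟩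
      F N * ν N
        ≈⟨ *-congˡ (θH^-diagonal N) ⟨
      F N * (φ ^ N *ˢ θ (H ^ N)) N
        ≈⟨ trans (+-congʳ (sum-0 n λ k k≤n → trans (*-congˡ (off k k≤n)) (zeroʳ _))) (+-identityˡ _) ⟨
      sum N (λ k → F k * (φ ^ N *ˢ θ (H ^ k)) N)
        ≈⟨ sum-cong N (λ k _ → *-scalarʳ (F k) (φ ^ N) (θ (H ^ k)) N) ⟨
      sum N (λ k → (φ ^ N *ˢ (F k · θ (H ^ k))) N)
        ≈⟨ *-sumʳ N N (φ ^ N) (λ k → F k · θ (H ^ k)) ⟨
      (φ ^ N *ˢ λ m → sum N (λ k → F k * θ (H ^ k) m)) N
        -- Only degrees up to N of the right factor enter, and there the sum truncated at N is the
        -- full composition.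
        ≈⟨ *-cong≤ N {f = φ ^ N} (λ _ _ → refl) θ-psum ⟩
      (φ ^ N *ˢ θ (compose F H)) N
        ≈⟨ at (S.*-congˡ {x = φ ^ N} (S.trans (θ-cong FH) θ-x)) N ⟩
      (φ ^ N *ˢ x) N
        ≈⟨ at (S.*-comm (φ ^ N) x) N ⟩
      (x *ˢ φ ^ N) N
        ≈⟨ x-*ˢ-suc (φ ^ N) n ⟩
      (φ ^ N) n ∎
      where
      N = suc n
      θ-psum : ∀ m → m ≤ N → sum N (λ k → F k * θ (H ^ k) m) ≈ θ (compose F H) m
      θ-psum m m≤N = begin
        sum N (λ k → F k * (ν m * (H ^ k) m))
          ≈⟨ sum-cong N (λ k _ → trans (sym (*-assoc _ _ _)) (trans (*-congʳ (*-comm _ _)) (*-assoc _ _ _))) ⟩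
        sum N (λ k → ν m * (F k * (H ^ k) m))  ≈⟨ sum-*ˡ N (ν m) _ ⟩
        ν m * psum N F H m                     ≈⟨ *-congˡ (psum-stable H₀ N m F m≤N) ⟩
        ν m * compose F H m                    ∎
      off : ∀ k → k ≤ n → (φ ^ N *ˢ θ (H ^ k)) N ≈ 0#
      off k k≤n = ≡.subst₂ (λ a b → (φ ^ a *ˢ θ (H ^ k)) b ≈ 0#)
        (≡.cong suc (ℕₚ.m∸n+n≡m k≤n))
        (≡.trans (ℕₚ.+-suc k (n ∸ k)) (≡.cong suc (ℕₚ.m+[n∸m]≡n k≤n)))
        (θH^-off-diagonal (n ∸ k) k)

  -- Constants and geometric series

  const-cong : ∀ {r s} → r ≈ s → const r ≋ const s
  const-cong e = mk λ { zero → e ; (suc _) → refl }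

  const-* : ∀ r s → const (r * s) ≋ const r *ˢ const s
  const-* r s = mk λ where
    zero    → refl
    (suc n) → sym (trans (const-*ˢ r (const s) (suc n)) (zeroʳ r))

  const-neg : ∀ r → const (- r) ≋ -ˢ const r
  const-neg r = mk λ { zero → refl ; (suc _) → sym -0#≈0# }
    where open import Algebra.Properties.Ring ring using (-0#≈0#)

  compose-neg : ∀ f g → compose (-ˢ f) g ≋ -ˢ compose f g
  compose-neg f g = mk λ n → +-inverseʳ-unique _ _ (begin
    compose f g n + compose (-ˢ f) g n  ≈⟨ compose-+ f (-ˢ f) g n ⟨
    compose (f +ˢ -ˢ f) g n             ≈⟨ sum-0 n (λ i _ → trans (*-congʳ (-‿inverseʳ (f i))) (zeroˡ _)) ⟩
    0#                                  ∎)
    where open import Algebra.Properties.Group +-group using () renaming (inverseʳ-unique to +-inverseʳ-unique)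

  geometric : Carrier → ℕ → Carrier
  geometric r zero    = 1#
  geometric r (suc n) = r * geometric r n

  geometric-step : ∀ r → geometric r ≋ 1ˢ +ˢ x *ˢ (const r *ˢ geometric r)
  geometric-step r = mk λ where
    zero    → sym (trans (+-congˡ (x-*ˢ-zero (const r *ˢ geometric r))) (+-identityʳ _))
    (suc n) → sym (trans (+-identityˡ _) (trans (x-*ˢ-suc (const r *ˢ geometric r) n) (const-*ˢ r (geometric r) n)))

  -- With f = G and g = (x G)^r this displays G (x G)^(r+1) as one label between an arbitrary forest
  -- and a configuration with r pending labels.
  x-factor : ∀ f g → f *ˢ (x *ˢ f *ˢ g) ≋ x *ˢ (f *ˢ (f *ˢ g))
  x-factor f g = Solver.solve 3 (λ a b c → a :* (b :* a :* c) := b :* (a :* (a :* c))) S.refl f x g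
    where open Solver using (_:*_; _:=_)

-- Ring identities behind the generating function of trees

module TreeIdentities (K : CommutativeRing 0ℓ 0ℓ)
  (ι-morphism : CommutativeRing.rawRing ℤₚ.+-*-commutativeRing -Raw-AlmostCommutative⟶ fromCommutativeRing K)
  where
  open CommutativeRing K hiding (zero)
  open _-Raw-AlmostCommutative⟶_ ι-morphism using (⟦_⟧; 1-homo)
  open import Algebra.Properties.Semiring.Exp semiring using (_^_)

  -- The signs in `C` call for integer coefficients. Equality in `K` need not be decidable, so the
  -- solver compares coefficients before they are mapped to `K`.
  ι-≟ : ∀ a b → Maybe (⟦ a ⟧ ≈ ⟦ b ⟧)
  ι-≟ a b with a ℤ.≟ b
  ... | yes ≡.refl = just refl
  ... | no _       = nothing

  private module Solver = Algebra.Solver.Ring (CommutativeRing.rawRing ℤₚ.+-*-commutativeRing) (fromCommutativeRing K) ι-morphism ι-≟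
  open Solver using (solve; _:=_; _:*_; _:+_; _:-_; :-_; _:^_)

  -- α, β, γ and δ stand for the geometric series 1/(1 + xq), 1/(1 + xyq), 1/(1 - xyq²) and 1/(1 - xq²).
  module CompositionalInverse (x y q α β γ δ : Carrier)
    (α-step : α ≈ 1# + x * (- q * α))
    (β-step : β ≈ 1# + x * (- (y * q) * β))
    (γ-step : γ ≈ 1# + x * (y * (q * q) * γ))
    (δ-step : δ ≈ 1# + x * (q * q * δ))
    where

    -- `w`, `b` and `g` are the white, black and generic series expressed through that of all trees,
    -- with x in place of the latter; `inverseSeries` is therefore `C` in partial fractions.
    A B D E w b g₀ g inverseSeries : Carrier
    A = 1# + x * q
    B = 1# + x * y * q
    D = 1# - x * q ^ 2
    E = 1# - x * y * q ^ 2
    w  = q * (x * (x * α))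
    b  = y * (q * (x * (x * β)))
    g₀ = y * (q * (q * (q * (x * (x * (x * γ))))))
    g  = g₀ * δ
    inverseSeries = x - (w + b + g)

    denominator numerator : Carrier
    denominator = A * B * D * E
    numerator   = x * (1# - x * (1# + y) * q ^ 2 - x ^ 2 * y * q ^ 2 * (1# + q - q ^ 2) - x ^ 4 * y ^ 2 * q ^ 5 * (1# + q))

    private
      -- The zeroth power denotes 1# on the nose, whereas the solver's constant 1 denotes its image ⟦ + 1 ⟧.
      one : ∀ {k} → Solver.Polynomial k → Solver.Polynomial k
      one p = p :^ 0

      Aα : A * α ≈ 1#
      Aα = trans (solve 3 (λ x q α → (one x :+ x :* q) :* α := α :+ x :* q :* α) refl x q α)
        (trans (+-congʳ α-step)
        (solve 3 (λ x q α → (one x :+ x :* ((:- q) :* α)) :+ x :* q :* α := one x) refl x q α))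

      Bβ : B * β ≈ 1#
      Bβ = trans (solve 4 (λ x y q β → (one x :+ x :* y :* q) :* β := β :+ x :* y :* q :* β) refl x y q β)
        (trans (+-congʳ β-step)
        (solve 4 (λ x y q β → (one x :+ x :* ((:- (y :* q)) :* β)) :+ x :* y :* q :* β := one x) refl x y q β))

      Dδ : D * δ ≈ 1#
      Dδ = trans (solve 3 (λ x q δ → (one x :- x :* q :^ 2) :* δ := δ :- x :* q :* q :* δ) refl x q δ)
        (trans (+-congʳ δ-step)
        (solve 3 (λ x q δ → (one x :+ x :* ((q :* q) :* δ)) :- x :* q :* q :* δ := one x) refl x q δ))

      Eγ : E * γ ≈ 1#
      Eγ = trans (solve 4 (λ x y q γ → (one x :- x :* y :* q :^ 2) :* γ := γ :- x :* y :* q :* q :* γ) refl x y q γ)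
        (trans (+-congʳ γ-step)
        (solve 4 (λ x y q γ → (one x :+ x :* ((y :* (q :* q)) :* γ)) :- x :* y :* q :* q :* γ := one x) refl x y q γ))

      denominator-w : denominator * w ≈ q * x * x * (B * D * E)
      denominator-w = trans
        (solve 7 (λ x q α A B D E → A :* B :* D :* E :* (q :* (x :* (x :* α))) := q :* x :* x :* (B :* D :* E) :* (A :* α))
          refl x q α A B D E)
        (trans (*-congˡ Aα) (*-identityʳ _))

      denominator-b : denominator * b ≈ y * q * x * x * (A * D * E)
      denominator-b = trans
        (solve 8 (λ x y q β A B D E → A :* B :* D :* E :* (y :* (q :* (x :* (x :* β)))) := y :* q :* x :* x :* (A :* D :* E) :* (B :* β))
          refl x y q β A B D E)
        (trans (*-congˡ Bβ) (*-identityʳ _))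

      denominator-g : denominator * g ≈ y * q ^ 3 * x ^ 3 * (A * B)
      denominator-g = trans
        (solve 6 (λ g δ A B D E → A :* B :* D :* E :* (g :* δ) := (A :* B :* E :* g) :* (D :* δ)) refl g₀ δ A B D E)
        (trans (*-congˡ Dδ)
        (trans (solve 7 (λ x y q γ A B E → A :* B :* E :* (y :* (q :* (q :* (q :* (x :* (x :* (x :* γ))))))) :* one x
                               := y :* q :^ 3 :* x :^ 3 :* (A :* B) :* (E :* γ)) refl x y q γ A B E)
        (trans (*-congˡ Eγ) (*-identityʳ _))))

    -- This is the origin of the numerator of `C`: each fraction loses its own factors of the
    -- denominator, and a polynomial identity remains.
    inverseSeries-fraction : denominator * inverseSeries ≈ numerator
    inverseSeries-fraction = trans
      (solve 5 (λ x w b g d → d :* (x :- (w :+ b :+ g)) := d :* x :- (d :* w :+ d :* b :+ d :* g)) refl x w b g denominator)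
      (trans
        (+-congˡ (-‿cong (+-cong (+-cong denominator-w denominator-b) denominator-g)))
        (solve 3 (λ q x y →
           let A = one x :+ x :* q
               B = one x :+ x :* y :* q
               D = one x :- x :* q :^ 2
               E = one x :- x :* y :* q :^ 2
           in A :* B :* D :* E :* x :- (q :* x :* x :* (B :* D :* E) :+ y :* q :* x :* x :* (A :* D :* E) :+ y :* q :^ 3 :* x :^ 3 :* (A :* B))
              := x :* (one x :- x :* (one x :+ y) :* q :^ 2
                   :- x :^ 2 :* y :* q :^ 2 :* (one x :+ q :- q :^ 2)
                   :- x :^ 4 :* y :^ 2 :* q :^ 5 :* (one x :+ q)))
          refl q x y))

  -- u, v, γ and δ stand for 1/(1 + qt), 1/(1 + yqt), 1/(1 - yq²t) and 1/(1 - q²t).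
  module Substituted (x y q t u v γ δ : Carrier)
    (u-step : u ≈ 1# + t * (- q * u))
    (v-step : v ≈ 1# + t * (- (y * q) * v))
    (γ-step : γ ≈ 1# + t * (y * (q * q) * γ))
    (δ-step : δ ≈ 1# + t * (q * q * δ))
    where

    white black generic₀ generic : Carrier
    white    = q * (t * (t * u))
    black    = y * (q * (t * (t * v)))
    generic₀ = y * (q * (q * (q * (t * (t * (t * γ))))))
    generic  = generic₀ * δ

    private
      one : ∀ {k} → Solver.Polynomial k → Solver.Polynomial k
      one p = p :^ 0

    module _ (total : t - (white + black + generic) ≈ x) where

      t-kinds : t ≈ x + white + black + generic
      t-kinds = trans (solve 4 (λ t w b g → t := (t :- (w :+ b :+ g)) :+ w :+ b :+ g) refl t white black generic)
        (+-congʳ (+-congʳ (+-congʳ total)))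

      -- From u = 1 - q t u one gets t u = t - white, which by `total` is the series of the trees
      -- whose top vertex is not white.
      white-eq : white ≈ q * ((x + black + generic) * t)
      white-eq = trans (solve 3 (λ q t u → q :* (t :* (t :* u)) := q :* ((t :* u) :* t)) refl q t u)
        (*-congˡ (*-congʳ (trans (*-congˡ u-step)
          (trans (solve 5 (λ q t u b g → t :* (one t :+ t :* ((:- q) :* u)) := (t :- (q :* (t :* (t :* u)) :+ b :+ g)) :+ b :+ g) refl q t u black generic)
            (+-congʳ (+-congʳ total))))))

      black-eq : black ≈ y * (q * ((x + white + generic) * t))
      black-eq = trans (solve 4 (λ y q t v → y :* (q :* (t :* (t :* v))) := y :* (q :* ((t :* v) :* t))) refl y q t v)
        (*-congˡ (*-congˡ (*-congʳ (trans (*-congˡ v-step)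
          (trans (solve 6 (λ y q t v w g → t :* (one t :+ t :* ((:- (y :* q)) :* v)) := (t :- (w :+ y :* (q :* (t :* (t :* v))) :+ g)) :+ w :+ g) refl y q t v white generic)
            (+-congʳ (+-congʳ total)))))))

      -- The factor `δ` of `generic` stands for a sequence of extra first children that leave the
      -- helicity unchanged; the factor `γ` of `generic₀` stands for children that each raise it by
      -- one.
      generic-eq : generic ≈ generic₀ + q * (q * (t * generic))
      generic-eq = trans (*-congˡ δ-step)
        (solve 4 (λ q t g δ → g :* (one t :+ t :* (q :* q :* δ)) := g :+ q :* (q :* (t :* (g :* δ)))) refl q t generic₀ δ)

      generic₀-eq : generic₀ ≈ y * (q * (q * (q * (t * (t * t))))) + y * (q * (q * (t * generic₀)))
      generic₀-eq = trans (*-congˡ (*-congˡ (*-congˡ (*-congˡ (*-congˡ (*-congˡ (*-congˡ γ-step)))))))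
        (solve 4 (λ y q t γ → y :* (q :* (q :* (q :* (t :* (t :* (t :* (one t :+ t :* (y :* (q :* q) :* γ))))))))
            := y :* (q :* (q :* (q :* (t :* (t :* t))))) :+ y :* (q :* (q :* (t :* (y :* (q :* (q :* (q :* (t :* (t :* (t :* γ)))))))))))
          refl y q t γ)

    -- `κ` is going to be composition with the tree series, which is a ring homomorphism; only its
    -- values on the ingredients of `inverseSeries` matter.
    substitution : (κ : Carrier → Carrier) →
      (∀ f g → κ (f + g) ≈ κ f + κ g) → (∀ f g → κ (f * g) ≈ κ f * κ g) → (∀ f → κ (- f) ≈ - κ f) →
      ∀ s α β γ′ δ′ → κ s ≈ t → κ y ≈ y → κ q ≈ q → κ α ≈ u → κ β ≈ v → κ γ′ ≈ γ → κ δ′ ≈ δ →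
      κ (s - (q * (s * (s * α)) + y * (q * (s * (s * β))) + y * (q * (q * (q * (s * (s * (s * γ′)))))) * δ′))
        ≈ t - (white + black + generic)
    substitution κ κ+ κ* κ- s α β γ′ δ′ s↦ y↦ q↦ α↦ β↦ γ↦ δ↦ =
      plus s↦ (trans (κ- _) (-‿cong (plus (plus
        (times q↦ (times s↦ (times s↦ α↦)))
        (times y↦ (times q↦ (times s↦ (times s↦ β↦)))))
        (times (times y↦ (times q↦ (times q↦ (times q↦ (times s↦ (times s↦ (times s↦ γ↦))))))) δ↦))))
      where
      plus : ∀ {f f′ g g′} → κ f ≈ f′ → κ g ≈ g′ → κ (f + g) ≈ f′ + g′
      plus p p′ = trans (κ+ _ _) (+-cong p p′)
      times : ∀ {f f′ g g′} → κ f ≈ f′ → κ g ≈ g′ → κ (f * g) ≈ f′ * g′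
      times p p′ = trans (κ* _ _) (*-cong p p′)

-- The series ring of the statement

open import Defs
open import Data.Bool using (Bool; true; false; if_then_else_; T; _∧_; not)
open import Data.Bool.ListAction using (all)
open import Data.Bool.Properties using (T-irrelevant; T-∧; T-≡)
open import Data.Empty using (⊥; ⊥-elim)
open import Data.Fin using (Fin; zero; suc)
open import Data.Integer using (_*_)
open import Data.Integer.Solver using () renaming (module +-*-Solver to ℤSolver)
open import Data.List using (List; []; _∷_; _++_; length; map; lookup; filter; upTo; cartesianProduct)
open import Data.List.Properties using (length-++; length-map; filter-++; filter-all; filter-none; ++-identityʳ)
open import Data.List.Membership.Propositional using (_∈_; lose; find)
open import Data.List.Membership.Propositional.Properties
  using (∈-++⁺ˡ; ∈-++⁺ʳ; ∈-++⁻; ∈-map⁺; ∈-map⁻; ∈-cartesianProduct⁺; ∈-cartesianProduct⁻; ∈-lookup; ∈-upTo⁺; ∈-upTo⁻)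
open import Data.List.Relation.Unary.All as All using (All; []; _∷_)
import Data.List.Relation.Unary.All.Properties as Allₚ
open import Data.List.Relation.Unary.AllPairs as AllPairs using (AllPairs; []; _∷_)
import Data.List.Relation.Unary.AllPairs.Properties as AllPairsₚ
open import Data.List.Relation.Unary.Any as Any using (Any; here; there)
import Data.List.Relation.Unary.Any.Properties as Anyₚ
open import Data.List.Relation.Unary.Linked using (Linked; []; [-]; _∷_)
open import Data.List.Relation.Unary.Linked.Properties using (Linked⇒AllPairs)
open import Data.List.Relation.Unary.Unique.Propositional using (Unique)
open import Data.List.Relation.Unary.Unique.Propositional.Properties using (++⁺; cartesianProduct⁺)
open import Data.Nat.Induction using (<-rec)
open import Data.Nat.Solver using () renaming (module +-*-Solver to ℕSolver)
open import Data.Product using (Σ; ∃-syntax; _×_; proj₁; proj₂)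
open import Data.Unit using (⊤; tt)
open import Function using (_∘_; case_of_; mk↔ₛ′)
open import Function.Bundles using (_↔_; Equivalence)
open import Relation.Binary.Definitions using (tri<; tri≈; tri>)
open import Relation.Nullary.Decidable using (toWitness; fromWitness)
open import Relation.Binary.PropositionalEquality using (refl; sym; trans; cong; cong₂; subst)

-- The carrier of the triple iteration is `Ser` itself, so only the operations and the constants
-- have to be compared.
module Sq = Series ℤₚ.+-*-commutativeRing
module Sy = Series Sq.seriesRing
module Sx = Series Sy.seriesRing
module R = CommutativeRing Sy.seriesRing

open Sx using (_≋_; mk; at; _+ˢ_; _*ˢ_; -ˢ_; 0ˢ; 1ˢ; const; _^_; compose; x; module S)

≋⇒≈ : ∀ {f g} → f ≋ g → f ≈ g
≋⇒≈ e a b c = Sq.at (Sy.at (at e a) b) c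

≈⇒≋ : ∀ {f g} → f ≈ g → f ≋ g
≈⇒≋ e = mk λ a → Sy.mk λ b → Sq.mk λ c → e a b c

Σ≤-cong : ∀ n {f g} → (∀ i → f i ≡ g i) → Σ≤ n f ≡ Σ≤ n g
Σ≤-cong zero    e = e 0
Σ≤-cong (suc n) e = cong₂ ℤ._+_ (Σ≤-cong n e) (e (suc n))

sum-Sq : ∀ n f → Sq.sum n f ≡ Σ≤ n f
sum-Sq zero    f = refl
sum-Sq (suc n) f = cong (ℤ._+ f (suc n)) (sum-Sq n f)

sum-Sy : ∀ n f c → Sy.sum n f c ≡ Σ≤ n λ i → f i c
sum-Sy zero    f c = refl
sum-Sy (suc n) f c = cong (ℤ._+ f (suc n) c) (sum-Sy n f c)

sum-Sx : ∀ n f b c → Sx.sum n f b c ≡ Σ≤ n λ i → f i b c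
sum-Sx zero    f b c = refl
sum-Sx (suc n) f b c = cong (ℤ._+ f (suc n) b c) (sum-Sx n f b c)

*R-coeff : ∀ (f g : ℕ → ℕ → ℤ) b c →
           (f R.* g) b c ≡ Σ≤ b λ j → Σ≤ c λ l → f j l ℤ.* g (b ∸ j) (c ∸ l)
*R-coeff f g b c = trans (sum-Sy b _ c) (Σ≤-cong b λ j → sum-Sq c _)

⊗-*ˢ : ∀ f g → f ⊗ g ≋ f *ˢ g
⊗-*ˢ f g = ≈⇒≋ λ a b c → sym (trans (sum-Sx a _ b c) (Σ≤-cong a λ i → *R-coeff (f i) (g (a ∸ i)) b c))

⊗-cong : ∀ {f f′ g g′} → f ≋ f′ → g ≋ g′ → f ⊗ g ≋ f′ *ˢ g′
⊗-cong {f} {f′} {g} {g′} p q = S.trans (⊗-*ˢ f g) (S.*-cong p q)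

⊕-cong : ∀ {f f′ g g′} → f ≋ f′ → g ≋ g′ → f ⊕ g ≋ f′ +ˢ g′
⊕-cong p q = S.+-cong p q

⊖-cong : ∀ {f f′ g g′} → f ≋ f′ → g ≋ g′ → f ⊖ g ≋ f′ +ˢ -ˢ g′
⊖-cong p q = S.+-cong p (S.-‿cong q)

𝟙≋ : 𝟙 ≋ 1ˢ
𝟙≋ = ≈⇒≋ λ { zero zero zero → refl ; zero zero (suc _) → refl ; zero (suc _) _ → refl ; (suc _) _ _ → refl }

X≋ : X ≋ x
X≋ = ≈⇒≋ λ { zero _ _ → refl ; (suc zero) zero zero → refl ; (suc zero) zero (suc _) → refl
           ; (suc zero) (suc _) _ → refl ; (suc (suc _)) _ _ → refl }

yᴿ qᴿ : ℕ → ℕ → ℤ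
yᴿ = Sy.x
qᴿ = Sy.const Sq.x

yˢ qˢ : Ser
yˢ = const yᴿ
qˢ = const qᴿ

Y≋ : Y ≋ yˢ
Y≋ = ≈⇒≋ λ { zero zero _ → refl ; zero (suc zero) zero → refl ; zero (suc zero) (suc _) → refl
           ; zero (suc (suc _)) _ → refl ; (suc _) _ _ → refl }

Q≋ : Q ≋ qˢ
Q≋ = ≈⇒≋ λ { zero zero zero → refl ; zero zero (suc zero) → refl ; zero zero (suc (suc _)) → refl
           ; zero (suc _) _ → refl ; (suc _) _ _ → refl }

pow-cong : ∀ {f g} m → f ≋ g → pow f m ≋ g ^ m
pow-cong zero    e = 𝟙≋
pow-cong (suc m) e = ⊗-cong e (pow-cong m e)

comp≋ : ∀ f g → comp f g ≋ compose f g
comp≋ f g = ≈⇒≋ λ a b c → trans (Σ≤-cong a (λ m → ≋⇒≈ (term m) a b c)) (sym (sum-Sx a _ b c))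
  where
  xcoef≋ : ∀ m → xcoef f m ≋ const (f m)
  xcoef≋ m = mk λ { zero → R.refl ; (suc _) → R.refl }
  term : ∀ m → xcoef f m ⊗ pow g m ≋ (f m Sx.· (g ^ m))
  term m = S.trans (⊗-cong (xcoef≋ m) (pow-cong m S.refl)) (mk λ n → Sx.const-*ˢ (f m) (g ^ m) n)


ι : ℤ → Ser
ι z = const (Sy.const (Sq.const z))

ι-+ : ∀ a b → ι (a ℤ.+ b) ≋ ι a +ˢ ι b
ι-+ a b = ≈⇒≋ λ { zero zero zero → refl ; zero zero (suc _) → refl ; zero (suc _) _ → refl ; (suc _) _ _ → refl }

ι-neg : ∀ a → ι (ℤ.- a) ≋ -ˢ ι a
ι-neg a = ≈⇒≋ λ { zero zero zero → refl ; zero zero (suc _) → refl ; zero (suc _) _ → refl ; (suc _) _ _ → refl }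

ι-0 : ι (+ 0) ≋ 0ˢ
ι-0 = ≈⇒≋ λ { zero zero zero → refl ; zero zero (suc _) → refl ; zero (suc _) _ → refl ; (suc _) _ _ → refl }

ι-* : ∀ a b → ι (a ℤ.* b) ≋ ι a *ˢ ι b
ι-* a b = S.trans
  (Sx.const-cong {Sy.const (Sq.const (a ℤ.* b))} {Sy.const (Sq.const a) R.* Sy.const (Sq.const b)}
    (R.trans {Sy.const (Sq.const (a ℤ.* b))} {Sy.const (Sq.const a Sq.*ˢ Sq.const b)} {Sy.const (Sq.const a) R.* Sy.const (Sq.const b)}
      (Sy.const-cong {Sq.const (a ℤ.* b)} {Sq.const a Sq.*ˢ Sq.const b} (Sq.const-* a b))
      (Sy.const-* (Sq.const a) (Sq.const b))))
  (Sx.const-* (Sy.const (Sq.const a)) (Sy.const (Sq.const b)))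

ι-morphism : CommutativeRing.rawRing ℤₚ.+-*-commutativeRing
             -Raw-AlmostCommutative⟶ fromCommutativeRing Sx.seriesRing
ι-morphism = record
  { ⟦_⟧    = ι
  ; +-homo = ι-+
  ; *-homo = ι-*
  ; -‿homo = ι-neg
  ; 0-homo = ι-0
  ; 1-homo = S.refl
  }

-- The equations for the compositional inverse and for the forest series

module I = TreeIdentities Sx.seriesRing ι-morphism

geometric-inverse : ∀ r {s} → const r ≋ s → Sx.geometric r ≋ 1ˢ +ˢ x *ˢ (s *ˢ Sx.geometric r)
geometric-inverse r {s} e =
  S.trans (Sx.geometric-step r) (S.+-congˡ {1ˢ} (S.*-congˡ {x} (S.*-congʳ {Sx.geometric r} e)))

α β γ δ : Ser
α = Sx.geometric (R.- qᴿ)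
β = Sx.geometric (R.- (yᴿ R.* qᴿ))
γ = Sx.geometric (yᴿ R.* (qᴿ R.* qᴿ))
δ = Sx.geometric (qᴿ R.* qᴿ)

const-α : const (R.- qᴿ) ≋ -ˢ qˢ
const-α = Sx.const-neg qᴿ

const-β : const (R.- (yᴿ R.* qᴿ)) ≋ -ˢ (yˢ *ˢ qˢ)
const-β = S.trans (Sx.const-neg (yᴿ R.* qᴿ)) (S.-‿cong (Sx.const-* yᴿ qᴿ))

const-δ : const (qᴿ R.* qᴿ) ≋ qˢ *ˢ qˢ
const-δ = Sx.const-* qᴿ qᴿ

const-γ : const (yᴿ R.* (qᴿ R.* qᴿ)) ≋ yˢ *ˢ (qˢ *ˢ qˢ)
const-γ = S.trans (Sx.const-* yᴿ (qᴿ R.* qᴿ)) (S.*-congˡ {yˢ} const-δ)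

module J = I.CompositionalInverse x yˢ qˢ α β γ δ
  (geometric-inverse _ const-α) (geometric-inverse _ const-β)
  (geometric-inverse _ const-γ) (geometric-inverse _ const-δ)

Cden≋ : Cden ≋ J.denominator
Cden≋ = ⊗-cong (⊗-cong (⊗-cong (⊕-cong 𝟙≋ xq) (⊕-cong 𝟙≋ (⊗-cong xy Q≋)))
    (⊖-cong 𝟙≋ (⊗-cong X≋ q²))) (⊖-cong 𝟙≋ (⊗-cong xy q²))
  where
  xq = ⊗-cong X≋ Q≋
  xy = ⊗-cong X≋ Y≋
  q² = pow-cong 2 Q≋

Cnum≋ : Cnum ≋ J.numerator
Cnum≋ = ⊗-cong X≋ (⊖-cong (⊖-cong (⊖-cong 𝟙≋
    (⊗-cong (⊗-cong X≋ (⊕-cong 𝟙≋ Y≋)) q²))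
    (⊗-cong (⊗-cong (⊗-cong (pow-cong 2 X≋) Y≋) q²) (⊖-cong (⊕-cong 𝟙≋ Q≋) q²)))
    (⊗-cong (⊗-cong (⊗-cong (pow-cong 4 X≋) (pow-cong 2 Y≋)) (pow-cong 5 Q≋)) (⊕-cong 𝟙≋ Q≋)))
  where
  q² = pow-cong 2 Q≋

-- Constant term 1 makes the denominator cancellable, so that its product with `C` determines `C`.
denominator₀ : J.denominator 0 R.≈ R.1#
denominator₀ = unit-* (J.A *ˢ J.B *ˢ J.D) J.E (unit-* (J.A *ˢ J.B) J.D (unit-* J.A J.B
    (unit-+ (x *ˢ qˢ) (x-first qˢ)) (unit-+ (x *ˢ yˢ *ˢ qˢ) (zero-* (x *ˢ yˢ) qˢ (x-first yˢ))))
    (unit-- (x *ˢ qˢ ^ 2) (x-first (qˢ ^ 2)))) (unit-- (x *ˢ yˢ *ˢ qˢ ^ 2) (zero-* (x *ˢ yˢ) (qˢ ^ 2) (x-first yˢ)))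
  where
  x-first : ∀ f → (x *ˢ f) 0 R.≈ R.0#
  x-first f = Sx.x-*ˢ-zero f
  zero-* : ∀ f g → f 0 R.≈ R.0# → (f *ˢ g) 0 R.≈ R.0#
  zero-* f g e = R.trans (R.*-congʳ {g 0} e) (R.zeroˡ (g 0))
  unit-* : ∀ f g → f 0 R.≈ R.1# → g 0 R.≈ R.1# → (f *ˢ g) 0 R.≈ R.1#
  unit-* f g e e′ = R.trans (R.*-cong e e′) (R.*-identityˡ R.1#)
  unit-+ : ∀ f → f 0 R.≈ R.0# → (1ˢ +ˢ f) 0 R.≈ R.1#
  unit-+ f e = R.trans (R.+-congˡ {R.1#} e) (R.+-identityʳ R.1#)
  unit-- : ∀ f → f 0 R.≈ R.0# → (1ˢ +ˢ -ˢ f) 0 R.≈ R.1#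
  unit-- f e = unit-+ (-ˢ f) (R.trans (R.-‿cong e) -0#≈0#)
    where open import Algebra.Properties.Ring R.ring using (-0#≈0#)

module Compositional (T : Ser) (T₀ : T 0 R.≈ R.0#) where

  compose-geometric : ∀ r {s} → const r ≋ s →
    compose (Sx.geometric r) T ≋ 1ˢ +ˢ T *ˢ (s *ˢ compose (Sx.geometric r) T)
  compose-geometric r {s} e = S.trans (mk λ n → Sx.compose-congˡ T n λ i _ → at (Sx.geometric-step r) i)
    (S.trans (mk λ n → Sx.compose-+ 1ˢ (x *ˢ (const r *ˢ Sx.geometric r)) T n)
    (S.+-cong (Sx.compose-const R.1# T)
      (S.trans (Sx.compose-* T₀ x (const r *ˢ Sx.geometric r))
      (S.*-cong (Sx.compose-x T₀) (S.trans (Sx.compose-* T₀ (const r) (Sx.geometric r))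
        (S.*-congʳ {compose (Sx.geometric r) T} (S.trans (Sx.compose-const r T) e)))))))

  module Kinds = I.Substituted x yˢ qˢ T (compose α T) (compose β T) (compose γ T) (compose δ T)
    (compose-geometric _ const-α) (compose-geometric _ const-β)
    (compose-geometric _ const-γ) (compose-geometric _ const-δ)

  compose-inverseSeries : compose J.inverseSeries T ≋ T +ˢ -ˢ (Kinds.white +ˢ Kinds.black +ˢ Kinds.generic)
  compose-inverseSeries = Kinds.substitution (λ f → compose f T)
    (λ f g → mk λ n → Sx.compose-+ f g T n) (Sx.compose-* T₀) (λ f → Sx.compose-neg f T)
    x α β γ δ (Sx.compose-x T₀) (Sx.compose-const yᴿ T) (Sx.compose-const qᴿ T) S.refl S.refl S.refl S.refl

  -- `C` and `inverseSeries` have the same product with the denominator, hence coincide, and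
  -- composing with `T` is possible term by term on the latter.
  total : ∀ {C} → C ⊗ Cden ≈ Cnum → comp C T ≈ X → T +ˢ -ˢ (Kinds.white +ˢ Kinds.black +ˢ Kinds.generic) ≋ x
  total {C} hC CT = S.trans (S.sym compose-inverseSeries)
    (S.trans (mk λ n → Sx.compose-congˡ T n λ i _ → at inverse≋C i) (S.trans (S.sym (comp≋ C T)) (S.trans (≈⇒≋ CT) X≋)))
    where
    inverse≋C : J.inverseSeries ≋ C
    inverse≋C = Sx.*-cancelˡ-unit {J.denominator} {J.inverseSeries} {C} denominator₀ (S.trans J.inverseSeries-fraction (S.trans (S.sym Cnum≋)
      (S.trans (S.sym (≈⇒≋ hC)) (S.trans (⊗-cong (S.refl {C}) Cden≋) (S.*-comm C J.denominator)))))

module ForestSeries {φ H F G : Ser} (Hφ : H ⊗ φ ≈ X) (φ₀ : φ 0 R.≈ R.1#) (F₀ : ZeroAtX0 F)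
  (HF : comp H F ≈ X) (FH : comp F H ≈ X) (xG : X ⊗ G ≈ F) where

  F≋xG : F ≋ x *ˢ G
  F≋xG = S.trans (S.sym (≈⇒≋ xG)) (⊗-cong X≋ (S.refl {G}))

  -- Substituting F into H φ = x gives H(F) φ(F) = F, where H(F) = x and F = x G; a factor x
  -- cancels.
  forest-fixpoint : G ≋ compose φ (x *ˢ G)
  forest-fixpoint = Sx.x-cancelˡ {G} {compose φ (x *ˢ G)} (S.trans (S.sym F≋xG) (S.sym xφF))
    where
    xG₀ : (x *ˢ G) 0 R.≈ R.0#
    xG₀ = Sx.x-*ˢ-zero G
    HxG : compose H (x *ˢ G) ≋ x
    HxG = S.trans (mk λ n → Sx.sum-cong n λ i _ → R.*-congˡ {H i} (at (Sx.^-congˡ i (S.sym F≋xG)) n))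
      (S.trans (S.sym (comp≋ H F)) (S.trans (≈⇒≋ HF) X≋))
    xφF : x *ˢ compose φ (x *ˢ G) ≋ F
    xφF = S.trans (S.*-congʳ {compose φ (x *ˢ G)} (S.sym HxG))
      (S.trans (S.sym (Sx.compose-* xG₀ H φ))
      (S.trans (mk λ n → Sx.compose-congˡ (x *ˢ G) n λ i _ → at (S.trans (S.sym (⊗-*ˢ H φ)) (S.trans (≈⇒≋ Hφ) X≋)) i)
      (S.trans (Sx.compose-x xG₀) (S.sym F≋xG))))

  private
    ν-coeff : ∀ n r b c → (Sx.ν n R.* r) b c ≡ + n ℤ.* r b c
    ν-coeff zero    r b c = trans (Sq.at (Sy.at (R.zeroˡ r) b) c) (sym (ℤₚ.*-zeroˡ (r b c)))
    ν-coeff (suc n) r b c = trans (Sq.at (Sy.at (R.trans (R.distribʳ r R.1# (Sx.ν n)) (R.+-congʳ {Sx.ν n R.* r} (R.*-identityˡ r))) b) c)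
      (trans (cong (λ z → r b c ℤ.+ z) (ν-coeff n r b c)) (sym (ℤₚ.suc-* (+ n) (r b c))))

    torsion-free : ∀ n r → Sx.ν (suc n) R.* r R.≈ R.0# → r R.≈ R.0#
    torsion-free n r e = Sy.mk λ b → Sq.mk λ c → ℤₚ.*-cancelˡ-≡ (+ suc n) (r b c) (+ 0)
      (trans (trans (sym (ν-coeff (suc n) r b c)) (Sq.at (Sy.at e b) c)) (sym (ℤₚ.*-zeroʳ (+ suc n))))

  -- Since F = x G, degree n of `G` is degree n + 1 of `F`, where inversion yields the factor n + 1.
  forest-lagrange : ∀ n b c → + suc n ℤ.* G n b c ≡ pow φ (suc n) n b c
  forest-lagrange n b c = trans (sym (ν-coeff (suc n) (G n) b c))
    (Sq.at (Sy.at (R.trans (R.*-congˡ {Sx.ν (suc n)} (R.trans (R.sym (Sx.x-*ˢ-suc G n)) (R.sym (at F≋xG (suc n)))))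
      (R.trans (L.lagrange-inversion {F} (S.trans (S.sym (comp≋ F H)) (S.trans (≈⇒≋ FH) X≋)) n)
      (R.sym (at (pow-cong (suc n) (S.refl {φ})) n)))) b) c)
    where
    module L = Sx.Lagrange torsion-free {φ} {H} φ₀
      (S.trans (S.*-comm φ H) (S.trans (S.sym (⊗-*ˢ H φ)) (S.trans (≈⇒≋ Hφ) X≋)))

-- Counting

-- Finite subsets of a type of raw objects, rather than finite types: validity proofs are kept out
-- of the elements, so bijections need only be mutually inverse on valid ones.
record Enumeration {A : Set} (P : A → Set) : Set where
  constructor enum
  field
    list     : List A
    unique   : Unique list
    sound    : ∀ {x} → x ∈ list → P x
    complete : ∀ {x} → P x → x ∈ list
open Enumeration

-- The cardinality is an integer in order to be compared with a coefficient; that it is not negative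
-- is read off the list.
Card : {A : Set} → (A → Set) → ℤ → Set
Card P z = Σ (Enumeration P) λ e → z ≡ + length (list e)

private variable
  A B : Set
  P P′ : A → Set
  z z′ : ℤ

card-≡ : z ≡ z′ → Card P z → Card P z′
card-≡ refl c = c

card-∅ : (∀ {x} → ¬ P x) → Card P (+ 0)
card-∅ ¬P = enum [] [] (λ ()) (λ p → ⊥-elim (¬P p)) , refl

card-singleton : ∀ a → P a → (∀ {x} → P x → x ≡ a) → Card P (+ 1)
card-singleton a p only =
  enum (a ∷ []) ([] ∷ []) (λ { (here refl) → p }) (λ q → here (only q)) , refl

map-unique : ∀ {f : A → B} (xs : List A) → (∀ {x y} → x ∈ xs → y ∈ xs → f x ≡ f y → x ≡ y) →
             Unique xs → Unique (map f xs)
map-unique []       inj []        = []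
map-unique (x ∷ xs) inj (x∉ ∷ u) =
  Allₚ.map⁺ (All.tabulate λ y∈ e → All.lookup x∉ y∈ (inj (here refl) (there y∈) e))
  ∷ map-unique xs (λ p q → inj (there p) (there q)) u

card-bijection : (f : A → B) (g : B → A) → (∀ {x} → P x → P′ (f x)) → (∀ {y} → P′ y → P (g y)) →
                 (∀ {x} → P x → g (f x) ≡ x) → (∀ {y} → P′ y → f (g y) ≡ y) → Card P z → Card P′ z
card-bijection {P′ = P′} f g to from gf fg (enum xs u s c , n≡) = enum (map f xs)
  (map-unique xs (λ p q e → trans (sym (gf (s p))) (trans (cong g e) (gf (s q)))) u)
  (λ y∈ → let x , x∈ , e = ∈-map⁻ f y∈ in subst P′ (sym e) (to (s x∈)))
  (λ {y} q → subst (_∈ map f xs) (fg q) (∈-map⁺ f (c (from q))))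
  , trans n≡ (cong +_ (sym (length-map f xs)))

card-⇔ : (∀ {x} → P x → P′ x) → (∀ {x} → P′ x → P x) → Card P z → Card P′ z
card-⇔ to from = card-bijection (λ x → x) (λ x → x) to from (λ _ → refl) (λ _ → refl)

card-⊎ : (∀ {x} → P x → P′ x → ⊥) → Card P z → Card P′ z′ → Card (λ x → P x ⊎ P′ x) (z ℤ.+ z′)
card-⊎ {P = P} {P′ = P′} disjoint (enum xs u s c , m≡) (enum ys v t d , n≡) = enum (xs ++ ys)
  (++⁺ u v λ (p , q) → disjoint (s p) (t q))
  sound′
  (λ { (inj₁ p) → ∈-++⁺ˡ (c p) ; (inj₂ q) → ∈-++⁺ʳ xs (d q) })
  , trans (cong₂ ℤ._+_ m≡ n≡) (cong +_ (sym (length-++ xs)))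
  where
  sound′ : ∀ {x} → x ∈ xs ++ ys → P x ⊎ P′ x
  sound′ x∈ with ∈-++⁻ xs x∈
  ... | inj₁ p = inj₁ (s p)
  ... | inj₂ q = inj₂ (t q)

length-cartesianProduct : (xs : List A) (ys : List B) → length (cartesianProduct xs ys) ≡ length xs ℕ.* length ys
length-cartesianProduct []       ys = refl
length-cartesianProduct (x ∷ xs) ys = trans (length-++ (map (x ,_) ys))
  (cong₂ ℕ._+_ (length-map (x ,_) ys) (length-cartesianProduct xs ys))

card-× : Card P z → Card P′ z′ → Card (λ (x , y) → P x × P′ y) (z ℤ.* z′)
card-× (enum xs u s c , m≡) (enum ys v t d , n≡) = enum (cartesianProduct xs ys)
  (cartesianProduct⁺ u v)
  (λ p → let x∈ , y∈ = ∈-cartesianProduct⁻ xs ys p in s x∈ , t y∈)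
  (λ (p , q) → ∈-cartesianProduct⁺ (c p) (d q))
  , trans (cong₂ ℤ._*_ m≡ n≡) (trans (sym (ℤₚ.pos-* (length xs) (length ys))) (cong +_ (sym (length-cartesianProduct xs ys))))

card-Σ≤ : ∀ n {P : ℕ → A → Set} {z : ℕ → ℤ} → (∀ {i j x} → P i x → P j x → i ≡ j) →
          (∀ i → i ≤ n → Card (P i) (z i)) → Card (λ x → ∃[ i ] (i ≤ n × P i x)) (Σ≤ n z)
card-Σ≤ zero {P} functional card =
  card-⇔ (λ p → 0 , z≤n , p) (λ { (zero , _ , p) → p }) (card 0 z≤n)
card-Σ≤ (suc n) {P} functional card =
  card-⇔ (λ { (inj₁ (i , i≤n , p)) → i , ℕₚ.m≤n⇒m≤1+n i≤n , p ; (inj₂ p) → suc n , ℕₚ.≤-refl , p }) split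
    (card-⊎ (λ (i , i≤n , p) q → ℕₚ.<⇒≢ (s≤s i≤n) (functional p q))
      (card-Σ≤ n functional λ i i≤n → card i (ℕₚ.m≤n⇒m≤1+n i≤n)) (card (suc n) ℕₚ.≤-refl))
  where
  split : ∀ {x} → ∃[ i ] (i ≤ suc n × P i x) → (∃[ i ] (i ≤ n × P i x)) ⊎ P (suc n) x
  split (i , i≤ , p) with ℕₚ.m≤n⇒m<n∨m≡n i≤
  ... | inj₁ (s≤s i≤n) = inj₁ (i , i≤n , p)
  ... | inj₂ refl      = inj₂ p

lookup-injective : ∀ {xs : List A} → Unique xs → ∀ i j → lookup xs i ≡ lookup xs j → i ≡ j
lookup-injective (x∉ ∷ u) zero    zero    e = refl
lookup-injective {xs = x ∷ xs} (x∉ ∷ u) zero    (suc j) e = ⊥-elim (All.lookup x∉ (∈-lookup {xs = xs} j) e)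
lookup-injective {xs = x ∷ xs} (x∉ ∷ u) (suc i) zero    e = ⊥-elim (All.lookup x∉ (∈-lookup {xs = xs} i) (sym e))
lookup-injective (x∉ ∷ u) (suc i) (suc j) e = cong suc (lookup-injective u i j e)

-- `T (p x)` has at most one proof, so listing the elements that pass the test also lists the pairs.
card-↔ : ∀ {p : A → Bool} → Card (T ∘ p) z → ∃[ m ] (z ≡ + m × (Fin m ↔ Σ A (T ∘ p)))
card-↔ (enum xs u s c , n≡) = length xs , n≡ , mk↔ₛ′
  (λ i → lookup xs i , s (∈-lookup i))
  (λ (x , p) → Any.index (c p))
  (λ (x , p) → Σ-≡ (sym (Anyₚ.lookup-index (c p))))
  (λ i → lookup-injective u _ i (sym (Anyₚ.lookup-index (c (s (∈-lookup i))))))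
  where
  Σ-≡ : ∀ {p : A → Bool} {x y} {a : T (p x)} {b : T (p y)} → x ≡ y → (x , a) ≡ (y , b)
  Σ-≡ {p = p} {x} refl = cong (x ,_) (T-irrelevant _ _)

-- Weighted counting, one power of x at a time

record Weight (A : Set) : Set where
  constructor weight
  field size ydeg qdeg : A → ℕ
open Weight public

Homogeneous : {A : Set} → Weight A → (A → Set) → ℕ → ℕ → ℕ → A → Set
Homogeneous w V n b c x = V x × size w x ≡ n × ydeg w x ≡ b × qdeg w x ≡ c

-- The size is fixed while the exponents of y and q vary: recursion is on the size, and `r` is the
-- coefficient of x^n as a series in y and q.
Count : {A : Set} → Weight A → (A → Set) → ℕ → (ℕ → ℕ → ℤ) → Set
Count w V n r = ∀ b c → Card (Homogeneous w V n b c) (r b c)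

infixr 5 _⊠_
_⊠_ : {A B : Set} → Weight A → Weight B → Weight (A × B)
w ⊠ w′ = record
  { size = λ (x , y) → size w x ℕ.+ size w′ y
  ; ydeg = λ (x , y) → ydeg w x ℕ.+ ydeg w′ y
  ; qdeg = λ (x , y) → qdeg w x ℕ.+ qdeg w′ y
  }

x↑ y↑ q↑ : {A : Set} → Weight A → Weight A
x↑ w = record w { size = suc ∘ size w }
y↑ w = record w { ydeg = suc ∘ ydeg w }
q↑ w = record w { qdeg = suc ∘ qdeg w }

private variable
  w w′ : Weight A
  V V′ : A → Set
  n : ℕ
  r s : ℕ → ℕ → ℤ

count-≈ : r R.≈ s → Count w V n r → Count w V n s
count-≈ e k b c = card-≡ (Sq.at (Sy.at e b) c) (k b c)

count-∅ : (∀ {x} → V x → size w x ≢ n) → Count w V n R.0#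
count-∅ none b c = card-∅ λ (v , n≡ , _) → none v n≡

count-⊎ : (∀ {x} → V x → V′ x → ⊥) → Count w V n r → Count w V′ n s → Count w (λ x → V x ⊎ V′ x) n (r R.+ s)
count-⊎ disjoint k k′ b c = card-⇔
  (λ { (inj₁ (v , e)) → inj₁ v , e ; (inj₂ (v , e)) → inj₂ v , e })
  (λ { (inj₁ v , e) → inj₁ (v , e) ; (inj₂ v , e) → inj₂ (v , e) })
  (card-⊎ (λ (v , _) (v′ , _) → disjoint v v′) (k b c) (k′ b c))

count-⇔ : (∀ {x} → V x → V′ x) → (∀ {x} → V′ x → V x) → Count w V n r → Count w V′ n r
count-⇔ to from k b c = card-⇔ (λ (v , e) → to v , e) (λ (v , e) → from v , e) (k b c)

record Isomorphism (w : Weight A) (V : A → Set) (w′ : Weight B) (V′ : B → Set) : Set where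
  field
    to        : A → B
    from      : B → A
    to-valid  : ∀ {x} → V x → V′ (to x)
    from-valid : ∀ {y} → V′ y → V (from y)
    from-to   : ∀ {x} → V x → from (to x) ≡ x
    to-from   : ∀ {y} → V′ y → to (from y) ≡ y
    to-size   : ∀ {x} → V x → size w′ (to x) ≡ size w x
    to-ydeg   : ∀ {x} → V x → ydeg w′ (to x) ≡ ydeg w x
    to-qdeg   : ∀ {x} → V x → qdeg w′ (to x) ≡ qdeg w x

count-≅ : Isomorphism w V w′ V′ → Count w V n r → Count w′ V′ n r
count-≅ {w = w} {w′ = w′} i k b c = card-bijection to from
  (λ (v , n≡ , b≡ , c≡) → to-valid v , trans (to-size v) n≡ , trans (to-ydeg v) b≡ , trans (to-qdeg v) c≡)
  (λ {y} (v , n≡ , b≡ , c≡) → let e = to-from v ; u = from-valid v in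
     u , trans (sym (to-size u)) (trans (cong (size w′) e) n≡)
       , trans (sym (to-ydeg u)) (trans (cong (ydeg w′) e) b≡)
       , trans (sym (to-qdeg u)) (trans (cong (qdeg w′) e) c≡))
  (from-to ∘ proj₁) (to-from ∘ proj₁) (k b c)
  where open Isomorphism i

count-q↑ : Count w V n r → Count (q↑ w) V n (qᴿ R.* r)
count-q↑ {r = r} k b zero = card-≡ (sym (Sq.at (Sy.const-*ˢ Sq.x r b) 0))
  (card-∅ λ { (_ , _ , _ , ()) })
count-q↑ {r = r} k b (suc c) = card-≡ (sym (trans (Sq.at (Sy.const-*ˢ Sq.x r b) (suc c)) (Sq.x-*ˢ-suc (r b) c)))
  (card-⇔ (λ (v , n≡ , b≡ , c≡) → v , n≡ , b≡ , cong suc c≡)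
          (λ (v , n≡ , b≡ , c≡) → v , n≡ , b≡ , ℕₚ.suc-injective c≡) (k b c))

count-y↑ : Count w V n r → Count (y↑ w) V n (yᴿ R.* r)
count-y↑ {r = r} k zero c = card-≡ (sym (Sq.at (Sy.x-*ˢ-zero r) c))
  (card-∅ λ { (_ , _ , () , _) })
count-y↑ {r = r} k (suc b) c = card-≡ (sym (Sq.at (Sy.x-*ˢ-suc r b) c))
  (card-⇔ (λ (v , n≡ , b≡ , c≡) → v , n≡ , cong suc b≡ , c≡)
          (λ (v , n≡ , b≡ , c≡) → v , n≡ , ℕₚ.suc-injective b≡ , c≡) (k b c))

+≡⇒≤ : ∀ {i j n} → i ℕ.+ j ≡ n → i ≤ n
+≡⇒≤ refl = ℕₚ.m≤m+n _ _

+≡⇒∸ : ∀ i {j n} → i ℕ.+ j ≡ n → j ≡ n ∸ i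
+≡⇒∸ i {j} refl = sym (ℕₚ.m+n∸m≡n i j)

∸≡⇒+ : ∀ {i j n} → i ≤ n → j ≡ n ∸ i → i ℕ.+ j ≡ n
∸≡⇒+ i≤n refl = ℕₚ.m+[n∸m]≡n i≤n

count-layer : ∀ {i j} → Count w V i r → Count w′ V′ j s → ∀ b c →
  Card (λ (x , y) → (V x × size w x ≡ i) × (V′ y × size w′ y ≡ j)
                    × ydeg (w ⊠ w′) (x , y) ≡ b × qdeg (w ⊠ w′) (x , y) ≡ c) ((r R.* s) b c)
count-layer {w = w} {r = r} {w′ = w′} {s = s} k k′ b c = card-≡ (sym (*R-coeff r s b c)) (card-⇔
  (λ (j , j≤b , l , l≤c , (v , n≡ , j≡ , l≡) , (v′ , n≡′ , j≡′ , l≡′)) →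
     (v , n≡) , (v′ , n≡′) , ∸≡⇒+ (subst (_≤ b) (sym j≡) j≤b) (trans j≡′ (cong (b ∸_) (sym j≡)))
              , ∸≡⇒+ (subst (_≤ c) (sym l≡) l≤c) (trans l≡′ (cong (c ∸_) (sym l≡))))
  (λ ((v , n≡) , (v′ , n≡′) , b≡ , c≡) →
     _ , +≡⇒≤ b≡ , _ , +≡⇒≤ c≡ , (v , n≡ , refl , refl) , (v′ , n≡′ , +≡⇒∸ _ b≡ , +≡⇒∸ _ c≡))
  (card-Σ≤ b (λ (_ , _ , (_ , _ , e , _) , _) (_ , _ , (_ , _ , e′ , _) , _) → trans (sym e) e′) λ j _ →
   card-Σ≤ c (λ ((_ , _ , _ , e) , _) ((_ , _ , _ , e′) , _) → trans (sym e) e′) λ l _ →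
   card-× (k j l) (k′ (b ∸ j) (c ∸ l))))

count-Σ≤ : ∀ {m} {U : ℕ → A → Set} {f : ℕ → ℕ → ℕ → ℤ} → (∀ {i j x} → U i x → U j x → i ≡ j) →
  (∀ i → i ≤ m → Count w (U i) n (f i)) → Count w (λ x → ∃[ i ] (i ≤ m × U i x)) n (Sx.sum m f)
count-Σ≤ {m = m} {f = f} functional k b c = card-≡ (sym (sum-Sx m f b c)) (card-⇔
  (λ (i , i≤ , v , e) → (i , i≤ , v) , e)
  (λ ((i , i≤ , v) , e) → i , i≤ , v , e)
  (card-Σ≤ m (λ (u , _) (u′ , _) → functional u u′) λ i i≤m → k i i≤m b c))

Layer : (w : Weight A) (V : A → Set) (w′ : Weight B) (V′ : ℕ → B → Set) → ℕ → ℕ → (A × B → Set)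
Layer w V w′ V′ i j (x , y) = (V x × size w x ≡ i) × (V′ i y × size w′ y ≡ j)

-- The second factor may depend on the size of the first.
count-⊠ : ∀ {w : Weight A} {V : A → Set} {w′ : Weight B} {V′ : ℕ → B → Set} {f g : Ser} →
  (∀ i → i ≤ n → (Count w V i (f i) × Count w′ (V′ i) (n ∸ i) (g (n ∸ i)))
               ⊎ ((∀ {xy} → ¬ Layer w V w′ V′ i (n ∸ i) xy) × f i R.* g (n ∸ i) R.≈ R.0#)) →
  Count (w ⊠ w′) (λ (x , y) → V x × V′ (size w x) y) n ((f *ˢ g) n)
count-⊠ {n = n} {w = w} {V} {w′} {V′} {f} {g} layers b c = card-⇔
  (λ { (i , i≤n , ((v , refl) , (v′ , n≡)) , b≡ , c≡) → (v , v′) , ∸≡⇒+ i≤n n≡ , b≡ , c≡ })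
  (λ ((v , v′) , n≡ , b≡ , c≡) → _ , +≡⇒≤ n≡ , ((v , refl) , (v′ , +≡⇒∸ _ n≡)) , b≡ , c≡)
  (card-≡ (sym (sum-Sx n _ b c)) (card-Σ≤ n (λ (((_ , e) , _) , _) (((_ , e′) , _) , _) → trans (sym e) e′) layer))
  where
  layer : ∀ i → i ≤ n → Card (λ xy → Layer w V w′ V′ i (n ∸ i) xy × ydeg (w ⊠ w′) xy ≡ b × qdeg (w ⊠ w′) xy ≡ c)
                             ((f i R.* g (n ∸ i)) b c)
  layer i i≤n with layers i i≤n
  ... | inj₁ (k , k′) = card-⇔ (λ (p , p′ , e) → (p , p′) , e) (λ ((p , p′) , e) → p , p′ , e) (count-layer k k′ b c)
  ... | inj₂ (none , zero≈) = card-≡ (sym (Sq.at (Sy.at zero≈ b) c)) (card-∅ λ (p , _) → none p)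

-- If neither factor has objects of size 0, both parts of a pair of size n are smaller than n. This
-- turns the equations for trees into recursions.
count-⊠-positive : ∀ {w : Weight A} {V : A → Set} {w′ : Weight B} {V′ : B → Set} {f g : Ser} →
  (∀ {x} → V x → size w x ≢ 0) → (∀ {y} → V′ y → size w′ y ≢ 0) → f 0 R.≈ R.0# → g 0 R.≈ R.0# →
  (∀ i → i < n → Count w V i (f i)) → (∀ i → i < n → Count w′ V′ i (g i)) →
  Count (w ⊠ w′) (λ (x , y) → V x × V′ y) n ((f *ˢ g) n)
count-⊠-positive {n = n} {w = w} {V} {w′} {V′} {f} {g} w>0 w′>0 f₀ g₀ k k′ = count-⊠ {f = f} {g} layers
  where
  layers : ∀ i → i ≤ n → (Count w V i (f i) × Count w′ V′ (n ∸ i) (g (n ∸ i)))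
                       ⊎ ((∀ {xy} → ¬ Layer w V w′ (λ _ → V′) i (n ∸ i) xy) × f i R.* g (n ∸ i) R.≈ R.0#)
  -- In the two extreme layers one part would have size 0: they are empty, and the matching product
  -- of coefficients vanishes.
  layers zero i≤n = inj₂ ((λ ((v , e) , _) → w>0 v e) , R.trans (R.*-congʳ {g n} f₀) (R.zeroˡ (g n)))
  layers (suc i) i<n with ℕₚ.m≤n⇒m<n∨m≡n i<n
  ... | inj₁ i<n′ = inj₁ (k (suc i) i<n′ , k′ (n ∸ suc i) (ℕₚ.∸-monoʳ-< {n} {suc i} {0} (s≤s z≤n) i<n))
  ... | inj₂ refl = inj₂ ((λ (_ , v , e) → w′>0 v (trans e (ℕₚ.n∸n≡0 n)))
    , R.trans (R.*-congˡ {f n} (R.trans (R.reflexive (cong g (ℕₚ.n∸n≡0 n))) g₀)) (R.zeroʳ (f n)))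

count-x↑ : Count w V n r → Count (x↑ w) V (suc n) r
count-x↑ k b c = card-⇔ (λ (v , n≡ , e) → v , cong suc n≡ , e) (λ (v , n≡ , e) → v , ℕₚ.suc-injective n≡ , e) (k b c)

-- Trees

data Kind : Set where
  leaf white black generic : Kind

-- Valid contracted trees, sorted by their top vertex. An internal vertex has at least two children,
-- so helicity 1 and helicity equal to the number of children exclude each other. Being contracted
-- restricts only the kinds of the children.
mutual
  data Ok : Kind → Tr → Set where
    leaf    : Ok leaf bd
    white   : ∀ {u v cs} → Offspring (_≢ white) (u ∷ v ∷ cs) → Ok white (nd 1 (u ∷ v ∷ cs))
    black   : ∀ {u v cs} → Offspring (_≢ black) (u ∷ v ∷ cs) → Ok black (nd (2 ℕ.+ length cs) (u ∷ v ∷ cs))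
    generic : ∀ {h cs} → 2 ≤ h → h < length cs → Offspring (λ _ → ⊤) cs → Ok generic (nd h cs)

  infixr 5 _∷_
  data Offspring (S : Kind → Set) : List Tr → Set where
    []  : Offspring S []
    _∷_ : ∀ {t ts} → ∃[ k ] (S k × Ok k t) → Offspring S ts → Offspring S (t ∷ ts)

OfKind : (Kind → Set) → Tr → Set
OfKind S t = ∃[ k ] (S k × Ok k t)

AnyKind : Tr → Set
AnyKind = OfKind λ _ → ⊤

anyKind : ∀ {S t} → OfKind S t → AnyKind t
anyKind (k , _ , o) = k , tt , o

kind-unique : ∀ {k l t} → Ok k t → Ok l t → k ≡ l
kind-unique leaf leaf = refl
kind-unique (white _) (white _) = refl
kind-unique (black _) (black _) = refl
kind-unique (generic _ _ _) (generic _ _ _) = refl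
kind-unique (white _) (generic (s≤s ()) _ _)
kind-unique (generic (s≤s ()) _ _) (white _)
kind-unique (black _) (generic _ h<h _) = ⊥-elim (ℕₚ.<-irrefl refl h<h)
kind-unique (generic _ h<h _) (black _) = ⊥-elim (ℕₚ.<-irrefl refl h<h)

isWhite-true : ∀ {t} → Ok white t → isWhite t ≡ true
isWhite-true (white _) = refl

isWhite-false : ∀ {t} → OfKind (_≢ white) t → isWhite t ≡ false
isWhite-false (_ , _ , leaf) = refl
isWhite-false (_ , k≢ , white _) = ⊥-elim (k≢ refl)
isWhite-false (_ , _ , black _) = refl
isWhite-false (_ , _ , generic (s≤s (s≤s _)) _ _) = refl

≡ᵇ-refl : ∀ n → (n ≡ᵇ n) ≡ true
≡ᵇ-refl zero    = refl
≡ᵇ-refl (suc n) = ≡ᵇ-refl n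

<⇒≡ᵇ-false : ∀ {m n} → m < n → (m ≡ᵇ n) ≡ false
<⇒≡ᵇ-false {zero}  (s≤s _) = refl
<⇒≡ᵇ-false {suc m} (s≤s p) = <⇒≡ᵇ-false p

isBlack-true : ∀ {t} → Ok black t → isBlack t ≡ true
isBlack-true (black {cs = cs} _) = ≡ᵇ-refl (length cs)

isBlack-false : ∀ {t} → OfKind (_≢ black) t → isBlack t ≡ false
isBlack-false (_ , _ , leaf) = refl
isBlack-false (_ , _ , white _) = refl
isBlack-false (_ , k≢ , black _) = ⊥-elim (k≢ refl)
isBlack-false (_ , _ , generic _ h< _) = <⇒≡ᵇ-false h<

-- m(v) - 1 for a vertex of helicity h with c children
vertexDim : ℕ → ℕ → ℕ
vertexDim h c = if (1 <ᵇ h) ∧ (h <ᵇ c) then c ℕ.+ c ∸ 3 else c ∸ 1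

-- Natural number exponents; `hsum-degree` and `dsum-degree` tie them to the integer helicity and
-- dimension of the statement.
mutual
  yT qT : Tr → ℕ
  yT bd        = 0
  yT (nd h cs) = h ∸ 1 ℕ.+ yL cs
  qT bd        = 0
  qT (nd h cs) = vertexDim h (length cs) ℕ.+ qL cs

  yL qL : List Tr → ℕ
  yL []       = 0
  yL (t ∷ ts) = yT t ℕ.+ yL ts
  qL []       = 0
  qL (t ∷ ts) = qT t ℕ.+ qL ts

treeWeight : Weight Tr
treeWeight = weight leavesT yT qT

<ᵇ-irrefl : ∀ n → (n <ᵇ n) ≡ false
<ᵇ-irrefl zero    = refl
<ᵇ-irrefl (suc n) = <ᵇ-irrefl n

<⇒<ᵇ-true : ∀ {m n} → m < n → (m <ᵇ n) ≡ true
<⇒<ᵇ-true {zero}  (s≤s _) = refl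
<⇒<ᵇ-true {suc m} (s≤s p) = <⇒<ᵇ-true p

vertexDim-generic : ∀ {h c} → 2 ≤ h → h < c → vertexDim h c ≡ c ℕ.+ c ∸ 3
vertexDim-generic (s≤s (s≤s _)) h<c rewrite <⇒<ᵇ-true h<c = refl

-- Here m = 2 deg - 4, so one more child costs q², whatever happens to the helicity within the
-- generic range.
vertexDim-generic-suc : ∀ {h h′ c} → 2 ≤ h → h < c → 2 ≤ h′ → h′ < suc c →
                        vertexDim h′ (suc c) ≡ 2 ℕ.+ vertexDim h c
vertexDim-generic-suc {c = c} 2≤h h<c 2≤h′ h′< = trans (vertexDim-generic 2≤h′ h′<)
  (trans (2+ c (ℕₚ.≤-trans (s≤s 2≤h) h<c)) (cong (2 ℕ.+_) (sym (vertexDim-generic 2≤h h<c))))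
  where
  2+ : ∀ c → 3 ≤ c → suc c ℕ.+ suc c ∸ 3 ≡ 2 ℕ.+ (c ℕ.+ c ∸ 3)
  2+ 1 (s≤s ())
  2+ 2 (s≤s (s≤s ()))
  2+ (suc (suc (suc c))) _ = cong suc (ℕₚ.+-suc c (suc (suc (suc c))))

leaves-positive : ∀ {k t} → Ok k t → 1 ≤ leavesT t
leaves-positiveL : ∀ {S cs} → 1 ≤ length cs → Offspring S cs → 1 ≤ leavesL cs
leaves-positive leaf = s≤s z≤n
leaves-positive (white cs) = leaves-positiveL (s≤s z≤n) cs
leaves-positive (black cs) = leaves-positiveL (s≤s z≤n) cs
leaves-positive (generic _ h< cs) = leaves-positiveL (ℕₚ.≤-trans (s≤s z≤n) h<) cs
leaves-positiveL _ ((_ , _ , o) ∷ _) = ℕₚ.≤-trans (leaves-positive o) (ℕₚ.m≤m+n _ _)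

offspring-map : ∀ {S S′ cs} → (∀ {k} → S k → S′ k) → Offspring S cs → Offspring S′ cs
offspring-map f []                   = []
offspring-map f ((k , s , o) ∷ cs) = (k , f s , o) ∷ offspring-map f cs

+-swap : ∀ a b c → a ℕ.+ (b ℕ.+ c) ≡ b ℕ.+ (a ℕ.+ c)
+-swap a b c = trans (sym (ℕₚ.+-assoc a b c)) (trans (cong (ℕ._+ c) (ℕₚ.+-comm a b)) (ℕₚ.+-assoc b a c))

-- Decomposing trees at the first child

children : Tr → List Tr
children bd        = []
children (nd _ cs) = cs

helicity : Tr → ℕ
helicity bd        = 0
helicity (nd h _)  = h

-- `f` corrects the helicity of the remaining vertex: the identity at a white one, the predecessor
-- at a black one. The last clause is a default outside the valid trees.
splitFirst : (ℕ → ℕ) → Tr → Tr × Tr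
splitFirst f (nd h (u ∷ v ∷ []))     = u , v
splitFirst f (nd h (u ∷ v ∷ w ∷ cs)) = u , nd (f h) (v ∷ w ∷ cs)
splitFirst f t                       = t , t

joinWhite joinBlack : Tr × Tr → Tr
joinWhite (u , t) = if isWhite t then nd 1 (u ∷ children t) else nd 1 (u ∷ t ∷ [])
joinBlack (u , t) = if isBlack t then nd (suc (helicity t)) (u ∷ children t) else nd 2 (u ∷ t ∷ [])

-- Detaching the first child of a white vertex leaves a white vertex,
-- or, if there were just two children, the other child, which is not white.
white-≅ : Isomorphism (q↑ (treeWeight ⊠ treeWeight)) (λ (u , t) → OfKind (_≢ white) u × AnyKind t) treeWeight (Ok white)
white-≅ = record
  { to = joinWhite
  ; from = splitFirst (λ h → h)
  ; to-valid = to-valid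
  ; from-valid = λ { (white (u ∷ v ∷ [])) → u , anyKind v ; (white (u ∷ v ∷ w ∷ cs)) → u , white , tt , white (v ∷ w ∷ cs) }
  ; from-to = from-to
  ; to-from = λ { (white (u ∷ v ∷ [])) → pair v ; (white (u ∷ v ∷ w ∷ cs)) → refl }
  ; to-size = to-size
  ; to-ydeg = to-ydeg
  ; to-qdeg = to-qdeg
  }
  where
  Valid : Tr × Tr → Set
  Valid (u , t) = OfKind (_≢ white) u × AnyKind t
  pair : ∀ {u t} → OfKind (_≢ white) t → joinWhite (u , t) ≡ nd 1 (u ∷ t ∷ [])
  pair {u} {t} o rewrite isWhite-false o = refl
  data View (t : Tr) : Set where
    isW  : Ok white t → View t
    notW : OfKind (_≢ white) t → View t
  view : ∀ {t} → AnyKind t → View t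
  view (leaf , _ , o)    = notW (leaf , (λ ()) , o)
  view (white , _ , o)   = isW o
  view (black , _ , o)   = notW (black , (λ ()) , o)
  view (generic , _ , o) = notW (generic , (λ ()) , o)
  to-valid : ∀ {x} → Valid x → Ok white (joinWhite x)
  to-valid (u , t) with view t
  ... | isW (white cs) = white (u ∷ cs)
  ... | notW o rewrite isWhite-false o = white (u ∷ o ∷ [])
  from-to : ∀ {x} → Valid x → splitFirst (λ h → h) (joinWhite x) ≡ x
  from-to (u , t) with view t
  ... | isW (white cs) = refl
  ... | notW o rewrite isWhite-false o = refl
  to-size : ∀ {x} → Valid x → leavesT (joinWhite x) ≡ size (treeWeight ⊠ treeWeight) x
  to-size {x} (u , t) with view t
  ... | isW (white cs) = refl
  ... | notW o rewrite isWhite-false o = cong (leavesT (proj₁ x) ℕ.+_) (ℕₚ.+-identityʳ _)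
  to-ydeg : ∀ {x} → Valid x → yT (joinWhite x) ≡ ydeg (treeWeight ⊠ treeWeight) x
  to-ydeg {x} (u , t) with view t
  ... | isW (white cs) = refl
  ... | notW o rewrite isWhite-false o = cong (yT (proj₁ x) ℕ.+_) (ℕₚ.+-identityʳ _)
  to-qdeg : ∀ {x} → Valid x → qT (joinWhite x) ≡ suc (qdeg (treeWeight ⊠ treeWeight) x)
  to-qdeg {x} (u , t) with view t
  ... | isW (white {cs = cs} _) = cong suc (+-swap (suc (length cs)) (qT (proj₁ x)) _)
  ... | notW o rewrite isWhite-false o = cong (λ z → suc (qT (proj₁ x) ℕ.+ z)) (ℕₚ.+-identityʳ _)

-- As at white vertices, except that the helicity equals the number of children. Adding a child
-- raises it by one, and a new black vertex has h - 1 = 1; either way this is the factor y.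
black-≅ : Isomorphism (y↑ (q↑ (treeWeight ⊠ treeWeight))) (λ (u , t) → OfKind (_≢ black) u × AnyKind t) treeWeight (Ok black)
black-≅ = record
  { to = joinBlack
  ; from = splitFirst (_∸ 1)
  ; to-valid = to-valid
  ; from-valid = λ { (black (u ∷ v ∷ [])) → u , anyKind v ; (black (u ∷ v ∷ w ∷ cs)) → u , black , tt , black (v ∷ w ∷ cs) }
  ; from-to = from-to
  ; to-from = λ { (black (u ∷ v ∷ [])) → pair v ; (black (_∷_ {u} _ (_∷_ {v} _ (_∷_ {w} {cs} _ _)))) → rejoin {u} {v} {w} {cs} }
  ; to-size = to-size
  ; to-ydeg = to-ydeg
  ; to-qdeg = to-qdeg
  }
  where
  Valid : Tr × Tr → Set
  Valid (u , t) = OfKind (_≢ black) u × AnyKind t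
  pair : ∀ {u t} → OfKind (_≢ black) t → joinBlack (u , t) ≡ nd 2 (u ∷ t ∷ [])
  pair o rewrite isBlack-false o = refl
  rejoin : ∀ {u v w cs} → joinBlack (u , nd (2 ℕ.+ length cs) (v ∷ w ∷ cs)) ≡ nd (3 ℕ.+ length cs) (u ∷ v ∷ w ∷ cs)
  rejoin {cs = cs} rewrite ≡ᵇ-refl (length cs) = refl
  data View (t : Tr) : Set where
    isB  : Ok black t → View t
    notB : OfKind (_≢ black) t → View t
  view : ∀ {t} → AnyKind t → View t
  view (leaf , _ , o)    = notB (leaf , (λ ()) , o)
  view (white , _ , o)   = notB (white , (λ ()) , o)
  view (black , _ , o)   = isB o
  view (generic , _ , o) = notB (generic , (λ ()) , o)
  to-valid : ∀ {x} → Valid x → Ok black (joinBlack x)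
  to-valid (u , t) with view t
  ... | isB (black {cs = cs′} cs) rewrite ≡ᵇ-refl (length cs′) = black (u ∷ cs)
  ... | notB o rewrite isBlack-false o = black (u ∷ o ∷ [])
  from-to : ∀ {x} → Valid x → splitFirst (_∸ 1) (joinBlack x) ≡ x
  from-to (u , t) with view t
  ... | isB (black {cs = cs′} cs) rewrite ≡ᵇ-refl (length cs′) = refl
  ... | notB o rewrite isBlack-false o = refl
  to-size : ∀ {x} → Valid x → leavesT (joinBlack x) ≡ size (treeWeight ⊠ treeWeight) x
  to-size {x} (u , t) with view t
  ... | isB (black {cs = cs′} cs) rewrite ≡ᵇ-refl (length cs′) = refl
  ... | notB o rewrite isBlack-false o = cong (leavesT (proj₁ x) ℕ.+_) (ℕₚ.+-identityʳ _)
  to-ydeg : ∀ {x} → Valid x → yT (joinBlack x) ≡ suc (ydeg (treeWeight ⊠ treeWeight) x)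
  to-ydeg {x} (u , t) with view t
  ... | isB (black {cs = cs′} cs) rewrite ≡ᵇ-refl (length cs′) = cong suc (+-swap (suc (length cs′)) (yT (proj₁ x)) _)
  ... | notB o rewrite isBlack-false o = cong (λ z → suc (yT (proj₁ x) ℕ.+ z)) (ℕₚ.+-identityʳ _)
  to-qdeg : ∀ {x} → Valid x → qT (joinBlack x) ≡ suc (qdeg (treeWeight ⊠ treeWeight) x)
  to-qdeg {x} (u , t) with view t
  ... | isB (black {cs = cs′} cs) rewrite ≡ᵇ-refl (length cs′) | <ᵇ-irrefl (length cs′) = cong suc (+-swap (suc (length cs′)) (qT (proj₁ x)) _)
  ... | notB o rewrite isBlack-false o = cong (λ z → suc (qT (proj₁ x) ℕ.+ z)) (ℕₚ.+-identityʳ _)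

attach : (ℕ → ℕ) → Tr × Tr → Tr
attach f (u , t) = nd (f (helicity t)) (u ∷ children t)

detach : (ℕ → ℕ) → Tr → Tr × Tr
detach f (nd h (u ∷ cs)) = u , nd (f h) cs
detach f t               = t , t

-- With c children the generic helicities are 2, ..., c - 1. Below c - 1 a child can be removed at
-- constant helicity (`Loose`); at c - 1 the helicity has to drop too (`Tight`), which is possible
-- unless it is 2.
data Loose : Tr → Set where
  loose : ∀ {h cs} → 2 ≤ h → suc h < length cs → Offspring (λ _ → ⊤) cs → Loose (nd h cs)

data Tight : Tr → Set where
  tight : ∀ {h cs} → 2 ≤ h → suc h ≡ length cs → Offspring (λ _ → ⊤) cs → Tight (nd h cs)

loose-≅ : Isomorphism (q↑ (q↑ (treeWeight ⊠ treeWeight))) (λ (u , t) → AnyKind u × Ok generic t) treeWeight Loose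
loose-≅ = record
  { to = attach (λ h → h)
  ; from = detach (λ h → h)
  ; to-valid = λ { (u , generic 2≤h h< cs) → loose 2≤h (s≤s h<) (u ∷ cs) }
  ; from-valid = λ { (loose 2≤h (s≤s h<) (u ∷ cs)) → anyKind u , generic 2≤h h< cs }
  ; from-to = λ { (u , generic _ _ _) → refl }
  ; to-from = λ { (loose _ _ (u ∷ cs)) → refl }
  ; to-size = λ { (u , generic _ _ _) → refl }
  ; to-ydeg = λ { {u , t} (_ , generic {h} _ _ _) → +-swap (h ∸ 1) (yT u) _ }
  ; to-qdeg = λ { {u , t} (_ , generic {h} {cs} 2≤h h< _) →
      trans (cong (ℕ._+ (qT u ℕ.+ qL cs)) (vertexDim-generic-suc 2≤h h< 2≤h (ℕₚ.m≤n⇒m≤1+n h<)))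
            (cong (2 ℕ.+_) (+-swap (vertexDim h (length cs)) (qT u) (qL cs))) }
  }

-- Tightness and helicity 2 force three children, hence degree 4: h - 1 = 1 and m - 1 = 3 give y q³.
small-≅ : Isomorphism (y↑ (q↑ (q↑ (q↑ (treeWeight ⊠ (treeWeight ⊠ treeWeight)))))) (λ (a , b , c) → AnyKind a × AnyKind b × AnyKind c)
                      treeWeight (λ t → Tight t × helicity t ≡ 2)
small-≅ = record
  { to = λ (a , b , c) → nd 2 (a ∷ b ∷ c ∷ [])
  ; from = λ { (nd _ (a ∷ b ∷ c ∷ [])) → a , b , c ; t → t , t , t }
  ; to-valid = λ (a , b , c) → tight (s≤s (s≤s z≤n)) refl (a ∷ b ∷ c ∷ []) , refl
  ; from-valid = λ { (tight _ refl (a ∷ b ∷ c ∷ []) , refl) → a , b , c }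
  ; from-to = λ _ → refl
  ; to-from = λ { (tight _ refl (a ∷ b ∷ c ∷ []) , refl) → refl }
  ; to-size = λ { {a , b , c} _ → cong (λ z → leavesT a ℕ.+ (leavesT b ℕ.+ z)) (ℕₚ.+-identityʳ _) }
  ; to-ydeg = λ { {a , b , c} _ → cong (λ z → suc (yT a ℕ.+ (yT b ℕ.+ z))) (ℕₚ.+-identityʳ _) }
  ; to-qdeg = λ { {a , b , c} _ → cong (λ z → 3 ℕ.+ (qT a ℕ.+ (qT b ℕ.+ z))) (ℕₚ.+-identityʳ _) }
  }

large-≅ : Isomorphism (y↑ (q↑ (q↑ (treeWeight ⊠ treeWeight)))) (λ (u , t) → AnyKind u × Tight t)
                      treeWeight (λ t → Tight t × 3 ≤ helicity t)
large-≅ = record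
  { to = attach suc
  ; from = detach (_∸ 1)
  ; to-valid = λ { (u , tight 2≤h h≡ cs) → tight (ℕₚ.m≤n⇒m≤1+n 2≤h) (cong suc h≡) (u ∷ cs) , s≤s 2≤h }
  ; from-valid = λ { (tight _ h≡ (u ∷ cs) , s≤s 2≤h) → anyKind u , tight 2≤h (ℕₚ.suc-injective h≡) cs }
  ; from-to = λ { (u , tight _ _ _) → refl }
  ; to-from = λ { (tight _ _ (u ∷ cs) , s≤s _) → refl }
  ; to-size = λ { (u , tight _ _ _) → refl }
  ; to-ydeg = λ { {u , t} (_ , tight {suc h} (s≤s _) _ _) → cong suc (+-swap h (yT u) _) }
  ; to-qdeg = λ { {u , t} (_ , tight {h} {cs} 2≤h h≡ _) →
      trans (cong (ℕ._+ (qT u ℕ.+ qL cs)) (vertexDim-generic-suc 2≤h (ℕₚ.≤-reflexive h≡) (ℕₚ.m≤n⇒m≤1+n 2≤h) (s≤s (ℕₚ.≤-reflexive h≡))))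
            (cong (2 ℕ.+_) (+-swap (vertexDim h (length cs)) (qT u) (qL cs))) }
  }

count-leaf : ∀ n → Count treeWeight (Ok leaf) n (x n)
count-leaf zero          = count-∅ λ { leaf () }
count-leaf (suc zero) zero    zero    = card-singleton bd (leaf , refl , refl , refl) λ { (leaf , _) → refl }
count-leaf (suc zero) zero    (suc _) = card-∅ λ { (leaf , _ , _ , ()) }
count-leaf (suc zero) (suc _) _       = card-∅ λ { (leaf , _ , () , _) }
count-leaf (suc (suc _)) = count-∅ λ { leaf () }

tree-size≢0 : ∀ {S t} → OfKind S t → leavesT t ≢ 0
tree-size≢0 (_ , _ , o) e = ℕₚ.<⇒≢ (leaves-positive o) (sym e)

tight-generic : ∀ {t} → Tight t → Ok generic t
tight-generic (tight 2≤h h≡ cs) = generic 2≤h (ℕₚ.≤-reflexive h≡) cs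

loose-generic : ∀ {t} → Loose t → Ok generic t
loose-generic (loose 2≤h h< cs) = generic 2≤h (ℕₚ.<-trans (ℕₚ.n<1+n _) h<) cs

generic-split : ∀ {t} → Ok generic t → Tight t ⊎ Loose t
generic-split (generic 2≤h h< cs) with ℕₚ.m≤n⇒m<n∨m≡n h<
... | inj₁ h<′ = inj₂ (loose 2≤h h<′ cs)
... | inj₂ h≡  = inj₁ (tight 2≤h h≡ cs)

tight-split : ∀ {t} → Tight t → (Tight t × helicity t ≡ 2) ⊎ (Tight t × 3 ≤ helicity t)
tight-split o@(tight 2≤h h≡ cs) with ℕₚ.m≤n⇒m<n∨m≡n 2≤h
... | inj₁ 3≤h = inj₂ (o , 3≤h)
... | inj₂ 2≡h = inj₁ (o , sym 2≡h)

tight-loose-disjoint : ∀ {t} → Tight t → Loose t → ⊥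
tight-loose-disjoint (tight _ h≡ _) (loose _ h< _) = ℕₚ.<⇒≢ h< h≡

clash : ∀ {k l t} → Ok k t → Ok l t → k ≢ l → ⊥
clash o o′ k≢l = k≢l (kind-unique o o′)

-- The series are arbitrary solutions of the equations; that their coefficients are counts is a
-- conclusion.
module TreeCounting {T W B G G₀ : Ser} (T₀ : T 0 R.≈ R.0#)
  (T-eq : T ≋ x +ˢ W +ˢ B +ˢ G)
  (W-eq : W ≋ qˢ *ˢ ((x +ˢ B +ˢ G) *ˢ T))
  (B-eq : B ≋ yˢ *ˢ (qˢ *ˢ ((x +ˢ W +ˢ G) *ˢ T)))
  (G-eq : G ≋ G₀ +ˢ qˢ *ˢ (qˢ *ˢ (T *ˢ G)))
  (G₀-eq : G₀ ≋ yˢ *ˢ (qˢ *ˢ (qˢ *ˢ (qˢ *ˢ (T *ˢ (T *ˢ T))))) +ˢ yˢ *ˢ (qˢ *ˢ (qˢ *ˢ (T *ˢ G₀))))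
  where

  private
    *-zeroˡ₀ : ∀ f g → f 0 R.≈ R.0# → (f *ˢ g) 0 R.≈ R.0#
    *-zeroˡ₀ f g e = R.trans (R.*-congʳ {g 0} e) (R.zeroˡ (g 0))

    *-zeroʳ₀ : ∀ f g → g 0 R.≈ R.0# → (f *ˢ g) 0 R.≈ R.0#
    *-zeroʳ₀ f g e = R.trans (R.*-congˡ {f 0} e) (R.zeroʳ (f 0))

    +-zero₀ : ∀ f g → f 0 R.≈ R.0# → g 0 R.≈ R.0# → (f +ˢ g) 0 R.≈ R.0#
    +-zero₀ f g e e′ = R.trans (R.+-cong e e′) (R.+-identityˡ R.0#)

    TT TTT NW NB : Ser
    TT  = T *ˢ T
    TTT = T *ˢ TT
    NW = x +ˢ B +ˢ G
    NB = x +ˢ W +ˢ G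

    TT₀ : TT 0 R.≈ R.0#
    TT₀ = *-zeroˡ₀ T T T₀

    W₀ : W 0 R.≈ R.0#
    W₀ = R.trans (at W-eq 0) (*-zeroʳ₀ qˢ (NW *ˢ T) (*-zeroʳ₀ NW T T₀))

    B₀ : B 0 R.≈ R.0#
    B₀ = R.trans (at B-eq 0) (*-zeroʳ₀ yˢ (qˢ *ˢ (NB *ˢ T)) (*-zeroʳ₀ qˢ (NB *ˢ T) (*-zeroʳ₀ NB T T₀)))

    yqq₀ : ∀ f → f 0 R.≈ R.0# → (yˢ *ˢ (qˢ *ˢ (qˢ *ˢ f))) 0 R.≈ R.0#
    yqq₀ f e = *-zeroʳ₀ yˢ (qˢ *ˢ (qˢ *ˢ f)) (*-zeroʳ₀ qˢ (qˢ *ˢ f) (*-zeroʳ₀ qˢ f e))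

    G₀₀ : G₀ 0 R.≈ R.0#
    G₀₀ = R.trans (at G₀-eq 0) (+-zero₀ (yˢ *ˢ (qˢ *ˢ (qˢ *ˢ (qˢ *ˢ TTT)))) (yˢ *ˢ (qˢ *ˢ (qˢ *ˢ (T *ˢ G₀))))
      (yqq₀ (qˢ *ˢ TTT) (*-zeroʳ₀ qˢ TTT (*-zeroˡ₀ T TT T₀))) (yqq₀ (T *ˢ G₀) (*-zeroˡ₀ T G₀ T₀)))

    G-zero : G 0 R.≈ R.0#
    G-zero = R.trans (at G-eq 0) (+-zero₀ G₀ (qˢ *ˢ (qˢ *ˢ (T *ˢ G))) G₀₀
      (*-zeroʳ₀ qˢ (qˢ *ˢ (T *ˢ G)) (*-zeroʳ₀ qˢ (T *ˢ G) (*-zeroˡ₀ T G T₀))))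

    NW₀ : NW 0 R.≈ R.0#
    NW₀ = +-zero₀ (x +ˢ B) G (+-zero₀ x B R.refl B₀) G-zero

    NB₀ : NB 0 R.≈ R.0#
    NB₀ = +-zero₀ (x +ˢ W) G (+-zero₀ x W R.refl W₀) G-zero

    q-at : ∀ f n → qᴿ R.* f n R.≈ (qˢ *ˢ f) n
    q-at f n = R.sym (Sx.const-*ˢ qᴿ f n)

    qq-at : ∀ f n → qᴿ R.* (qᴿ R.* f n) R.≈ (qˢ *ˢ (qˢ *ˢ f)) n
    qq-at f n = R.trans (R.*-congˡ {qᴿ} (q-at f n)) (q-at (qˢ *ˢ f) n)

    y-at : ∀ f {r} n → r R.≈ f n → yᴿ R.* r R.≈ (yˢ *ˢ f) n
    y-at f n e = R.trans (R.*-congˡ {yᴿ} e) (R.sym (Sx.const-*ˢ yᴿ f n))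

  record Counts (n : ℕ) : Set where
    field
      white-count : Count treeWeight (Ok white) n (W n)
      black-count : Count treeWeight (Ok black) n (B n)
      generic-count : Count treeWeight (Ok generic) n (G n)
      tight-count : Count treeWeight Tight n (G₀ n)

    non-white : Count treeWeight (OfKind (_≢ white)) n (NW n)
    non-white = count-⇔
      (λ { (inj₁ (inj₁ o)) → leaf , (λ ()) , o ; (inj₁ (inj₂ o)) → black , (λ ()) , o ; (inj₂ o) → generic , (λ ()) , o })
      (λ { (leaf , _ , o) → inj₁ (inj₁ o) ; (white , w , _) → ⊥-elim (w refl) ; (black , _ , o) → inj₁ (inj₂ o) ; (generic , _ , o) → inj₂ o })
      (count-⊎ (λ { (inj₁ o) o′ → clash o o′ λ () ; (inj₂ o) o′ → clash o o′ λ () })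
        (count-⊎ (λ o o′ → clash o o′ λ ()) (count-leaf n) black-count) generic-count)

    non-black : Count treeWeight (OfKind (_≢ black)) n (NB n)
    non-black = count-⇔
      (λ { (inj₁ (inj₁ o)) → leaf , (λ ()) , o ; (inj₁ (inj₂ o)) → white , (λ ()) , o ; (inj₂ o) → generic , (λ ()) , o })
      (λ { (leaf , _ , o) → inj₁ (inj₁ o) ; (black , w , _) → ⊥-elim (w refl) ; (white , _ , o) → inj₁ (inj₂ o) ; (generic , _ , o) → inj₂ o })
      (count-⊎ (λ { (inj₁ o) o′ → clash o o′ λ () ; (inj₂ o) o′ → clash o o′ λ () })
        (count-⊎ (λ o o′ → clash o o′ λ ()) (count-leaf n) white-count) generic-count)

    any-count : Count treeWeight AnyKind n (T n)
    any-count = count-≈ (R.sym (at T-eq n)) (count-⇔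
      (λ { (inj₁ (inj₁ (inj₁ o))) → leaf , tt , o ; (inj₁ (inj₁ (inj₂ o))) → white , tt , o
         ; (inj₁ (inj₂ o)) → black , tt , o ; (inj₂ o) → generic , tt , o })
      (λ { (leaf , _ , o) → inj₁ (inj₁ (inj₁ o)) ; (white , _ , o) → inj₁ (inj₁ (inj₂ o))
         ; (black , _ , o) → inj₁ (inj₂ o) ; (generic , _ , o) → inj₂ o })
      (count-⊎ (λ { (inj₁ (inj₁ o)) o′ → clash o o′ λ () ; (inj₁ (inj₂ o)) o′ → clash o o′ λ () ; (inj₂ o) o′ → clash o o′ λ () })
        (count-⊎ (λ { (inj₁ o) o′ → clash o o′ λ () ; (inj₂ o) o′ → clash o o′ λ () })
          (count-⊎ (λ o o′ → clash o o′ λ ()) (count-leaf n) white-count) black-count) generic-count))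

  open Counts

  -- All products have factors without constant term and use sizes below n only. The tight trees
  -- enter the generic ones at size n itself, so they are counted before them.
  counts-step : ∀ n → (∀ i → i < n → Counts i) → Counts n
  counts-step n below = record
    { white-count = count-≈ (R.trans (q-at (NW *ˢ T) n) (R.sym (at W-eq n)))
        (count-≅ white-≅ (count-q↑ (count-⊠-positive {f = NW} {T} tree-size≢0 tree-size≢0 NW₀ T₀
          (λ i i<n → non-white (below i i<n)) one)))
    ; black-count = count-≈ (R.trans (y-at (qˢ *ˢ (NB *ˢ T)) n (q-at (NB *ˢ T) n)) (R.sym (at B-eq n)))
        (count-≅ black-≅ (count-y↑ (count-q↑ (count-⊠-positive {f = NB} {T} tree-size≢0 tree-size≢0 NB₀ T₀
          (λ i i<n → non-black (below i i<n)) one))))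
    ; generic-count = count-≈ (R.trans (R.+-congˡ {G₀ n} (qq-at (T *ˢ G) n)) (R.sym (at G-eq n)))
        (count-⇔ (λ { (inj₁ o) → tight-generic o ; (inj₂ o) → loose-generic o }) generic-split
          (count-⊎ tight-loose-disjoint tight-n
            (count-≅ loose-≅ (count-q↑ (count-q↑ (count-⊠-positive {f = T} {G} tree-size≢0 ok-size≢0 T₀ G-zero one
              λ i i<n → generic-count (below i i<n)))))))
    ; tight-count = tight-n
    }
    where
    ok-size≢0 : ∀ {k t} → Ok k t → leavesT t ≢ 0
    ok-size≢0 o = tree-size≢0 (_ , tt , o)
    one : ∀ i → i < n → Count treeWeight AnyKind i (T i)
    one i i<n = any-count (below i i<n)
    two : ∀ i → i < n → Count (treeWeight ⊠ treeWeight) (λ (a , b) → AnyKind a × AnyKind b) i (TT i)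
    two i i<n = count-⊠-positive {f = T} {T} tree-size≢0 tree-size≢0 T₀ T₀
      (λ j j<i → one j (ℕₚ.<-trans j<i i<n)) (λ j j<i → one j (ℕₚ.<-trans j<i i<n))
    three : Count (treeWeight ⊠ (treeWeight ⊠ treeWeight)) (λ (a , b , c) → AnyKind a × AnyKind b × AnyKind c) n (TTT n)
    three = count-⊠-positive {f = T} {TT} tree-size≢0 (λ (a , b) e → tree-size≢0 a (ℕₚ.m+n≡0⇒m≡0 _ e)) T₀ TT₀ one two
    tight-n : Count treeWeight Tight n (G₀ n)
    tight-n = count-≈
      (R.trans (R.+-cong (y-at (qˢ *ˢ (qˢ *ˢ (qˢ *ˢ TTT))) n (R.trans (R.*-congˡ {qᴿ} (qq-at TTT n)) (q-at (qˢ *ˢ (qˢ *ˢ TTT)) n)))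
                         (y-at (qˢ *ˢ (qˢ *ˢ (T *ˢ G₀))) n (qq-at (T *ˢ G₀) n)))
               (R.sym (at G₀-eq n)))
      (count-⇔ (λ { (inj₁ (o , _)) → o ; (inj₂ (o , _)) → o }) tight-split
        (count-⊎ (λ (_ , h≡) (_ , 3≤h) → ℕₚ.<⇒≢ 3≤h (sym h≡))
          (count-≅ small-≅ (count-y↑ (count-q↑ (count-q↑ (count-q↑ three)))))
          (count-≅ large-≅ (count-y↑ (count-q↑ (count-q↑ (count-⊠-positive {f = T} {G₀} tree-size≢0 (ok-size≢0 ∘ tight-generic) T₀ G₀₀
            one λ i i<n → tight-count (below i i<n))))))))

  tree-count : ∀ n → Count treeWeight AnyKind n (T n)
  tree-count n = any-count (counts n)
    where
    counts : ∀ n → Counts n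
    counts = <-rec Counts λ n below → counts-step n (λ i i<n → below i<n)

-- Comparing trees with the tests of the statement

T-∧⁻ : ∀ {a b} → T (a ∧ b) → T a × T b
T-∧⁻ = Equivalence.to T-∧

T-∧⁺ : ∀ {a b} → T a → T b → T (a ∧ b)
T-∧⁺ p q = Equivalence.from T-∧ (p , q)

-- The children are analysed before the kind of their parent is known, so both colour constraints
-- stay conditional on the parent.
Compatible : Tr → Kind → Set
Compatible p k = (isWhite p ≡ true → k ≢ white) × (isBlack p ≡ true → k ≢ black)

not-∧ : ∀ {a b} → T (not (a ∧ b)) → a ≡ true → b ≢ true
not-∧ () refl refl

compatible : ∀ p {k c} → Ok k c → T (not (isWhite p ∧ isWhite c)) → T (not (isBlack p ∧ isBlack c)) → Compatible p k
compatible p o w b = (λ { e refl → not-∧ w e (isWhite-true o) }) , (λ { e refl → not-∧ b e (isBlack-true o) })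

assemble : ∀ h cs → 2 ≤ length cs → 1 ≤ h → h ≤ length cs → Offspring (Compatible (nd h cs)) cs → AnyKind (nd h cs)
assemble 1 (_ ∷ _ ∷ _) _ _ _ os = white , tt , white (offspring-map (λ (w , _) → w refl) os)
assemble 1 (_ ∷ []) (s≤s ()) _ _ os
assemble h@(suc (suc _)) cs 2≤ _ h≤ os with ℕₚ.m≤n⇒m<n∨m≡n h≤
... | inj₁ h< = generic , tt , generic (s≤s (s≤s z≤n)) h< (offspring-map (λ _ → tt) os)
assemble (suc (suc _)) (_ ∷ _ ∷ cs) _ _ _ os | inj₂ refl =
  black , tt , black (offspring-map (λ (_ , b) → b (≡ᵇ-refl (length cs))) os)

valid⇒kind : ∀ t → T (validT t) → T (contrT t) → AnyKind t
valid⇒offspring : ∀ p cs → T (validL cs) → T (contrL p cs) → Offspring (Compatible p) cs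

valid⇒kind bd _ _ = leaf , tt , leaf
valid⇒kind (nd h cs) v c =
  let 2≤ , v₁ = T-∧⁻ {2 ℕ.≤ᵇ length cs} v
      1≤h , v₂ = T-∧⁻ {1 ℕ.≤ᵇ h} v₁
      h≤ , vs = T-∧⁻ {h ℕ.≤ᵇ length cs} v₂
  in assemble h cs (ℕₚ.≤ᵇ⇒≤ 2 _ 2≤) (ℕₚ.≤ᵇ⇒≤ 1 h 1≤h) (ℕₚ.≤ᵇ⇒≤ h _ h≤) (valid⇒offspring (nd h cs) cs vs c)

valid⇒offspring p []       _ _ = []
valid⇒offspring p (t ∷ ts) v c =
  let vt , vts = T-∧⁻ {validT t} v
      w , c₁ = T-∧⁻ {not (isWhite p ∧ isWhite t)} c
      b , c₂ = T-∧⁻ {not (isBlack p ∧ isBlack t)} c₁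
      ct , cts = T-∧⁻ {contrT t} c₂
      k , _ , o = valid⇒kind t vt ct
  in (k , compatible p o w b , o) ∷ valid⇒offspring p ts vts cts

kind⇒valid : ∀ {k t} → Ok k t → T (validT t) × T (contrT t)
offspring⇒valid : ∀ {S : Kind → Set} p {cs} → Offspring S cs → (∀ {k c} → S k → Ok k c → T (not (isWhite p ∧ isWhite c)) × T (not (isBlack p ∧ isBlack c))) →
  T (validL cs) × T (contrL p cs)

kind⇒valid leaf = tt , tt
kind⇒valid (white {u} {v} {cs} os) =
  offspring⇒valid (nd 1 (u ∷ v ∷ cs)) os λ {k} {c} k≢ o → not-T (isWhite-false (k , k≢ , o)) , tt
  where
  not-T : ∀ {b} → b ≡ false → T (not b)
  not-T refl = tt
kind⇒valid (black {u} {v} {cs} os) =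
  let vs , cs′ = offspring⇒valid (nd (2 ℕ.+ length cs) (u ∷ v ∷ cs)) os λ {k} {c} k≢ o → tt , not-T _ (isBlack-false (k , k≢ , o))
  in T-∧⁺ {length cs <ᵇ suc (length cs)} (ℕₚ.<⇒<ᵇ (ℕₚ.n<1+n (length cs))) vs , cs′
  where
  not-T : ∀ a {b} → b ≡ false → T (not (a ∧ b))
  not-T true  refl = tt
  not-T false refl = tt
kind⇒valid (generic {h} {cs} 2≤h h< os) =
  let vs , cs′ = offspring⇒valid (nd h cs) os λ {_} {c} _ _ →
        not-T (isWhite c) (h≢1 2≤h) , not-T (isBlack c) (<⇒≡ᵇ-false h<)
  in T-∧⁺ {2 ℕ.≤ᵇ length cs} (ℕₚ.≤⇒≤ᵇ (ℕₚ.≤-trans 2≤h (ℕₚ.<⇒≤ h<)))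
       (T-∧⁺ {1 ℕ.≤ᵇ h} (ℕₚ.≤⇒≤ᵇ (ℕₚ.<⇒≤ 2≤h)) (T-∧⁺ {h ℕ.≤ᵇ length cs} (ℕₚ.≤⇒≤ᵇ (ℕₚ.<⇒≤ h<)) vs)) , cs′
  where
  h≢1 : ∀ {h} → 2 ≤ h → (h ≡ᵇ 1) ≡ false
  h≢1 (s≤s (s≤s _)) = refl
  not-T : ∀ {a} b → a ≡ false → T (not (a ∧ b))
  not-T _ refl = tt

offspring⇒valid p [] f = tt , tt
offspring⇒valid p (_∷_ {t} {ts} (k , s , o) os) f =
  let vt , ct = kind⇒valid o
      vs , cs = offspring⇒valid p os f
      w , b = f s o
  in T-∧⁺ {validT t} vt vs
   , T-∧⁺ {not (isWhite p ∧ isWhite t)} w (T-∧⁺ {not (isBlack p ∧ isBlack t)} b (T-∧⁺ {contrT t} ct cs))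

-- A tree with I internal and N boundary vertices has I + N - 1 edges, so the internal degrees add
-- up to 2I + N - 2 and Σ (2h - deg) + N = 2 (1 + Σ (h - 1)). The version for lists carries one edge
-- to the parent for each tree.
hsum-degree : ∀ {k t} → Ok k t → hsumT t ℤ.+ + suc (leavesT t) ≡ + 2 ℤ.* + suc (yT t)
hsumL-degree : ∀ {S cs} → Offspring S cs → hsumL cs ℤ.+ + leavesL cs ≡ + length cs ℤ.+ + 2 ℤ.* + yL cs

hsum-vertex : ∀ {S cs} h → Offspring S cs →
  hsumT (nd (suc h) cs) ℤ.+ + suc (leavesL cs) ≡ + 2 ℤ.* + suc (h ℕ.+ yL cs)
hsum-vertex {cs = cs} h os = trans
  (cong (λ z → (z ℤ.- + suc (length cs) ℤ.+ hsumL cs) ℤ.+ + suc (leavesL cs)) (ℤₚ.pos-* 2 (suc h)))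
  (trans (solve 4 (λ h m s l → (con (+ 2) :* (con (+ 1) :+ h) :- (con (+ 1) :+ m) :+ s) :+ (con (+ 1) :+ l)
                          := con (+ 2) :* (con (+ 1) :+ h) :- m :+ (s :+ l)) refl (+ h) (+ length cs) (hsumL cs) (+ leavesL cs))
  (trans (cong (λ z → + 2 ℤ.* + suc h ℤ.- + length cs ℤ.+ z) (hsumL-degree os))
  (solve 3 (λ h m y → con (+ 2) :* (con (+ 1) :+ h) :- m :+ (m :+ con (+ 2) :* y)
              := con (+ 2) :* (con (+ 1) :+ (h :+ y))) refl (+ h) (+ length cs) (+ yL cs))))
  where open ℤSolver

hsum-degree leaf = refl
hsum-degree (white os) = hsum-vertex 0 os
hsum-degree (black {cs = cs} os) = hsum-vertex (suc (length cs)) os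
hsum-degree (generic {suc h} _ _ os) = hsum-vertex h os

hsumL-degree [] = refl
hsumL-degree (_∷_ {t} {ts} (k , s , o) os) = trans
  (solve 4 (λ a b l m → (a :+ b) :+ (l :+ m) := ((a :+ (con (+ 1) :+ l)) :- con (+ 1)) :+ (b :+ m)) refl
    (hsumT t) (hsumL ts) (+ leavesT t) (+ leavesL ts))
  (trans (cong₂ (λ a b → (a ℤ.- + 1) ℤ.+ b) (hsum-degree o) (hsumL-degree os))
  (solve 3 (λ y n z → (con (+ 2) :* (con (+ 1) :+ y) :- con (+ 1)) :+ (n :+ con (+ 2) :* z)
              := (con (+ 1) :+ n) :+ con (+ 2) :* (y :+ z)) refl (+ yT t) (+ length ts) (+ yL ts)))
  where open ℤSolver

dsum-degree : ∀ {k t} → Ok k t → dsumT t ≡ + qT t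
dsumL-degree : ∀ {S cs} → Offspring S cs → dsumL cs ≡ + qL cs

-- The truncated subtractions in `vertexDim` are exact: there are at least two children, and at
-- least three at a generic vertex.
dsum-vertex : ∀ {S cs} h → 2 ≤ length cs → Offspring S cs → dsumT (nd h cs) ≡ + qT (nd h cs)
dsum-vertex {cs = cs} h 2≤ os = trans (cong₂ ℤ._+_ (vertex h (length cs) 2≤) (dsumL-degree os))
  (sym (ℤₚ.pos-+ (vertexDim h (length cs)) (qL cs)))
  where
  double : ∀ c → 2 ℕ.* (4 ℕ.+ c) ≡ 5 ℕ.+ (c ℕ.+ (3 ℕ.+ c))
  double = solve 1 (λ c → con 2 :* (con 4 :+ c) := con 5 :+ (c :+ (con 3 :+ c))) refl
    where open ℕSolver
  generic-vertex : ∀ c → 3 ≤ c → + (2 ℕ.* suc c) ℤ.- + 4 ℤ.- + 1 ≡ + (c ℕ.+ c ∸ 3)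
  generic-vertex 1 (s≤s ())
  generic-vertex 2 (s≤s (s≤s ()))
  generic-vertex (suc (suc (suc c))) _ = cong (λ z → + z ℤ.- + 4 ℤ.- + 1) (double c)
  vertex : ∀ h c → 2 ≤ c → mval h (suc c) ℤ.- + 1 ≡ + vertexDim h c
  vertex h c 2≤c with (1 <ᵇ h) ∧ (h <ᵇ c) in e
  vertex h c 2≤c | true =
    let 1<h , h<c = T-∧⁻ {1 <ᵇ h} (subst T (sym e) tt)
    in generic-vertex c (ℕₚ.≤-trans (s≤s (ℕₚ.<ᵇ⇒< 1 h 1<h)) (ℕₚ.<ᵇ⇒< h c h<c))
  vertex h (suc c) 2≤c | false = refl

dsum-degree leaf = refl
dsum-degree (white os) = dsum-vertex 1 (s≤s (s≤s z≤n)) os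
dsum-degree (black {cs = cs} os) = dsum-vertex (2 ℕ.+ length cs) (s≤s (s≤s z≤n)) os
dsum-degree (generic {h} 2≤h h< os) = dsum-vertex h (ℕₚ.≤-trans 2≤h (ℕₚ.<⇒≤ h<)) os

dsumL-degree [] = refl
dsumL-degree (_∷_ {t} {ts} (_ , _ , o) os) =
  trans (cong₂ ℤ._+_ (dsum-degree o) (dsumL-degree os)) (sym (ℤₚ.pos-+ (qT t) (qL ts)))

data OkG : GTree → Set where
  single₀ : OkG (single 0)
  single₁ : OkG (single 1)
  rooted  : ∀ {t} → AnyKind t → OkG (rooted t)

validG⇒OkG : ∀ g → T (validG g) → T (contrG g) → OkG g
validG⇒OkG (single 0) _ _ = single₀
validG⇒OkG (single 1) _ _ = single₁
validG⇒OkG (rooted t) v c = rooted (valid⇒kind t v c)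

OkG⇒validG : ∀ {g} → OkG g → T (validG g) × T (contrG g)
OkG⇒validG single₀ = tt , tt
OkG⇒validG single₁ = tt , tt
OkG⇒validG (rooted (_ , _ , o)) = kind⇒valid o

-- The successors are the summands 1 in the helicity 1 + Σ (h - 1) and the dimension 1 + Σ (m - 1).
yG qG : GTree → ℕ
yG (single h) = h
yG (rooted t) = suc (yT t)
qG (single _) = 0
qG (rooted t) = suc (qT t)

gtreeWeight : Weight GTree
gtreeWeight = weight nbd yG qG

twiceHel-degree : ∀ {g} → OkG g → twiceHelG g ≡ + 2 ℤ.* + yG g
twiceHel-degree single₀ = refl
twiceHel-degree single₁ = refl
twiceHel-degree (rooted (_ , _ , o)) = hsum-degree o

two-leaves : ∀ {S u v cs} → Offspring S (u ∷ v ∷ cs) → 2 ≤ leavesL (u ∷ v ∷ cs)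
two-leaves ((_ , _ , o) ∷ (_ , _ , o′) ∷ _) =
  ℕₚ.+-mono-≤ (leaves-positive o) (ℕₚ.≤-trans (leaves-positive o′) (ℕₚ.m≤m+n _ _))

dim-rooted : ∀ {k t} → Ok k t → 2 ≤ leavesT t → dimG (rooted t) ≡ + suc (qT t)
dim-rooted {t = t} o 2≤ with suc (leavesT t) ℕ.≤ᵇ 2 in e
... | true  = ⊥-elim (ℕₚ.<⇒≱ 2≤ (ℕₚ.≤-pred (ℕₚ.≤ᵇ⇒≤ (suc (leavesT t)) 2 (subst T (sym e) tt))))
... | false = cong (λ z → + 1 ℤ.+ z) (dsum-degree o)

-- The exceptional dimension n - 1 for n ≤ 2 concerns only boundary leaves and the edge from b₁ to
-- b₂; on that edge it agrees with the general formula.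
dim-degree : ∀ {g} → OkG g → dimG g ≡ + qG g
dim-degree single₀ = refl
dim-degree single₁ = refl
dim-degree (rooted (_ , _ , leaf)) = refl
dim-degree (rooted (_ , _ , o@(white os))) = dim-rooted o (two-leaves os)
dim-degree (rooted (_ , _ , o@(black os))) = dim-rooted o (two-leaves os)
dim-degree (rooted (_ , _ , o@(generic _ _ os@(_ ∷ _ ∷ _)))) = dim-rooted o (two-leaves os)
dim-degree (rooted (_ , _ , generic (s≤s (s≤s _)) (s≤s ()) (_ ∷ [])))

isCTree⇒ : ∀ {n k r} g → T (isCTree n k r g) → OkG g × nbd g ≡ n × + yG g ≡ k × + qG g ≡ r
isCTree⇒ {n} {k} {r} g p =
  let v , p₁ = T-∧⁻ {validG g} p
      c , p₂ = T-∧⁻ {contrG g} p₁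
      n≡ , p₃ = T-∧⁻ {nbd g ≡ᵇ n} p₂
      k≡ , r≡ = T-∧⁻ {twiceHelG g ==ℤ (+ 2 ℤ.* k)} p₃
      o = validG⇒OkG g v c
  in o , ℕₚ.≡ᵇ⇒≡ (nbd g) n n≡
       , ℤₚ.*-cancelˡ-≡ (+ 2) (+ yG g) k (trans (sym (twiceHel-degree o)) (toWitness k≡))
       , trans (sym (dim-degree o)) (toWitness r≡)

⇒isCTree : ∀ {n k r} g → OkG g × nbd g ≡ n × + yG g ≡ k × + qG g ≡ r → T (isCTree n k r g)
⇒isCTree {n} {k} {r} g (o , n≡ , k≡ , r≡) =
  let v , c = OkG⇒validG o
  in T-∧⁺ {validG g} v (T-∧⁺ {contrG g} c (T-∧⁺ {nbd g ≡ᵇ n} (ℕₚ.≡⇒≡ᵇ (nbd g) n n≡)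
       (T-∧⁺ {twiceHelG g ==ℤ (+ 2 ℤ.* k)} (fromWitness (trans (twiceHel-degree o) (cong (+ 2 ℤ.*_) k≡)))
             (fromWitness (trans (dim-degree o) r≡)))))

nbd≢0 : ∀ g → nbd g ≢ 0
nbd≢0 (single _) ()
nbd≢0 (rooted _) ()

module _ {S : Ser} (counts : ∀ n → Count treeWeight AnyKind n (S n)) where

  Gtree≋ : Gtree S ≋ x *ˢ (Sx.1ˢ +ˢ yˢ +ˢ yˢ *ˢ (qˢ *ˢ S))
  Gtree≋ = ⊗-cong X≋ (⊕-cong (⊕-cong 𝟙≋ Y≋) (Sx.S.trans (⊗-cong (⊗-cong Y≋ Q≋) (Sx.S.refl {S})) (Sx.S.*-assoc yˢ qˢ S)))

  gtree-count : ∀ n → Count gtreeWeight OkG n (Gtree S n)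
  gtree-count zero    = count-≈ (R.sym (R.trans (at Gtree≋ 0) (Sx.x-*ˢ-zero (Sx.1ˢ +ˢ yˢ +ˢ yˢ *ˢ (qˢ *ˢ S))))) (count-∅ λ {g} _ → nbd≢0 g)
  gtree-count (suc m) = count-≈ (R.sym (R.trans (at Gtree≋ (suc m)) (Sx.x-*ˢ-suc (Sx.1ˢ +ˢ yˢ +ˢ yˢ *ˢ (qˢ *ˢ S)) m)))
    (count-⇔ {V = λ g → (g ≡ single 0 ⊎ g ≡ single 1) ⊎ ∃[ t ] (g ≡ rooted t × AnyKind t)}
      (λ { (inj₁ (inj₁ refl)) → single₀ ; (inj₁ (inj₂ refl)) → single₁ ; (inj₂ (_ , refl , o)) → rooted o })
      (λ { single₀ → inj₁ (inj₁ refl) ; single₁ → inj₁ (inj₂ refl) ; (rooted o) → inj₂ (_ , refl , o) })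
      (count-⊎ (λ { (inj₁ refl) (_ , () , _) ; (inj₂ refl) (_ , () , _) })
        (count-⊎ (λ { refl () }) (count₀ m) (count₁ m))
        (count-≈ (R.trans (R.*-congˡ {yᴿ} (R.sym (Sx.const-*ˢ qᴿ S m))) (R.sym (Sx.const-*ˢ yᴿ (qˢ *ˢ S) m)))
          (count-≅ rooted-≅ (count-x↑ (count-y↑ (count-q↑ (counts m))))))))
    where
    count₀ : ∀ m → Count gtreeWeight (_≡ single 0) (suc m) (Sx.1ˢ m)
    count₀ zero    zero    zero    = card-singleton (single 0) (refl , refl , refl , refl) proj₁
    count₀ zero    zero    (suc _) = card-∅ λ { (refl , _ , _ , ()) }
    count₀ zero    (suc _) _       = card-∅ λ { (refl , _ , () , _) }
    count₀ (suc _)                 = count-∅ λ { refl () }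
    count₁ : ∀ m → Count gtreeWeight (_≡ single 1) (suc m) (yˢ m)
    count₁ zero    zero          _       = card-∅ λ { (refl , _ , () , _) }
    count₁ zero    (suc zero)    zero    = card-singleton (single 1) (refl , refl , refl , refl) proj₁
    count₁ zero    (suc zero)    (suc _) = card-∅ λ { (refl , _ , _ , ()) }
    count₁ zero    (suc (suc _)) _       = card-∅ λ { (refl , _ , () , _) }
    count₁ (suc _)                       = count-∅ λ { refl () }
    rooted-≅ : Isomorphism (x↑ (y↑ (q↑ treeWeight))) AnyKind gtreeWeight (λ g → ∃[ t ] (g ≡ rooted t × AnyKind t))
    rooted-≅ = record
      { to = rooted
      ; from = λ { (rooted t) → t ; (single _) → bd }
      ; to-valid = λ {t} o → t , refl , o
      ; from-valid = λ { (_ , refl , o) → o }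
      ; from-to = λ _ → refl
      ; to-from = λ { (_ , refl , _) → refl }
      ; to-size = λ _ → refl
      ; to-ydeg = λ _ → refl
      ; to-qdeg = λ _ → refl
      }

  ctree-card : ∀ n k r → Card (T ∘ isCTree n k r) (coeff (Gtree S) n k r)
  ctree-card n (+ k) (+ r) = card-⇔
    (λ {g} (o , n≡ , k≡ , r≡) → ⇒isCTree {n} {+ k} {+ r} g (o , n≡ , cong +_ k≡ , cong +_ r≡))
    (λ {g} p → let o , n≡ , k≡ , r≡ = isCTree⇒ {n} {+ k} {+ r} g p in o , n≡ , ℤₚ.+-injective k≡ , ℤₚ.+-injective r≡)
    (gtree-count n k r)
  ctree-card n (+ k) ℤ.-[1+ r ] = card-∅ λ {g} p → case (isCTree⇒ {n} {+ k} { ℤ.-[1+ r ]} g p) of λ { (_ , _ , _ , ()) }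
  ctree-card n ℤ.-[1+ k ] r = card-∅ λ {g} p → case (isCTree⇒ {n} { ℤ.-[1+ k ]} {r} g p) of λ { (_ , _ , () , _) }

-- Forests

Component : Set
Component = List ℕ × GTree

NonCrossing : List ℕ → List ℕ → Set
NonCrossing P Q = ∀ {a b c d} → a ∈ P → b ∈ Q → c ∈ P → d ∈ Q → a < b → b < c → c < d → ⊥

-- The conditions on a forest are made pairwise in order to pass to sublists and concatenations;
-- covering each label exactly once becomes covering together with disjointness.
record Ordered (p p′ : Component) : Set where
  constructor ordered
  field
    disjoint : ∀ {i} → i ∈ proj₁ p → i ∈ proj₁ p′ → ⊥
    nc       : NonCrossing (proj₁ p) (proj₁ p′)
    nc′      : NonCrossing (proj₁ p′) (proj₁ p)
    heads    : headOr0 (proj₁ p) < headOr0 (proj₁ p′)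

-- The component lies in a single gap of the block D.
record Nested (D : List ℕ) (p : Component) : Set where
  constructor nested
  field
    disjoint : ∀ {i} → i ∈ D → i ∈ proj₁ p → ⊥
    one-gap  : ∀ {c d c′} → c ∈ proj₁ p → d ∈ D → c′ ∈ proj₁ p → c < d → d < c′ → ⊥

record ComponentOk (p : Component) : Set where
  constructor component
  field
    increasing : AllPairs _<_ (proj₁ p)
    len        : length (proj₁ p) ≡ nbd (proj₂ p)
    tree       : OkG (proj₂ p)

Covered : ℕ → List ℕ → Forest → Set
Covered i D F = i ∈ D ⊎ Any (λ p → i ∈ proj₁ p) F

-- F is a noncrossing forest on the labels s ≤ i < e outside D, none of whose components is separated by D:
-- D is the part still to come of a block that encloses F.
record Valid (s e : ℕ) (D : List ℕ) (F : Forest) : Set where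
  constructor valid
  field
    pending    : AllPairs _<_ D
    components : All ComponentOk F
    pairs      : AllPairs Ordered F
    nests      : All (Nested D) F
    range      : ∀ {i} → Covered i D F → s ≤ i × i < e
    cover      : ∀ {i} → s ≤ i → i < e → Covered i D F
open Valid

head-∈ : ∀ {p} → ComponentOk p → headOr0 (proj₁ p) ∈ proj₁ p
head-∈ {[]    , g} ok = ⊥-elim (nbd≢0 g (sym (ComponentOk.len ok)))
head-∈ {_ ∷ _ , g} ok = here refl

head-≤ : ∀ {p i} → ComponentOk p → i ∈ proj₁ p → headOr0 (proj₁ p) ≤ i
head-≤ {_ ∷ _ , _} ok (here refl) = ℕₚ.≤-refl
head-≤ {_ ∷ _ , _} (component (b< ∷ _) _ _) (there i∈) = ℕₚ.<⇒≤ (All.lookup b< i∈)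

lookup-any : ∀ {F : Forest} {P : Component → Set} {i} → All P F → Any (λ p → i ∈ proj₁ p) F → ∃[ p ] (P p × i ∈ proj₁ p)
lookup-any (p ∷ _)  (here i∈)  = _ , p , i∈
lookup-any (_ ∷ ps) (there i∈) = lookup-any ps i∈

All-elements : ∀ {F : Forest} {P : ℕ → Set} → (∀ {i} → Any (λ p → i ∈ proj₁ p) F → P i) → All (λ p → ∀ {i} → i ∈ proj₁ p → P i) F
All-elements {[]}    f = []
All-elements {_ ∷ _} f = (λ i∈ → f (here i∈)) ∷ All-elements (f ∘ there)

-- Decomposing a forest at its first label and at a pending label

valid-nil : ∀ {s F} → Valid s s [] F → F ≡ []
valid-nil {F = []}     _ = refl
valid-nil {F = p ∷ F} v with components v
... | ok ∷ _ = let s≤ , <s = range v (inj₂ (here (head-∈ ok))) in ⊥-elim (ℕₚ.<⇒≱ <s s≤)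

nil-valid : ∀ {s} → Valid s s [] []
nil-valid = valid [] [] [] [] (λ { (inj₁ ()) ; (inj₂ ()) }) (λ s≤i i<s → ⊥-elim (ℕₚ.<⇒≱ i<s s≤i))

-- The label s is covered and the minima increase, so s is the least element of the first block. The
-- rest of this block becomes pending.
valid-first : ∀ {s e F} → s < e → Valid s e [] F →
  ∃[ B ] ∃[ g ] ∃[ F′ ] (F ≡ ((s ∷ B , g) ∷ F′) × nbd g ≡ suc (length B) × OkG g × Valid (suc s) e B F′)
valid-first {s} {e} {[]} s<e v with cover v ℕₚ.≤-refl s<e
... | inj₁ ()
... | inj₂ ()
valid-first {s} {e} {(B , g) ∷ F} s<e v with components v | pairs v | B-starts
  where
  B-starts : ∃[ B′ ] (B ≡ s ∷ B′)
  B-starts = start B refl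
    where
    b≤s : headOr0 B ≤ s
    b≤s with components v | pairs v | cover v ℕₚ.≤-refl s<e
    ... | ok ∷ _   | _      | inj₂ (here s∈)  = head-≤ ok s∈
    ... | _  ∷ oks | ps ∷ _ | inj₂ (there s∈) =
      let p , (ok , o) , s∈p = lookup-any (All.zip (oks , ps)) s∈
      in ℕₚ.<⇒≤ (ℕₚ.<-≤-trans (Ordered.heads o) (head-≤ ok s∈p))
    start : ∀ C → B ≡ C → ∃[ B′ ] (B ≡ s ∷ B′)
    start C B≡ with components v
    start [] refl | ok ∷ _ = ⊥-elim (nbd≢0 g (sym (ComponentOk.len ok)))
    start (b ∷ B′) refl | ok ∷ _ = B′ , cong (_∷ B′) (ℕₚ.≤-antisym b≤s (proj₁ (range v (inj₂ (here (here refl))))))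
valid-first {s} {e} {(.(s ∷ B) , g) ∷ F} s<e v | ok ∷ oks | ps ∷ pairs′ | B , refl =
  B , g , F , refl , sym (ComponentOk.len ok) , ComponentOk.tree ok , valid
    (AllPairs.tail (ComponentOk.increasing ok)) oks pairs′
    (All.zipWith (λ (o , s<) → nested (λ i∈ i∈′ → Ordered.disjoint o (there i∈) i∈′)
                                      -- A component on both sides of a later label d of the block
                                      -- would cross it at s < c < d < c′.
                                      (λ c∈ d∈ c′∈ c<d d<c′ → Ordered.nc o (here refl) c∈ (there d∈) c′∈ (s< c∈) c<d d<c′))
      (ps , All-elements later))
    range′ cover′
  where
  s<B : All (s <_) B
  s<B = AllPairs.head (ComponentOk.increasing ok)
  later : ∀ {i} → Any (λ p → i ∈ proj₁ p) F → s < i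
  later {i} i∈ = ℕₚ.≤∧≢⇒< (proj₁ (range v (inj₂ (there i∈)))) λ { refl →
    let _ , o , i∈p = lookup-any ps i∈ in Ordered.disjoint o (here refl) i∈p }
  range′ : ∀ {i} → Covered i B F → suc s ≤ i × i < e
  range′ (inj₁ i∈) = All.lookup s<B i∈ , proj₂ (range v (inj₂ (here (there i∈))))
  range′ (inj₂ i∈) = later i∈ , proj₂ (range v (inj₂ (there i∈)))
  cover′ : ∀ {i} → suc s ≤ i → i < e → Covered i B F
  cover′ s<i i<e with cover v (ℕₚ.<⇒≤ s<i) i<e
  ... | inj₂ (here (here refl)) = ⊥-elim (ℕₚ.<-irrefl refl s<i)
  ... | inj₂ (here (there i∈))  = inj₁ i∈
  ... | inj₂ (there i∈)         = inj₂ i∈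

first-valid : ∀ {s e B g F} → s < e → nbd g ≡ suc (length B) → OkG g → Valid (suc s) e B F → Valid s e [] ((s ∷ B , g) ∷ F)
first-valid {s} {e} {B} {g} {F} s<e len g-ok v = valid []
  (component (All.tabulate (λ i∈ → proj₁ (range v (inj₁ i∈))) ∷ pending v) (sym len) g-ok ∷ components v)
  (All.zipWith enclosed (nests v , All.zip (components v , All-elements λ i∈ → proj₁ (range v (inj₂ i∈)))) ∷ pairs v)
  (All.tabulate λ _ → nested (λ ()) λ _ ()) range′ cover′
  where
  enclosed : ∀ {p} → Nested B p × (ComponentOk p × (∀ {i} → i ∈ proj₁ p → s < i)) → Ordered (s ∷ B , g) p
  enclosed (n , ok , s<) = ordered
    (λ { (here refl) i∈ → ℕₚ.<-irrefl refl (s< i∈) ; (there i∈) i∈′ → Nested.disjoint n i∈ i∈′ })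
    (λ { _ b∈ (here refl) _ _ b<c _ → ℕₚ.<-asym b<c (s< b∈)
       ; _ b∈ (there c∈) d∈ _ b<c c<d → Nested.one-gap n b∈ c∈ d∈ b<c c<d })
    (λ { a∈ (here refl) _ _ a<b _ _ → ℕₚ.<-asym a<b (s< a∈)
       ; a∈ (there b∈) c∈ _ a<b b<c _ → Nested.one-gap n a∈ b∈ c∈ a<b b<c })
    (s< (head-∈ ok))
  range′ : ∀ {i} → Covered i [] ((s ∷ B , g) ∷ F) → s ≤ i × i < e
  range′ (inj₂ (here (here refl))) = ℕₚ.≤-refl , s<e
  range′ (inj₂ (here (there i∈)))  = let s< , <e = range v (inj₁ i∈) in ℕₚ.<⇒≤ s< , <e
  range′ (inj₂ (there i∈))         = let s< , <e = range v (inj₂ i∈) in ℕₚ.<⇒≤ s< , <e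
  cover′ : ∀ {i} → s ≤ i → i < e → Covered i [] ((s ∷ B , g) ∷ F)
  cover′ {i} s≤i i<e with ℕₚ.m≤n⇒m<n∨m≡n s≤i
  ... | inj₂ refl = inj₂ (here (here refl))
  ... | inj₁ s<i with cover v s<i i<e
  ... | inj₁ i∈ = inj₂ (here (there i∈))
  ... | inj₂ i∈ = inj₂ (there i∈)

headLabel : Component → ℕ
headLabel p = headOr0 (proj₁ p)

sorted-split : ∀ d F → AllPairs Ordered F →
  ∃[ F₁ ] ∃[ F₂ ] (F ≡ F₁ ++ F₂ × All (λ p → headLabel p < d) F₁ × All (λ p → d ≤ headLabel p) F₂)
sorted-split d []      []         = [] , [] , refl , [] , []
sorted-split d (p ∷ F) (o ∷ os) with headLabel p ℕ.<? d
... | yes p<d = let F₁ , F₂ , e , lo , hi = sorted-split d F os in p ∷ F₁ , F₂ , cong (p ∷_) e , p<d ∷ lo , hi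
... | no  p≮d = [] , p ∷ F , refl , [] , ℕₚ.≮⇒≥ p≮d ∷ All.map (λ o → ℕₚ.≤-trans (ℕₚ.≮⇒≥ p≮d) (ℕₚ.<⇒≤ (Ordered.heads o))) o

AllPairs-++⁻ : ∀ {A : Set} {R : A → A → Set} (xs : List A) {ys} → AllPairs R (xs ++ ys) → AllPairs R xs × AllPairs R ys
AllPairs-++⁻ []       rs       = [] , rs
AllPairs-++⁻ (x ∷ xs) (r ∷ rs) = let rxs , rys = AllPairs-++⁻ xs rs in Allₚ.++⁻ˡ xs r ∷ rxs , rys

Below Above : ℕ → Component → Set
Below d p = ∀ {i} → i ∈ proj₁ p → i < d
Above d p = ∀ {i} → i ∈ proj₁ p → d < i

-- A component may neither contain `d` nor lie on both sides of it, so its least label decides on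
-- which side it is.
nested-below : ∀ {d D p} → Nested (d ∷ D) p → ComponentOk p → headLabel p < d → Below d p
nested-below {d} n ok h<d {i} i∈ with ℕₚ.<-cmp i d
... | tri< i<d _ _ = i<d
... | tri≈ _ refl _ = ⊥-elim (Nested.disjoint n (here refl) i∈)
... | tri> _ _ d<i = ⊥-elim (Nested.one-gap n (head-∈ ok) (here refl) i∈ h<d d<i)

nested-above : ∀ {d D p} → Nested (d ∷ D) p → ComponentOk p → d ≤ headLabel p → Above d p
nested-above n ok d≤h i∈ = ℕₚ.≤∧≢⇒< (ℕₚ.≤-trans d≤h (head-≤ ok i∈)) λ { refl → Nested.disjoint n (here refl) i∈ }

nested-tail : ∀ {d D p} → Nested (d ∷ D) p → Nested D p
nested-tail n = nested (λ i∈ → Nested.disjoint n (there i∈)) (λ c∈ d∈ → Nested.one-gap n c∈ (there d∈))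

-- The list is sorted by least labels, so the components below `d` form a prefix. As `d` is the
-- first pending label, nothing is pending in front of it.
valid-split : ∀ {s e d D F} → Valid s e (d ∷ D) F →
  ∃[ F₁ ] ∃[ F₂ ] (F ≡ F₁ ++ F₂ × All (λ p → headLabel p < d) F₁ × All (λ p → d ≤ headLabel p) F₂
                   × s ≤ d × d < e × Valid s d [] F₁ × Valid (suc d) e D F₂)
valid-split {s} {e} {d} {D} {F} v with sorted-split d F (pairs v)
... | F₁ , F₂ , refl , lo , hi = F₁ , F₂ , refl , lo , hi , s≤d , d<e , valid₁ , valid₂
  where
  s≤d = proj₁ (range v (inj₁ (here refl)))
  d<e = proj₂ (range v (inj₁ (here refl)))
  d<D : All (d <_) D
  d<D = AllPairs.head (pending v)
  oks₁ = Allₚ.++⁻ˡ F₁ (components v)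
  oks₂ = Allₚ.++⁻ʳ F₁ (components v)
  below : ∀ {i} → Any (λ p → i ∈ proj₁ p) F₁ → i < d
  below i∈ = let _ , (n , ok , h<) , i∈p = lookup-any (All.zip (Allₚ.++⁻ˡ F₁ (nests v) , All.zip (oks₁ , lo))) i∈
             in nested-below n ok h< i∈p
  above : ∀ {i} → Any (λ p → i ∈ proj₁ p) F₂ → d < i
  above i∈ = let _ , (n , ok , ≤h) , i∈p = lookup-any (All.zip (Allₚ.++⁻ʳ F₁ (nests v) , All.zip (oks₂ , hi))) i∈
             in nested-above n ok ≤h i∈p
  valid₁ : Valid s d [] F₁
  valid₁ = valid [] oks₁ (proj₁ (AllPairs-++⁻ F₁ (pairs v))) (All.tabulate λ _ → nested (λ ()) λ _ ())
    (λ { (inj₂ i∈) → proj₁ (range v (inj₂ (Anyₚ.++⁺ˡ i∈))) , below i∈ }) cover₁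
    where
    cover₁ : ∀ {i} → s ≤ i → i < d → Covered i [] F₁
    cover₁ s≤i i<d with cover v s≤i (ℕₚ.<-trans i<d d<e)
    ... | inj₁ (here refl) = ⊥-elim (ℕₚ.<-irrefl refl i<d)
    ... | inj₁ (there i∈)  = ⊥-elim (ℕₚ.<-asym i<d (All.lookup d<D i∈))
    ... | inj₂ i∈ with Anyₚ.++⁻ F₁ i∈
    ... | inj₁ i∈₁ = inj₂ i∈₁
    ... | inj₂ i∈₂ = ⊥-elim (ℕₚ.<-asym i<d (above i∈₂))
  valid₂ : Valid (suc d) e D F₂
  valid₂ = valid (AllPairs.tail (pending v)) oks₂ (proj₂ (AllPairs-++⁻ F₁ (pairs v)))
    (All.map nested-tail (Allₚ.++⁻ʳ F₁ (nests v)))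
    (λ { (inj₁ i∈) → All.lookup d<D i∈ , proj₂ (range v (inj₁ (there i∈)))
       ; (inj₂ i∈) → above i∈ , proj₂ (range v (inj₂ (Anyₚ.++⁺ʳ F₁ i∈))) }) cover₂
    where
    cover₂ : ∀ {i} → d < i → i < e → Covered i D F₂
    cover₂ d<i i<e with cover v (ℕₚ.≤-trans s≤d (ℕₚ.<⇒≤ d<i)) i<e
    ... | inj₁ (here refl) = ⊥-elim (ℕₚ.<-irrefl refl d<i)
    ... | inj₁ (there i∈)  = inj₁ i∈
    ... | inj₂ i∈ with Anyₚ.++⁻ F₁ i∈
    ... | inj₁ i∈₁ = ⊥-elim (ℕₚ.<-asym d<i (below i∈₁))
    ... | inj₂ i∈₂ = inj₂ i∈₂

split-valid : ∀ {s e d D F₁ F₂} → s ≤ d → d < e → Valid s d [] F₁ → Valid (suc d) e D F₂ → Valid s e (d ∷ D) (F₁ ++ F₂)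
split-valid {s} {e} {d} {D} {F₁} {F₂} s≤d d<e v₁ v₂ = valid
  (All.tabulate (λ i∈ → proj₁ (range v₂ (inj₁ i∈))) ∷ pending v₂)
  (Allₚ.++⁺ (components v₁) (components v₂))
  (AllPairsₚ.++⁺ (pairs v₁) (pairs v₂) (All.map (λ a → All.map (across a) right) left))
  (Allₚ.++⁺ (All.map nested₁ left) (All.zipWith nested₂ (nests v₂ , right)))
  range′ cover′
  where
  left : All (λ p → ComponentOk p × Below d p) F₁
  left = All.zip (components v₁ , All-elements λ i∈ → proj₂ (range v₁ (inj₂ i∈)))
  right : All (λ p → ComponentOk p × Above d p) F₂
  right = All.zip (components v₂ , All-elements λ i∈ → proj₁ (range v₂ (inj₂ i∈)))
  across : ∀ {p p′} → ComponentOk p × Below d p → ComponentOk p′ × Above d p′ → Ordered p p′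
  across (ok , <d) (ok′ , d<) = ordered
    (λ i∈ i∈′ → ℕₚ.<-asym (<d i∈) (d< i∈′))
    (λ _ b∈ c∈ _ _ b<c _ → ℕₚ.<-asym (ℕₚ.<-trans (d< b∈) b<c) (<d c∈))
    (λ a∈ b∈ _ _ a<b _ _ → ℕₚ.<-asym (ℕₚ.<-trans (d< a∈) a<b) (<d b∈))
    (ℕₚ.<-trans (<d (head-∈ ok)) (d< (head-∈ ok′)))
  d≤D : ∀ {i} → i ∈ d ∷ D → d ≤ i
  d≤D (here refl) = ℕₚ.≤-refl
  d≤D (there i∈)  = ℕₚ.<⇒≤ (proj₁ (range v₂ (inj₁ i∈)))
  nested₁ : ∀ {p} → ComponentOk p × Below d p → Nested (d ∷ D) p
  nested₁ (_ , <d) = nested (λ i∈ i∈′ → ℕₚ.<⇒≱ (<d i∈′) (d≤D i∈))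
    (λ _ d∈ c′∈ _ d<c′ → ℕₚ.<⇒≱ (ℕₚ.<-trans d<c′ (<d c′∈)) (d≤D d∈))
  nested₂ : ∀ {p} → Nested D p × (ComponentOk p × Above d p) → Nested (d ∷ D) p
  nested₂ (n , _ , d<) = nested
    (λ { (here refl) i∈ → ℕₚ.<-irrefl refl (d< i∈) ; (there i∈) i∈′ → Nested.disjoint n i∈ i∈′ })
    (λ { c∈ (here refl) _ c<d _ → ℕₚ.<-asym c<d (d< c∈) ; c∈ (there d∈) c′∈ c<d d<c′ → Nested.one-gap n c∈ d∈ c′∈ c<d d<c′ })
  range′ : ∀ {i} → Covered i (d ∷ D) (F₁ ++ F₂) → s ≤ i × i < e
  range′ (inj₁ (here refl)) = s≤d , d<e
  range′ (inj₁ (there i∈))  = let d< , <e = range v₂ (inj₁ i∈) in ℕₚ.≤-trans s≤d (ℕₚ.<⇒≤ d<) , <e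
  range′ (inj₂ i∈) with Anyₚ.++⁻ F₁ i∈
  ... | inj₁ i∈₁ = let s≤ , <d = range v₁ (inj₂ i∈₁) in s≤ , ℕₚ.<-trans <d d<e
  ... | inj₂ i∈₂ = let d< , <e = range v₂ (inj₂ i∈₂) in ℕₚ.≤-trans s≤d (ℕₚ.<⇒≤ d<) , <e
  cover′ : ∀ {i} → s ≤ i → i < e → Covered i (d ∷ D) (F₁ ++ F₂)
  cover′ {i} s≤i i<e with ℕₚ.<-cmp i d
  ... | tri≈ _ refl _ = inj₁ (here refl)
  ... | tri< i<d _ _ with cover v₁ s≤i i<d
  ...   | inj₂ i∈ = inj₂ (Anyₚ.++⁺ˡ i∈)
  cover′ {i} s≤i i<e | tri> _ _ d<i with cover v₂ d<i i<e
  ... | inj₁ i∈ = inj₁ (there i∈)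
  ... | inj₂ i∈ = inj₂ (Anyₚ.++⁺ʳ F₁ i∈)

increasing-length : ∀ {D a n} → AllPairs _<_ D → All (λ i → a ≤ i × i < a ℕ.+ n) D → length D ≤ n
increasing-length {[]} [] [] = z≤n
increasing-length {d ∷ D} {a} {zero} _ ((a≤d , d<a) ∷ _) = ⊥-elim (ℕₚ.<⇒≱ d<a (subst (_≤ d) (sym (ℕₚ.+-identityʳ a)) a≤d))
increasing-length {d ∷ D} {a} {suc n} (d< ∷ inc) ((a≤d , _) ∷ bounds) = s≤s (increasing-length inc
  (All.zipWith (λ { {i} (d<i , _ , i<) → ℕₚ.≤-<-trans a≤d d<i , subst (i <_) (ℕₚ.+-suc a n) i< }) (d< , bounds)))

-- (n , D , F) lives on an interval of n labels; the starting label is kept outside, as it changes in the recursion.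
Partial : Set
Partial = ℕ × List ℕ × Forest

yF qF : Forest → ℕ
yF []            = 0
yF ((_ , g) ∷ F) = yG g ℕ.+ yF F
qF []            = 0
qF ((_ , g) ∷ F) = qG g ℕ.+ qF F

partialWeight : Weight Partial
partialWeight = weight proj₁ (yF ∘ proj₂ ∘ proj₂) (qF ∘ proj₂ ∘ proj₂)

PartialForest : ℕ → ℕ → Partial → Set
PartialForest s r (n , D , F) = Valid s (s ℕ.+ n) D F × length D ≡ r

yF-++ : ∀ F {F′} → yF (F ++ F′) ≡ yF F ℕ.+ yF F′
yF-++ []            = refl
yF-++ ((_ , g) ∷ F) = trans (cong (yG g ℕ.+_) (yF-++ F)) (sym (ℕₚ.+-assoc (yG g) _ _))

qF-++ : ∀ F {F′} → qF (F ++ F′) ≡ qF F ℕ.+ qF F′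
qF-++ []            = refl
qF-++ ((_ , g) ∷ F) = trans (cong (qG g ℕ.+_) (qF-++ F)) (sym (ℕₚ.+-assoc (qG g) _ _))

glue : ℕ → Partial × Partial → Partial
glue s ((i , _ , F₁) , (j , D , F₂)) = suc (i ℕ.+ j) , s ℕ.+ i ∷ D , F₁ ++ F₂

cut : ℕ → Partial → Partial × Partial
-- A default; only configurations with a pending label are cut.
cut s (n , []    , F) = (n , [] , F) , (n , [] , F)
cut s (n , d ∷ D , F) = (d ∸ s , [] , filter (λ p → headLabel p ℕ.<? d) F)
                      , (n ∸ suc (d ∸ s) , D , filter (λ p → d ℕ.≤? headLabel p) F)

glued-range : ∀ s i j → s ℕ.+ suc i ℕ.+ j ≡ s ℕ.+ suc (i ℕ.+ j)
glued-range s i j = ℕₚ.+-assoc s (suc i) j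

cut-glue : ∀ s i j {D F₁ F₂} → All (λ p → headLabel p < s ℕ.+ i) F₁ → All (λ p → s ℕ.+ i ≤ headLabel p) F₂ →
           cut s (glue s ((i , [] , F₁) , (j , D , F₂))) ≡ ((i , [] , F₁) , (j , D , F₂))
cut-glue s i j {D} {F₁} {F₂} lo hi rewrite ℕₚ.m+n∸m≡n s i | ℕₚ.m+n∸m≡n i j =
  cong₂ (λ F F′ → (i , [] , F) , (j , D , F′))
    (trans (filter-++ <? F₁ F₂) (trans (cong₂ _++_ (filter-all <? lo) (filter-none <? (All.map ℕₚ.≤⇒≯ hi))) (++-identityʳ F₁)))
    (trans (filter-++ ≤? F₁ F₂) (cong₂ _++_ (filter-none ≤? (All.map ℕₚ.<⇒≱ lo)) (filter-all ≤? hi)))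
  where
  <? = λ p → headLabel p ℕ.<? (s ℕ.+ i)
  ≤? = λ p → (s ℕ.+ i) ℕ.≤? headLabel p

-- Every configuration with a pending label has this form, so `cut` need only be computed on glued
-- pairs.
data Glued (s r : ℕ) : Partial → Set where
  glued : ∀ {i j D F₁ F₂} → All (λ p → headLabel p < s ℕ.+ i) F₁ → All (λ p → s ℕ.+ i ≤ headLabel p) F₂ →
          PartialForest s 0 (i , [] , F₁) → PartialForest (s ℕ.+ suc i) r (j , D , F₂) →
          Glued s r (glue s ((i , [] , F₁) , (j , D , F₂)))

partial-glued : ∀ {s r o} → PartialForest s (suc r) o → Glued s r o
partial-glued {s} {r} {n , d ∷ D , F} (v , len) with valid-split v
... | F₁ , F₂ , refl , lo , hi , s≤d , d<e , v₁ , v₂ with ℕₚ.m≤n⇒∃[o]m+o≡n s≤d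
-- Inequalities are replaced by sums, d = s + i and n = suc (i + j), to keep subtraction out of the
-- indices.
... | i , refl with ℕₚ.m≤n⇒∃[o]m+o≡n (ℕₚ.+-cancelˡ-< s i n d<e)
... | j , refl = glued lo hi (v₁ , refl)
  (subst (λ e → Valid (s ℕ.+ suc i) e D F₂) (sym (glued-range s i j))
    (subst (λ t → Valid t (s ℕ.+ suc (i ℕ.+ j)) D F₂) (sym (ℕₚ.+-suc s i)) v₂) , ℕₚ.suc-injective len)

GlueValid : ℕ → ℕ → Partial × Partial → Set
GlueValid s r (p , p′) = PartialForest s 0 p × PartialForest (s ℕ.+ suc (proj₁ p)) r p′

glue-≅ : ∀ s r → Isomorphism (x↑ (partialWeight ⊠ partialWeight)) (GlueValid s r) partialWeight (PartialForest s (suc r))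
glue-≅ s r = record
  { to = glue s
  ; from = cut s
  ; to-valid = to-valid
  ; from-valid = λ o → from-valid (partial-glued o)
  ; from-to = from-to
  ; to-from = λ o → to-from (partial-glued o)
  ; to-size = λ _ → refl
  ; to-ydeg = λ { {(_ , _ , F) , _} _ → yF-++ F }
  ; to-qdeg = λ { {(_ , _ , F) , _} _ → qF-++ F }
  }
  where
  shifted : ∀ {i j D F} → Valid (s ℕ.+ suc i) (s ℕ.+ suc i ℕ.+ j) D F → Valid (suc (s ℕ.+ i)) (s ℕ.+ suc (i ℕ.+ j)) D F
  shifted {i} {j} {D} {F} v = subst (λ t → Valid t (s ℕ.+ suc (i ℕ.+ j)) D F) (ℕₚ.+-suc s i)
    (subst (λ e → Valid (s ℕ.+ suc i) e D F) (glued-range s i j) v)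
  to-valid : ∀ {x} → GlueValid s r x → PartialForest s (suc r) (glue s x)
  to-valid {(i , [] , F₁) , (j , D , F₂)} ((v₁ , _) , (v₂ , len)) =
    split-valid (ℕₚ.m≤m+n s i) (ℕₚ.+-monoʳ-< s (s≤s (ℕₚ.m≤m+n i j))) v₁ (shifted v₂) , cong suc len
  from-to : ∀ {x} → GlueValid s r x → cut s (glue s x) ≡ x
  from-to {(i , [] , F₁) , (j , D , F₂)} ((v₁ , _) , (v₂ , _)) = cut-glue s i j
    (All.zipWith (λ (ok , f) → f (head-∈ ok)) (components v₁ , All-elements λ i∈ → proj₂ (range v₁ (inj₂ i∈))))
    (All.zipWith (λ (ok , f) → ℕₚ.<⇒≤ (f (head-∈ ok))) (components v₂ , All-elements λ i∈ → proj₁ (range (shifted v₂) (inj₂ i∈))))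
  from-valid : ∀ {o} → Glued s r o → GlueValid s r (cut s o)
  from-valid (glued {i} {j} lo hi o₁ o₂) = subst (GlueValid s r) (sym (cut-glue s i j lo hi)) (o₁ , o₂)
  to-from : ∀ {o} → Glued s r o → glue s (cut s o) ≡ o
  to-from (glued {i} {j} lo hi _ _) = cong (glue s) (cut-glue s i j lo hi)

-- Without pending labels the first label opens a new component, whose other labels become the pending ones;
-- otherwise the configuration is cut at the first pending label.
firstSize : Partial → ℕ
firstSize (_ , _ , [])          = 0
firstSize (_ , _ , (_ , g) ∷ _) = nbd g

addFirst : ℕ → GTree × Partial → Partial
addFirst s (g , n , D , F) = suc n , [] , (s ∷ D , g) ∷ F

removeFirst : Partial → GTree × Partial
removeFirst (n , _ , (_ ∷ D , g) ∷ F) = g , n ∸ 1 , D , F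
removeFirst o                         = single 0 , o

data FirstAdded (s m : ℕ) : Partial → Set where
  firstAdded : ∀ {g D F} → OkG g → nbd g ≡ suc (length D) → Valid (suc s) (suc s ℕ.+ m) D F →
               FirstAdded s m (addFirst s (g , m , D , F))

partial-firstAdded : ∀ {s m o} → PartialForest s 0 o → proj₁ o ≡ suc m → FirstAdded s m o
partial-firstAdded {s} {m} {n , [] , F} (v , _) refl
  with valid-first (ℕₚ.m<m+n s (s≤s z≤n)) v
... | B , g , F′ , refl , len , g-ok , v′ = firstAdded g-ok len (subst (λ e → Valid (suc s) e B F′) (ℕₚ.+-suc s m) v′)

firstAdded-valid : ∀ {s m o} → FirstAdded s m o → PartialForest s 0 o
firstAdded-valid {s} {m} (firstAdded {D = D} {F} g-ok len v) =
  first-valid (ℕₚ.m<m+n s (s≤s z≤n)) len g-ok (subst (λ e → Valid (suc s) e D F) (sym (ℕₚ.+-suc s m)) v) , refl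

-- Composition is truncated at the degree, so the sum over the sizes of the first component must
-- stop there as well.
firstAdded-bound : ∀ {s m o} → FirstAdded s m o → firstSize o ≤ suc m
firstAdded-bound (firstAdded {D = D} {F} _ len v) = ℕₚ.≤-trans (ℕₚ.≤-reflexive len)
  (s≤s (increasing-length (pending v) (All.tabulate λ i∈ → range v (inj₁ i∈))))

module ForestCounting {Gt Gf : Ser} (trees : ∀ n → Count gtreeWeight OkG n (Gt n))
  (fixpoint : Gf ≋ Sx.compose (Sx.1ˢ +ˢ Gt) (x *ˢ Gf)) where

  open Sx using (1ˢ; _^_; module S)

  φ Fs : Ser
  φ  = 1ˢ +ˢ Gt
  Fs = x *ˢ Gf

  -- All s and r are treated at once: opening a component changes the number of pending labels, and
  -- both decompositions move the starting label.
  PartialCount : ℕ → Set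
  PartialCount n = ∀ s r → Count partialWeight (PartialForest s r) n ((Gf *ˢ Fs ^ r) n)

  count-empty : ∀ s → Count partialWeight (PartialForest s 0) 0 ((Gf *ˢ Fs ^ 0) 0)
  count-empty s = count-≈ (R.sym (R.trans (at (S.*-identityʳ Gf) 0) (R.trans (at fixpoint 0) (R.trans (R.*-identityʳ (φ 0)) φ₀)))) one
    where
    φ₀ : φ 0 R.≈ R.1#
    φ₀ = R.trans (R.+-congˡ {R.1#} (Sy.mk λ b → Sq.mk λ c → Gt₀ b c)) (R.+-identityʳ R.1#)
      where
      -- Every tree has a boundary vertex, so the enumeration of trees of size 0 is empty.
      Gt₀ : ∀ b c → Gt 0 b c ≡ + 0
      Gt₀ b c with trees 0 b c
      ... | enum []      _ _     _ , e = e
      ... | enum (g ∷ _) _ sound _ , _ = ⊥-elim (nbd≢0 g (proj₁ (proj₂ (sound (here refl)))))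
    only : ∀ {o} → PartialForest s 0 o → proj₁ o ≡ 0 → o ≡ (0 , [] , [])
    only {_ , [] , F} (v , _) refl = cong (λ F → 0 , [] , F) (valid-nil (subst (λ e → Valid s e [] F) (ℕₚ.+-identityʳ s) v))
    empty : PartialForest s 0 (0 , [] , [])
    empty = subst (λ e → Valid s e [] []) (sym (ℕₚ.+-identityʳ s)) nil-valid , refl
    one : Count partialWeight (PartialForest s 0) 0 R.1#
    one zero    zero    = card-singleton (0 , [] , []) (empty , refl , refl , refl) λ (o , e , _) → only o e
    one zero    (suc _) = card-∅ λ (o , e , _ , c) → ℕₚ.0≢1+n (trans (sym (cong (qdeg partialWeight) (only o e))) c)
    one (suc _) _       = card-∅ λ (o , e , b , _) → ℕₚ.0≢1+n (trans (sym (cong (ydeg partialWeight) (only o e))) b)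

  -- A first component with k + 1 boundary vertices uses up the label s and leaves k pending labels
  -- among the next m.
  count-first : ∀ m s k → PartialCount m →
    Count partialWeight (λ o → PartialForest s 0 o × firstSize o ≡ suc k) (suc m) (Gt (suc k) R.* (Gf *ˢ Fs ^ k) m)
  count-first m s k below b c = card-bijection (addFirst s) removeFirst to from from-to to-from
    (count-layer {w = gtreeWeight} {V = OkG} {w′ = partialWeight} {V′ = PartialForest (suc s) k} (trees (suc k)) (below (suc s) k) b c)
    where
    Source : GTree × Partial → Set
    Source (g , o) = (OkG g × nbd g ≡ suc k) × (PartialForest (suc s) k o × proj₁ o ≡ m)
      × yG g ℕ.+ yF (proj₂ (proj₂ o)) ≡ b × qG g ℕ.+ qF (proj₂ (proj₂ o)) ≡ c
    Target : Partial → Set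
    Target = Homogeneous partialWeight (λ o → PartialForest s 0 o × firstSize o ≡ suc k) (suc m) b c
    to : ∀ {x} → Source x → Target (addFirst s x)
    to ((g-ok , k≡) , ((v , len) , refl) , weights) =
      (firstAdded-valid (firstAdded g-ok (trans k≡ (cong suc (sym len))) v) , k≡) , refl , weights
    from : ∀ {o} → Target o → Source (removeFirst o)
    from ((o , k≡) , n≡ , weights) with partial-firstAdded o n≡
    ... | firstAdded g-ok len v = (g-ok , k≡) , ((v , ℕₚ.suc-injective (trans (sym len) k≡)) , refl) , weights
    from-to : ∀ {x} → Source x → removeFirst (addFirst s x) ≡ x
    from-to _ = refl
    to-from : ∀ {o} → Target o → addFirst s (removeFirst o) ≡ o
    to-from ((o , _) , n≡ , _) with partial-firstAdded o n≡
    ... | firstAdded _ _ _ = refl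

  count-nonempty : ∀ m s → PartialCount m → Count partialWeight (PartialForest s 0) (suc m) ((Gf *ˢ Fs ^ 0) (suc m))
  count-nonempty m s below = count-≈ (R.sym (R.trans (at (S.*-identityʳ Gf) (suc m)) (at fixpoint (suc m))))
    λ b c → card-⇔ (λ ((_ , _ , o , _) , e) → o , e)
      (λ {x} (o , n≡ , e) → (_ , firstAdded-bound (partial-firstAdded o n≡) , o , refl) , n≡ , e)
      (count-Σ≤ {m = suc m} {U = λ k o → PartialForest s 0 o × firstSize o ≡ k} (λ (_ , e) (_ , e′) → trans (sym e) e′) layer b c)
    where
    layer : ∀ k → k ≤ suc m → Count partialWeight (λ o → PartialForest s 0 o × firstSize o ≡ k) (suc m) (φ k R.* (Fs ^ k) (suc m))
    layer zero    _ = count-≈ (R.sym (R.zeroʳ (φ 0))) (count-∅ λ (o , k≡) n≡ → none (partial-firstAdded o n≡) k≡)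
      where
      none : ∀ {o} → FirstAdded s m o → firstSize o ≢ 0
      none (firstAdded {g} _ _ _) = nbd≢0 g
    -- One factor x of (x G)^(k+1) accounts for the first label; G (x G)^k in degree m remains.
    layer (suc k) _ = count-≈ (R.*-cong (R.sym (R.+-identityˡ (Gt (suc k))))
        (R.sym (R.trans (at (S.*-assoc x Gf (Fs ^ k)) (suc m)) (Sx.x-*ˢ-suc (Gf *ˢ Fs ^ k) m))))
      (count-first m s k below)

  -- The factor x is the first pending label, G the forest in front of it, and G (x G)^r the
  -- configuration behind it.
  count-glue : ∀ n s r → (∀ i → i < n → PartialCount i) → Count partialWeight (PartialForest s (suc r)) n ((Gf *ˢ Fs ^ suc r) n)
  count-glue zero s r below = count-≈ (R.sym (R.trans (at (Sx.x-factor Gf (Fs ^ r)) 0) (Sx.x-*ˢ-zero (Gf *ˢ (Gf *ˢ Fs ^ r)))))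
    (count-∅ λ {o} v n≡ → positive (partial-glued v) n≡)
    where
    positive : ∀ {o} → Glued s r o → proj₁ o ≢ 0
    positive (glued _ _ _ _) ()
  count-glue (suc m) s r below = count-≈ (R.sym (R.trans (at (Sx.x-factor Gf (Fs ^ r)) (suc m)) (Sx.x-*ˢ-suc (Gf *ˢ (Gf *ˢ Fs ^ r)) m)))
    (count-≅ (glue-≅ s r) (count-x↑ (count-⊠ {w = partialWeight} {V = PartialForest s 0} {w′ = partialWeight}
      {V′ = λ i → PartialForest (s ℕ.+ suc i) r} {f = Gf} {g = Gf *ˢ Fs ^ r}
      λ i i≤m → inj₁ (count-≈ (at (S.*-identityʳ Gf) i) (below i (s≤s i≤m) s 0) , below (m ∸ i) (s≤s (ℕₚ.m∸n≤m m i)) (s ℕ.+ suc i) r))))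

  partial-count : ∀ n → PartialCount n
  partial-count = <-rec PartialCount step
    where
    step : ∀ n → (∀ {i} → i < n → PartialCount i) → PartialCount n
    step n       below s (suc r) = count-glue n s r λ i i<n → below i<n
    step zero    below s zero    = count-empty s
    step (suc m) below s zero    = count-nonempty m s (below (ℕₚ.n<1+n m))

  forest-count : ∀ n → Count partialWeight (PartialForest 1 0) n (Gf n)
  forest-count n = count-≈ (at (S.*-identityʳ Gf) n) (partial-count n 1 0)

-- Comparing forests with the tests of the statement

labels : Forest → ℕ
labels []            = 0
labels ((_ , g) ∷ F) = nbd g ℕ.+ labels F

labels-++ : ∀ F {F′} → labels (F ++ F′) ≡ labels F ℕ.+ labels F′
labels-++ []            = refl
labels-++ ((_ , g) ∷ F) = trans (cong (nbd g ℕ.+_) (labels-++ F)) (sym (ℕₚ.+-assoc (nbd g) _ _))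

-- The helicity of a forest adds n, that of each tree its own number of boundary vertices; here
-- these are seen to agree. The recursion that counts forests proves it without counting elements of
-- a partition.
partial-size : ∀ n {s r D F} → PartialForest s r (n , D , F) → r ℕ.+ labels F ≡ n
partial-size n = <-rec (λ n → ∀ {s r D F} → PartialForest s r (n , D , F) → r ℕ.+ labels F ≡ n) step n
  where
  step : ∀ n → (∀ {i} → i < n → ∀ {s r D F} → PartialForest s r (i , D , F) → r ℕ.+ labels F ≡ i) →
         ∀ {s r D F} → PartialForest s r (n , D , F) → r ℕ.+ labels F ≡ n
  step n below {s} {suc r} o = glued-size (partial-glued o) refl
    where
    glued-size : ∀ {o} → Glued s r o → proj₁ o ≡ n → suc r ℕ.+ labels (proj₂ (proj₂ o)) ≡ proj₁ o
    glued-size (glued {i} {j} {F₁ = F₁} {F₂} _ _ o₁ o₂) refl =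
      trans (cong (suc r ℕ.+_) (labels-++ F₁)) (cong suc (trans (+-swap r (labels F₁) (labels F₂))
        (cong₂ ℕ._+_ (below (s≤s (ℕₚ.m≤m+n i j)) o₁) (below (s≤s (ℕₚ.m≤n+m j i)) o₂))))
  step zero    below {s} {zero} {[]} {F} (v , _) =
    cong labels (valid-nil (subst (λ e → Valid s e [] F) (ℕₚ.+-identityʳ s) v))
  step (suc m) below {s} {zero} o = first-size (partial-firstAdded o refl)
    where
    first-size : ∀ {o} → FirstAdded s m o → labels (proj₂ (proj₂ o)) ≡ suc m
    first-size (firstAdded {D = D} {F} _ len v) =
      trans (cong (ℕ._+ labels F) len) (cong suc (below (ℕₚ.n<1+n m) (v , refl)))

strictInc⇒ : ∀ B → T (strictInc B) → AllPairs _<_ B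
strictInc⇒ B = Linked⇒AllPairs ℕₚ.<-trans ∘ linked B
  where
  linked : ∀ B → T (strictInc B) → Linked _<_ B
  linked []          _ = []
  linked (_ ∷ [])    _ = [-]
  linked (a ∷ b ∷ B) p = let a<b , p′ = T-∧⁻ {a <ᵇ b} p in ℕₚ.<ᵇ⇒< a b a<b ∷ linked (b ∷ B) p′

⇒strictInc : ∀ {B} → AllPairs _<_ B → T (strictInc B)
⇒strictInc []                   = tt
⇒strictInc (_ ∷ [])             = tt
⇒strictInc ((a<b ∷ _) ∷ p@(_ ∷ _)) = T-∧⁺ (ℕₚ.<⇒<ᵇ a<b) (⇒strictInc p)

T-not⁻ : ∀ {b} → T (not b) → ¬ T b
T-not⁻ {false} _ ()

T-not⁺ : ∀ {b} → ¬ T b → T (not b)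
T-not⁺ {true}  ¬p = ¬p tt
T-not⁺ {false} _  = tt

noCross⇒ : ∀ P P′ → T (noCross P P′) → NonCrossing P P′
noCross⇒ P P′ p a∈ b∈ c∈ d∈ a<b b<c c<d = T-not⁻ p
  (Anyₚ.any⁺ _ (lose a∈ (Anyₚ.any⁺ _ (lose b∈ (Anyₚ.any⁺ _ (lose c∈ (Anyₚ.any⁺ _ (lose d∈
    (T-∧⁺ (ℕₚ.<⇒<ᵇ a<b) (T-∧⁺ (ℕₚ.<⇒<ᵇ b<c) (ℕₚ.<⇒<ᵇ c<d)))))))))))

⇒noCross : ∀ P P′ → NonCrossing P P′ → T (noCross P P′)
⇒noCross P P′ nc = T-not⁺ λ p →
  let a , a∈ , p₁ = find (Anyₚ.any⁻ _ P p)
      b , b∈ , p₂ = find (Anyₚ.any⁻ _ P′ p₁)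
      c , c∈ , p₃ = find (Anyₚ.any⁻ _ P p₂)
      d , d∈ , p₄ = find (Anyₚ.any⁻ _ P′ p₃)
      a<b , p₅ = T-∧⁻ {a <ᵇ b} p₄
      b<c , c<d = T-∧⁻ {b <ᵇ c} p₅
  in nc a∈ b∈ c∈ d∈ (ℕₚ.<ᵇ⇒< a b a<b) (ℕₚ.<ᵇ⇒< b c b<c) (ℕₚ.<ᵇ⇒< c d c<d)

noncrossingAll⇒ : ∀ Bs → T (noncrossingAll Bs) → AllPairs (λ B C → NonCrossing B C × NonCrossing C B) Bs
noncrossingAll⇒ []       _ = []
noncrossingAll⇒ (B ∷ Bs) p =
  let q , p′ = T-∧⁻ {all (λ C → noCross B C ∧ noCross C B) Bs} p
  in All.map both (Allₚ.all⁺ _ Bs q) ∷ noncrossingAll⇒ Bs p′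
  where
  both : ∀ {C} → T (noCross B C ∧ noCross C B) → NonCrossing B C × NonCrossing C B
  both {C} t = let u , v = T-∧⁻ {noCross B C} t in noCross⇒ B C u , noCross⇒ C B v

⇒noncrossingAll : ∀ {Bs} → AllPairs (λ B C → NonCrossing B C × NonCrossing C B) Bs → T (noncrossingAll Bs)
⇒noncrossingAll [] = tt
⇒noncrossingAll {B ∷ Bs} (ncs ∷ p) = T-∧⁺ {all (λ C → noCross B C ∧ noCross C B) Bs}
  (Allₚ.all⁻ _ (All.map (λ {C} (u , v) → T-∧⁺ {noCross B C} (⇒noCross B C u) (⇒noCross C B v)) ncs)) (⇒noncrossingAll p)

Disjoint : List ℕ → List ℕ → Set
Disjoint B C = ∀ {i} → i ∈ B → i ∈ C → ⊥

∈⇒member : ∀ {i B} → i ∈ B → member i B ≡ true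
∈⇒member {i} {B} i∈ = Equivalence.to T-≡ (Anyₚ.any⁺ (λ j → i ≡ᵇ j) (Any.map (ℕₚ.≡⇒≡ᵇ i _) i∈))

member⇒∈ : ∀ {i} B → member i B ≡ true → i ∈ B
member⇒∈ {i} B e = Any.map (ℕₚ.≡ᵇ⇒≡ i _) (Anyₚ.any⁻ (λ j → i ≡ᵇ j) B (subst T (sym e) tt))

covered⇒countIn : ∀ {i Bs} → Any (i ∈_) Bs → 1 ≤ countIn i Bs
covered⇒countIn {i} {B ∷ Bs} (here i∈) rewrite ∈⇒member i∈ = s≤s z≤n
covered⇒countIn {i} {B ∷ Bs} (there i∈) = ℕₚ.≤-trans (covered⇒countIn i∈) (ℕₚ.m≤n+m _ _)

countIn⇒covered : ∀ {i} Bs → 1 ≤ countIn i Bs → Any (i ∈_) Bs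
countIn⇒covered {i} (B ∷ Bs) 1≤ with member i B in e
... | true  = here (member⇒∈ B e)
... | false = there (countIn⇒covered Bs 1≤)

-- A label shared by the first block and a later one would be counted at least twice.
countIn⇒disjoint : ∀ Bs → (∀ {i} → Any (i ∈_) Bs → countIn i Bs ≤ 1) → AllPairs Disjoint Bs
countIn⇒disjoint []       _  = []
countIn⇒disjoint (B ∷ Bs) ≤1 = All.tabulate first ∷ countIn⇒disjoint Bs λ i∈ → ℕₚ.≤-trans (ℕₚ.m≤n+m _ _) (≤1 (there i∈))
  where
  first : ∀ {C} → C ∈ Bs → Disjoint B C
  first {C} C∈ {i} i∈B i∈C with ≤1 {i} (here i∈B)
  ... | ≤1 rewrite ∈⇒member i∈B = ℕₚ.<⇒≱ (covered⇒countIn (lose C∈ i∈C)) (ℕₚ.≤-pred ≤1)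

disjoint⇒countIn : ∀ {i Bs} → AllPairs Disjoint Bs → Any (i ∈_) Bs → countIn i Bs ≡ 1
disjoint⇒countIn {i} {B ∷ Bs} (d ∷ _) (here i∈) rewrite ∈⇒member i∈ = cong suc (none Bs d)
  where
  none : ∀ Cs → All (Disjoint B) Cs → countIn i Cs ≡ 0
  none []       []       = refl
  none (C ∷ Cs) (d ∷ ds) with member i C in e
  ... | true  = ⊥-elim (d i∈ (member⇒∈ C e))
  ... | false = none Cs ds
disjoint⇒countIn {i} {B ∷ Bs} (d ∷ ds) (there i∈) with member i B in e
... | true  = let C , C∈ , i∈C = find i∈ in ⊥-elim (All.lookup d C∈ (member⇒∈ B e) i∈C)
... | false = disjoint⇒countIn ds i∈

sum-intHel : ∀ {F} → All ComponentOk F → sumℤ (map (λ p → intHel (proj₂ p)) F) ℤ.+ + labels F ≡ + 2 ℤ.* + yF F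
sum-intHel [] = refl
sum-intHel {(_ , g) ∷ F} (ok ∷ oks) = trans
  (solve 4 (λ a b m l → (a :+ b) :+ (m :+ l) := (a :+ m) :+ (b :+ l)) refl (intHel g) _ (+ nbd g) (+ labels F))
  (trans (cong₂ ℤ._+_ (twiceHel-degree (ComponentOk.tree ok)) (sum-intHel oks)) (sym (ℤₚ.*-distribˡ-+ (+ 2) (+ yG g) (+ yF F))))
  where open ℤSolver

sum-dim : ∀ {F} → All ComponentOk F → dimF F ≡ + qF F
sum-dim [] = refl
sum-dim (ok ∷ oks) = cong₂ ℤ._+_ (dim-degree (ComponentOk.tree ok)) (sum-dim oks)

twiceHelF-degree : ∀ {n F} → PartialForest 1 0 (n , [] , F) → twiceHelF n F ≡ + 2 ℤ.* + yF F
twiceHelF-degree {n} {F} o = trans (cong (λ m → sumℤ (map (λ p → intHel (proj₂ p)) F) ℤ.+ + m) (sym (partial-size n o)))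
  (sum-intHel (components (proj₁ o)))

blocks : Forest → List (List ℕ)
blocks = map proj₁

componentOK⇒ : ∀ n p → T (componentOK n p) → ComponentOk p × All (λ i → 1 ≤ i × i ≤ n) (proj₁ p)
componentOK⇒ n (B , g) t =
  let inc , t₁ = T-∧⁻ {strictInc B} t
      rng , t₂ = T-∧⁻ {inRange n B} t₁
      len , t₃ = T-∧⁻ {length B ≡ᵇ nbd g} t₂
      vg , cg = T-∧⁻ {validG g} t₃
  in component (strictInc⇒ B inc) (ℕₚ.≡ᵇ⇒≡ (length B) (nbd g) len) (validG⇒OkG g vg cg)
   , All.map (λ {i} r → let 1≤ , ≤n = T-∧⁻ {1 ℕ.≤ᵇ i} r in ℕₚ.≤ᵇ⇒≤ 1 i 1≤ , ℕₚ.≤ᵇ⇒≤ i n ≤n) (Allₚ.all⁺ _ B rng)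

⇒componentOK : ∀ n {p} → ComponentOk p → All (λ i → 1 ≤ i × i ≤ n) (proj₁ p) → T (componentOK n p)
⇒componentOK n {B , g} (component inc len g-ok) rng =
  let vg , cg = OkG⇒validG g-ok
  in T-∧⁺ {strictInc B} (⇒strictInc inc) (T-∧⁺ {inRange n B}
       (Allₚ.all⁻ _ (All.map (λ {i} (1≤ , ≤n) → T-∧⁺ {1 ℕ.≤ᵇ i} (ℕₚ.≤⇒≤ᵇ 1≤) (ℕₚ.≤⇒≤ᵇ ≤n)) rng))
       (T-∧⁺ {length B ≡ᵇ nbd g} (ℕₚ.≡⇒≡ᵇ (length B) (nbd g) len) (T-∧⁺ {validG g} vg cg)))

OrderedBlocks : List ℕ → List ℕ → Set
OrderedBlocks B C = Disjoint B C × (NonCrossing B C × NonCrossing C B) × headOr0 B < headOr0 C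

module _ {n : ℕ} {F : Forest}
  (oks : All (λ p → ComponentOk p × All (λ i → 1 ≤ i × i ≤ n) (proj₁ p)) F)
  (counted : All (λ j → countIn (suc j) (blocks F) ≡ 1) (upTo n))
  (mins : AllPairs (λ B C → headOr0 B < headOr0 C) (blocks F))
  (ncs : AllPairs (λ B C → NonCrossing B C × NonCrossing C B) (blocks F)) where

  private
    in-range : ∀ {i} → Any (λ p → i ∈ proj₁ p) F → 1 ≤ i × i < suc n
    in-range i∈ = let _ , (_ , rng) , i∈p = lookup-any oks i∈ ; 1≤ , ≤n = All.lookup rng i∈p in 1≤ , s≤s ≤n

    once : ∀ {i} → 1 ≤ i → i < suc n → countIn i (blocks F) ≡ 1
    -- The test runs over j < n and asks about the label `suc j`.
    once {suc j} _ (s≤s j<n) = All.lookup counted (∈-upTo⁺ j<n)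

    disjoint : AllPairs Disjoint (blocks F)
    disjoint = countIn⇒disjoint (blocks F) λ i∈ →
      let 1≤ , <1+n = in-range (Anyₚ.map⁻ i∈) in ℕₚ.≤-reflexive (once 1≤ <1+n)

    pairwise : AllPairs OrderedBlocks (blocks F)
    pairwise = AllPairs.zip (disjoint , AllPairs.zip (ncs , mins))

  blocks-valid : PartialForest 1 0 (n , [] , F)
  blocks-valid = valid [] (All.map proj₁ oks) (AllPairs.map (λ (d , (nc , nc′) , h) → ordered d nc nc′ h) (AllPairsₚ.map⁻ pairwise))
    (All.tabulate λ _ → nested (λ ()) λ _ ())
    (λ { (inj₂ i∈) → in-range i∈ })
    (λ 1≤ <1+n → inj₂ (Anyₚ.map⁻ (countIn⇒covered (blocks F) (ℕₚ.≤-reflexive (sym (once 1≤ <1+n)))))) , refl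

isCForest⇒ : ∀ {n k r} F → T (isCForest n k r F) → PartialForest 1 0 (n , [] , F) × + yF F ≡ k × + qF F ≡ r
isCForest⇒ {n} {k} {r} F p =
  let oks , p₁ = T-∧⁻ {all (componentOK n) F} p
      cov , p₂ = T-∧⁻ {covers n (blocks F)} p₁
      mins , p₃ = T-∧⁻ {minsInc (blocks F)} p₂
      ncs , p₄ = T-∧⁻ {noncrossingAll (blocks F)} p₃
      k≡ , r≡ = T-∧⁻ {twiceHelF n F ==ℤ (+ 2 ℤ.* k)} p₄
      o = blocks-valid (All.map (λ {p} → componentOK⇒ n p) (Allₚ.all⁺ _ F oks))
            (All.map (λ {j} → ℕₚ.≡ᵇ⇒≡ (countIn (suc j) (blocks F)) 1) (Allₚ.all⁺ _ (upTo n) cov))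
            (AllPairsₚ.map⁻ (strictInc⇒ (map headOr0 (blocks F)) mins))
            (noncrossingAll⇒ (blocks F) ncs)
  in o , ℤₚ.*-cancelˡ-≡ (+ 2) (+ yF F) k (trans (sym (twiceHelF-degree o)) (toWitness k≡))
       , trans (sym (sum-dim (components (proj₁ o)))) (toWitness r≡)

⇒isCForest : ∀ {n k r} F → PartialForest 1 0 (n , [] , F) × + yF F ≡ k × + qF F ≡ r → T (isCForest n k r F)
⇒isCForest {n} {k} {r} F (o@(v , _) , k≡ , r≡) =
  T-∧⁺ {all (componentOK n) F} (Allₚ.all⁻ _ (All.zipWith ok (components v , All-elements λ i∈ → range v (inj₂ i∈))))
  (T-∧⁺ {covers n (blocks F)} (Allₚ.all⁻ _ (All.tabulate λ {j} j∈ → ℕₚ.≡⇒≡ᵇ (countIn (suc j) (blocks F)) 1 (once (∈-upTo⁻ j∈))))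
  (T-∧⁺ {minsInc (blocks F)} (⇒strictInc (AllPairsₚ.map⁺ (AllPairsₚ.map⁺ (AllPairs.map Ordered.heads (pairs v)))))
  (T-∧⁺ {noncrossingAll (blocks F)} (⇒noncrossingAll (AllPairsₚ.map⁺ (AllPairs.map both (pairs v))))
  (T-∧⁺ {twiceHelF n F ==ℤ (+ 2 ℤ.* k)} (fromWitness (trans (twiceHelF-degree o) (cong (+ 2 ℤ.*_) k≡)))
    (fromWitness (trans (sum-dim (components v)) r≡))))))
  where
  ok : ∀ {p} → ComponentOk p × (∀ {i} → i ∈ proj₁ p → 1 ≤ i × i < suc n) → T (componentOK n p)
  ok (c , rng) = ⇒componentOK n c (All.tabulate λ i∈ → let 1≤ , <1+n = rng i∈ in 1≤ , ℕₚ.≤-pred <1+n)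
  both : ∀ {p p′} → Ordered p p′ → NonCrossing (proj₁ p) (proj₁ p′) × NonCrossing (proj₁ p′) (proj₁ p)
  both o = Ordered.nc o , Ordered.nc′ o
  disjoint : ∀ {p p′} → Ordered p p′ → Disjoint (proj₁ p) (proj₁ p′)
  disjoint o = Ordered.disjoint o
  once : ∀ {j} → j < n → countIn (suc j) (blocks F) ≡ 1
  once j<n with cover v (s≤s z≤n) (s≤s j<n)
  ... | inj₂ i∈ = disjoint⇒countIn (AllPairsₚ.map⁺ (AllPairs.map disjoint (pairs v))) (Anyₚ.map⁺ i∈)

cforest-card : ∀ {S : Ser} → (∀ n → Count partialWeight (PartialForest 1 0) n (S n)) →
  ∀ n k r → Card (T ∘ isCForest n k r) (coeff S n k r)
cforest-card counts n (+ k) (+ r) = card-bijection (proj₂ ∘ proj₂) (λ F → n , [] , F)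
  (λ { {_ , [] , F} (o , refl , k≡ , r≡) → ⇒isCForest {n} {+ k} {+ r} F (o , cong +_ k≡ , cong +_ r≡) })
  (λ {F} p → let o , k≡ , r≡ = isCForest⇒ {n} {+ k} {+ r} F p in o , refl , ℤₚ.+-injective k≡ , ℤₚ.+-injective r≡)
  (λ { {_ , [] , _} (_ , refl , _) → refl }) (λ _ → refl) (counts n k r)
cforest-card counts n (+ k) ℤ.-[1+ r ] = card-∅ λ {F} p → case isCForest⇒ {n} {+ k} { ℤ.-[1+ r ]} F p of λ { (_ , _ , ()) }
cforest-card counts n ℤ.-[1+ k ] r = card-∅ λ {F} p → case isCForest⇒ {n} { ℤ.-[1+ k ]} {r} F p of λ { (_ , () , _) }

theorem3p20 : (C Cinv H F Gforest : Ser)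
    → C ⊗ Cden ≈ Cnum
    → ZeroAtX0 Cinv → comp C Cinv ≈ X → comp Cinv C ≈ X
    → H ⊗ (𝟙 ⊕ Gtree Cinv) ≈ X
    → ZeroAtX0 F → comp H F ≈ X → comp F H ≈ X
    → X ⊗ Gforest ≈ F
    → (∀ (n : ℕ) (k r : ℤ) → ∃[ m ] (coeff (Gtree Cinv) n k r ≡ + m × (Fin m ↔ CTree n k r)))
    × (∀ (n : ℕ) (k r : ℤ) → ∃[ m ] (coeff Gforest n k r ≡ + m × (Fin m ↔ CForest n k r)))
    × (∀ (n b c : ℕ) → + suc n * Gforest n b c ≡ pow (𝟙 ⊕ Gtree Cinv) (suc n) n b c)
theorem3p20 C Cinv H F Gforest hC Cinv₀ CCinv _ hH F₀ HF FH xG =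
  (λ n k r → card-↔ (ctree-card tree-counts n k r)) ,
  (λ n k r → card-↔ (cforest-card forest-counts n k r)) ,
  forest-lagrange
  where
  T₀ : Cinv 0 R.≈ R.0#
  T₀ = Sy.mk λ b → Sq.mk λ c → Cinv₀ b c

  open Compositional Cinv T₀

  inverse-eq = total {C} hC CCinv

  -- The trees hanging from b₁ are counted by `Cinv` itself; `Gtree` adds b₁ and the boundary
  -- leaves.
  tree-counts : ∀ n → Count treeWeight AnyKind n (Cinv n)
  tree-counts = TreeCounting.tree-count {Cinv} {Kinds.white} {Kinds.black} {Kinds.generic} {Kinds.generic₀} T₀
    (Kinds.t-kinds inverse-eq) (Kinds.white-eq inverse-eq) (Kinds.black-eq inverse-eq)
    (Kinds.generic-eq inverse-eq) (Kinds.generic₀-eq inverse-eq)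

  Gt : Ser
  Gt = Gtree Cinv

  φ≋ : 𝟙 ⊕ Gt ≋ 1ˢ +ˢ Gt
  φ≋ = ⊕-cong 𝟙≋ (S.refl {Gt})

  φ₀ : (𝟙 ⊕ Gt) 0 R.≈ R.1#
  φ₀ = R.trans (at φ≋ 0) (R.trans (R.+-congˡ {R.1#} (R.trans (at (⊗-*ˢ X factor) 0)
      (R.trans (R.*-congʳ {factor 0} (at X≋ 0)) (Sx.x-*ˢ-zero factor)))) (R.+-identityʳ R.1#))
    where
    factor = 𝟙 ⊕ Y ⊕ Y ⊗ Q ⊗ Cinv

  open ForestSeries {𝟙 ⊕ Gt} {H} {F} {Gforest} hH φ₀ F₀ HF FH xG

  forest-counts : ∀ n → Count partialWeight (PartialForest 1 0) n (Gforest n)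
  forest-counts = ForestCounting.forest-count {Gt} {Gforest} (gtree-count tree-counts)
    (S.trans forest-fixpoint (mk λ n → Sx.compose-congˡ (x *ˢ Gforest) n λ i _ → at φ≋ i))
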